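{- Both Fitting Hexasort and Empty Hexasort can be decided, on an instance $(G,S,t)$ with $G=(V,E)$ and color set $C$, in time $\mathcal{O}\bigl(|S|\cdot(|C|\cdot t)^{|V|}\bigr)$.
   Context: An instance $(G,S,t)$ of Hexasort consists of a finite simple undirected graph $G=(V,E)$, a threshold $t\in\mathbb{N}^+$, and a finite sequence $S$ of stacks with colors $C$; each stack $s=(c,h)\in S$ has a color $c\in C$ and a height $h\in\mathbb{N}^+$. A configuration is a function $\delta:V\to (C\times\mathbb{N}^+)\cup\{\perp\}$, where $\delta(v)=\perp$ means $v$ is empty and $\delta(v)=(c,h)$ means $v$ hosts a stack of color $c$ and height $h$. Initially $\delta(v)=\perp$ for all $v$. The stacks of $S$ are placed one after the other in the given order. To place the next stack $(c,h)$, the player chooses an empty vertex $x$; let $N_c[x]$ be the set of non-empty neighbors of $x$ hosting a stack of color $c$, and let $h'$ be the sum of their heights. The new configuration $\delta'$ is obtained from $\delta$ by setting $\delta'(u)=\perp$ for all $u\in N_c[x]$, and setting $\delta'(x)=\perp$ if $h+h'\ge t$ (the stacks vanish) and $\delta'(x)=(c,h+h')$ otherwise. Empty Hexasort asks whether all stacks of $S$ can be placed in the given order such that all vertices are empty after $S$ is exhausted. Fitting Hexasort asks only whether all stacks of $S$ can be placed in the given order. Standing assumptions: $h\le t$ for all $(c,h)\in S$; and, for Empty Hexasort, for every color $c\in C$ the sum of the heights of the color-$c$ stacks in $S$ is at least $t$. -}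

module Defs where

open import Data.Bool.Base using (Bool; true; false; _∧_; if_then_else_)
open import Data.Fin.Base using (Fin; toℕ)
open import Data.Fin.Properties using (_≟_)
open import Data.List.Base
  using (List; []; _∷_; _++_; map; concatMap; cartesianProductWith; length; filterᵇ; allFin)
open import Data.List.Relation.Unary.All using (All)
open import Data.Maybe.Base using (Maybe; just; nothing)
open import Data.Nat.Base
  using (ℕ; zero; suc; _+_; _*_; _∸_; _⊔_; _≤_; _≡ᵇ_; NonZero; >-nonZero; >-nonZero⁻¹)
open import Data.Nat.ListAction using (sum)
open import Data.Nat.Properties using (_≤?_; ≤-trans; m≤m+n)
open import Data.Product.Base using (_×_; _,_; ∃-syntax)
open import Data.Sum.Base using (_⊎_)
open import Relation.Binary.PropositionalEquality.Core using (_≡_; _≢_)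
open import Relation.Nullary using (¬_; does)

record Graph (n : ℕ) : Set where
  field
    adjacent    : Fin n → Fin n → Bool
    symmetric   : ∀ u v → adjacent u v ≡ adjacent v u
    irreflexive : ∀ v → adjacent v v ≡ false

record Stack (k : ℕ) : Set where
  constructor stack
  field
    colour : Fin k
    height : ℕ
    .{{height≢0}} : NonZero height

open Stack public

Configuration : (n k : ℕ) → Set
Configuration n k = Fin n → Maybe (Stack k)

allEmpty : ∀ {n k} → Configuration n k
allEmpty _ = nothing

hasColour : ∀ {k} → Fin k → Stack k → Bool
hasColour c s = does (colour s ≟ c)

hosts : ∀ {k} → Fin k → Maybe (Stack k) → Bool
hosts c nothing  = false
hosts c (just s) = hasColour c s

hostedHeight : ∀ {k} → Maybe (Stack k) → ℕ
hostedHeight nothing  = 0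
hostedHeight (just s) = height s

raise : ∀ {k} → Stack k → ℕ → Stack k
raise (stack c h) h′ =
  stack c (h + h′) {{>-nonZero (≤-trans (>-nonZero⁻¹ h) (m≤m+n h h′))}}

module _ {n k : ℕ} (G : Graph n) (t : ℕ) where
  open Graph G

  -- Membership in N_c[x].
  merges : Configuration n k → Fin k → Fin n → Fin n → Bool
  merges δ c x u = adjacent x u ∧ hosts c (δ u)

  mergedHeight : Configuration n k → Fin k → Fin n → ℕ
  mergedHeight δ c x =
    sum (map (λ u → hostedHeight (δ u)) (filterᵇ (merges δ c x) (allFin n)))

  place : Configuration n k → Stack k → Fin n → Configuration n k
  place δ s x u =
    if does (u ≟ x)
    then (if does (t ≤? height s + h′) then nothing else just (raise s h′))
    else (if merges δ (colour s) x u then nothing else δ u)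
    where
    h′ : ℕ
    h′ = mergedHeight δ (colour s) x

  -- Plays δ S δ′: placing the stacks of S in order can turn δ into δ′.
  data Plays : Configuration n k → List (Stack k) → Configuration n k → Set where
    done : ∀ {δ} → Plays δ [] δ
    move : ∀ {δ s S δ′} (x : Fin n) → δ x ≡ nothing →
           Plays (place δ s x) S δ′ → Plays δ (s ∷ S) δ′

record Instance : Set where
  field
    vertices  : ℕ
    colours   : ℕ
    graph     : Graph vertices
    threshold : ℕ
    .{{threshold≢0}} : NonZero threshold
    stacks    : List (Stack colours)

  CanReach : Configuration vertices colours → Set
  CanReach = Plays graph threshold allEmpty stacks

FittingHexasort : Instance → Set
FittingHexasort I = ∃[ δ ] CanReach δ
  where open Instance I

EmptyHexasort : Instance → Set
EmptyHexasort I = ∃[ δ ] CanReach δ × (∀ v → δ v ≡ nothing)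
  where open Instance I

HeightsBounded : Instance → Set
HeightsBounded I = All (λ s → height s ≤ threshold) stacks
  where open Instance I

ColoursSuffice : Instance → Set
ColoursSuffice I =
  ∀ c → threshold ≤ sum (map height (filterᵇ (hasColour c) stacks))
  where open Instance I

-- A random access machine with unit-cost instructions, programmed by
-- structured programs.  Registers are addressed by constants only, memory
-- cells by computed addresses.  Addition and truncated subtraction are the
-- only arithmetic: with unit-cost multiplication, a short run could build
-- numbers too large for unit cost to be a sensible measure of time.

data Expr : Set where
  lit       : ℕ → Expr
  reg       : ℕ → Expr
  load      : Expr → Expr
  _⊕_ _⊖_   : Expr → Expr → Expr

infixl 6 _⊕_ _⊖_
infix  4 _≔_ [_]≔_
infixr 3 _⨾_

data Program : Set where
  skip            : Program
  _≔_             : ℕ → Expr → Program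
  [_]≔_           : Expr → Expr → Program
  _⨾_             : Program → Program → Program
  ifNonZero_then_else_ : Expr → Program → Program → Program
  whileNonZero_repeat_ : Expr → Program → Program

record State : Set where
  constructor state
  field
    regs : ℕ → ℕ
    mem  : ℕ → ℕ

open State public

_[_↦_] : (ℕ → ℕ) → ℕ → ℕ → (ℕ → ℕ)
(f [ a ↦ v ]) b = if a ≡ᵇ b then v else f b

⟦_⟧ : Expr → State → ℕ
⟦ lit m ⟧    σ = m
⟦ reg r ⟧    σ = regs σ r
⟦ load e ⟧   σ = mem σ (⟦ e ⟧ σ)
⟦ e₁ ⊕ e₂ ⟧  σ = ⟦ e₁ ⟧ σ + ⟦ e₂ ⟧ σ
⟦ e₁ ⊖ e₂ ⟧  σ = ⟦ e₁ ⟧ σ ∸ ⟦ e₂ ⟧ σ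

cost : Expr → ℕ
cost (lit _)   = 1
cost (reg _)   = 1
cost (load e)  = suc (cost e)
cost (e₁ ⊕ e₂) = suc (cost e₁ + cost e₂)
cost (e₁ ⊖ e₂) = suc (cost e₁ + cost e₂)

-- ⟨ p , σ ⟩⇓ σ′ [ T ]: started in σ, p halts in σ′ after T steps.
data ⟨_,_⟩⇓_[_] : Program → State → State → ℕ → Set where
  ⇓skip : ∀ {σ} → ⟨ skip , σ ⟩⇓ σ [ 1 ]
  ⇓reg  : ∀ {r e σ} →
          ⟨ r ≔ e , σ ⟩⇓ state (regs σ [ r ↦ ⟦ e ⟧ σ ]) (mem σ) [ suc (cost e) ]
  ⇓mem  : ∀ {a e σ} →
          ⟨ [ a ]≔ e , σ ⟩⇓ state (regs σ) (mem σ [ ⟦ a ⟧ σ ↦ ⟦ e ⟧ σ ])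
            [ suc (cost a + cost e) ]
  ⇓seq  : ∀ {p q σ σ′ σ″ T T′} →
          ⟨ p , σ ⟩⇓ σ′ [ T ] → ⟨ q , σ′ ⟩⇓ σ″ [ T′ ] →
          ⟨ p ⨾ q , σ ⟩⇓ σ″ [ T + T′ ]
  ⇓then : ∀ {e p q σ σ′ T} → ⟦ e ⟧ σ ≢ 0 → ⟨ p , σ ⟩⇓ σ′ [ T ] →
          ⟨ ifNonZero e then p else q , σ ⟩⇓ σ′ [ suc (cost e + T) ]
  ⇓else : ∀ {e p q σ σ′ T} → ⟦ e ⟧ σ ≡ 0 → ⟨ q , σ ⟩⇓ σ′ [ T ] →
          ⟨ ifNonZero e then p else q , σ ⟩⇓ σ′ [ suc (cost e + T) ]
  ⇓exit : ∀ {e p σ} → ⟦ e ⟧ σ ≡ 0 →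
          ⟨ whileNonZero e repeat p , σ ⟩⇓ σ [ suc (cost e) ]
  ⇓loop : ∀ {e p σ σ′ σ″ T T′} → ⟦ e ⟧ σ ≢ 0 →
          ⟨ p , σ ⟩⇓ σ′ [ T ] → ⟨ whileNonZero e repeat p , σ′ ⟩⇓ σ″ [ T′ ] →
          ⟨ whileNonZero e repeat p , σ ⟩⇓ σ″ [ suc (cost e + T + T′) ]

contents : List ℕ → ℕ → ℕ
contents []       _       = 0
contents (m ∷ _)  zero    = m
contents (_ ∷ ms) (suc a) = contents ms a

-- Registers 0–3 hold |V|, |C|, t, |S|.  Memory holds the stacks, as pairs
-- (colour, height), and then the adjacency matrix in row-major order.  All
-- other registers and cells are zero.
encode : Instance → State
encode I = state
  (contents (vertices ∷ colours ∷ threshold ∷ length stacks ∷ []))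
  (contents (concatMap (λ s → toℕ (colour s) ∷ height s ∷ []) stacks
             ++ cartesianProductWith
                  (λ u v → if Graph.adjacent graph u v then 1 else 0)
                  (allFin vertices) (allFin vertices)))
  where open Instance I

Answers : Set → ℕ → Set
Answers P b = (P × b ≡ 1) ⊎ (¬ P × b ≡ 0)

-- A single program decides the problem on all instances satisfying the
-- promise, in time O(f), leaving its answer in register 0.  A run takes at
-- least one step, so f is read as 1 where it vanishes.
DecidableInTime : (Promise Problem : Instance → Set) → (Instance → ℕ) → Set
DecidableInTime Promise Problem f =
  ∃[ p ] ∃[ K ] ∀ (I : Instance) → Promise I →
    ∃[ σ ] ∃[ T ] ⟨ p , encode I ⟩⇓ σ [ T ]
                × T ≤ K * (f I ⊔ 1)
                × Answers (Problem I) (regs σ 0)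

{-# OPTIONS --safe #-}

-- Dynamic programming over the suffixes of S: a table indexed by the codes of
-- configurations (base |C| t, digit c t + h on a vertex that hosts (c , h))
-- marks those from which the remaining stacks can be placed with success.  For
-- each stack and each vertex x, the configurations with x empty are listed
-- together with the code after the placement on x, one vertex being filled at a
-- time, which takes constant time per configuration.
--
-- With M = |C| (t - 1) + 1 states per vertex, this makes |V| M ^ (|V| - 1) moves
-- per stack, which is at most (M + 1) ^ |V|, hence within the bound, when
-- |C| > 1.  With one colour, M = t, and the factor |V| has to be saved.  Fitting
-- is then trivial: two adjacent vertices take any sequence of stacks, and
-- without edges it suffices to count the empty vertices.  For Empty, adjacent
-- vertices never both host a stack, so a matched pair has 2 t - 1 instead of t²
-- states, and isolated vertices are never filled.  Take a greedy maximal
-- matching.  If every vertex has at most 2 t unmatched neighbours, then the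
-- matching has enough edges to make up for the factor |V|.  Otherwise a vertex
-- has 2 t pairwise non-adjacent neighbours, and the answer is yes exactly if
-- the last stack has height t or the stacks of height below t sum up to t.

module Submission where

open import Defs
open import Algebra.Properties.CommutativeMonoid.Sum using (sum-cong-≗; ∑-distrib-+; ∑-comm)
open import Data.Bool.Base using (Bool; true; false; _∧_; _∨_; not; if_then_else_; T)
open import Data.Fin.Base using (Fin; zero; suc; toℕ; fromℕ<)
open import Data.Fin.Properties using (toℕ-injective; toℕ<n; toℕ-fromℕ<) renaming (_≟_ to _≟ᶠ_)
open import Data.List.Base
  using (List; []; _∷_; [_]; _++_; map; concatMap; cartesianProductWith; length; filterᵇ; allFin;
         applyUpTo; tabulate; foldl; initLast; _∷ʳ′_)
open import Data.List.Membership.Propositional using (_∈_)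
open import Data.List.Membership.Propositional.Properties using (∈-map⁺; ∈-map⁻; ∈-++⁺ˡ; ∈-++⁺ʳ; ∈-++⁻; ∈-applyUpTo⁺; ∈-applyUpTo⁻)
open import Data.List.Properties using (length-++; length-map; length-applyUpTo; length-tabulate; foldl-∷ʳ; map-cong; ++-identityʳ; ++-assoc; map-applyUpTo)
open import Data.List.Relation.Unary.All using (All; _∷_)
open import Data.List.Relation.Unary.Any using (here)
open import Data.Maybe.Base using (Maybe; just; nothing)
open import Data.Maybe.Properties using (just-injective)
open import Data.Nat.Base
import Data.Nat.ListAction as ListAction
open import Data.Nat.Properties
open import Data.Nat.DivMod using (_%_; [m+kn]%n≡m%n; m<n⇒m%n≡m)
open import Data.Nat.Tactic.RingSolver using (solve-∀)
open import Data.Product.Base using (_×_; _,_; ∃-syntax; proj₁; proj₂)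
open import Data.Sum.Base using (_⊎_; inj₁; inj₂)
open import Data.Unit.Base using (⊤; tt)
open import Data.Empty using (⊥; ⊥-elim)
open import Function.Base using (_∘_)
open import Relation.Binary.PropositionalEquality hiding ([_])
open import Relation.Nullary using (¬_; yes; no; contradiction; does; Dec)
open import Relation.Nullary.Decidable using (dec-true; dec-false)
open Algebra.Properties.CommutativeMonoid.Sum +-0-commutativeMonoid using () renaming (sum to ∑)

-- A language with counted loops

-- The bound leaves constant time per move, although a move may change many digits of a code. For a
-- fixed `x`, however, the code of a configuration, the height merged on `x` and the two possible
-- codes after the placement are all sums over the vertices. A stack on one more vertex therefore
-- adds the same few offsets to a whole block of rows, and nothing is ever decoded. The matching is
-- large enough by maximality: a non-isolated unmatched vertex is next to a matched one, so if no
-- vertex has more than 2 t unmatched neighbours, m edges leave at most 4 m t of them. Apart from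
-- isolated vertices, |V| is thus of order m t, which ((2 t - 1) / t²)^m outweighs. The criterion
-- for the star comes from the last placement, which has to bring height t together. A stack of
-- height t helps only if it is the last one, since it vanishes wherever it is placed. Conversely, 2
-- t leaves are room enough to collect what is needed. Time is counted in loop iterations of a small
-- language whose loops cannot change their own counters; compilation costs a constant factor.

data Term : Set where
  con var   : ℕ → Term
  input     : Term → Term
  cell      : ℕ → Term → Term
  _⊞_ _⊟_   : Term → Term → Term

infixl 6 _⊞_ _⊟_
infix  4 _:=_ _[_]:=_
infixr 3 _▸_

-- In for i / l below e loop p, register i counts up to the value that e has on
-- entry, which register l keeps.
data Command : Set where
  nop                 : Command
  _:=_                : ℕ → Term → Command
  _[_]:=_             : ℕ → Term → Term → Command
  _▸_                : Command → Command → Command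
  ifnz_then_else_     : Term → Command → Command → Command
  for_/_below_loop_     : ℕ → ℕ → Term → Command → Command

record Store : Set where
  constructor store
  field
    vars  : ℕ → ℕ
    cells : ℕ → ℕ → ℕ

open Store public

-- A syntactic over-approximation of what a command may change. On a concrete program it evaluates,
-- so that every framing condition below is proved by `refl`.
assigns : ℕ → Command → Bool
assigns r nop                      = false
assigns r (q := _)                 = q ≡ᵇ r
assigns r (_ [ _ ]:= _)            = false
assigns r (p ▸ q)                 = assigns r p ∨ assigns r q
assigns r (ifnz _ then p else q)   = assigns r p ∨ assigns r q
assigns r (for i / l below _ loop p) = (i ≡ᵇ r) ∨ (l ≡ᵇ r) ∨ assigns r p

updates : ℕ → Command → Bool
updates k nop                      = false
updates k (_ := _)                 = false
updates k (j [ _ ]:= _)            = j ≡ᵇ k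
updates k (p ▸ q)                 = updates k p ∨ updates k q
updates k (ifnz _ then p else q)   = updates k p ∨ updates k q
updates k (for _ / _ below _ loop p) = updates k p

-- Register 4 is reserved for the length of the input.
legalTerm : Term → Bool
legalTerm (con _)    = true
legalTerm (var _)    = true
legalTerm (input e)  = legalTerm e
legalTerm (cell k e) = (k <ᵇ 8) ∧ legalTerm e
legalTerm (e ⊞ f)    = legalTerm e ∧ legalTerm f
legalTerm (e ⊟ f)    = legalTerm e ∧ legalTerm f

-- A loop body must leave counter and limit alone: only then does the machine loop, which compares
-- the two registers afresh in every round, run as often as `execLoop`, which fixes the number of
-- rounds beforehand.
legal : Command → Bool
legal nop                      = true
legal (r := e)                 = not (r ≡ᵇ 4) ∧ legalTerm e
legal (k [ a ]:= e)            = (k <ᵇ 8) ∧ legalTerm a ∧ legalTerm e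
legal (p ▸ q)                 = legal p ∧ legal q
legal (ifnz e then p else q)   = legalTerm e ∧ legal p ∧ legal q
legal (for i / l below e loop p) =
  not (i ≡ᵇ 4) ∧ not (l ≡ᵇ 4) ∧ not (i ≡ᵇ l) ∧ not (assigns i p) ∧ not (assigns l p)
  ∧ legalTerm e ∧ legal p

choose : {A : Set} → ℕ → A → A → A
choose zero    x y = y
choose (suc _) x y = x

choose-zero : ∀ {A : Set} {a b : A} {m} → m ≡ 0 → choose m a b ≡ b
choose-zero refl = refl

choose-pos : ∀ {A : Set} {a b : A} {m} → m ≢ 0 → choose m a b ≡ a
choose-pos {m = zero}  ne = contradiction refl ne
choose-pos {m = suc _} ne = refl

setCell : (ℕ → ℕ → ℕ) → ℕ → ℕ → ℕ → (ℕ → ℕ → ℕ)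
setCell cs k a v j = if k ≡ᵇ j then cs j [ a ↦ v ] else cs j

setVar : ℕ → ℕ → Store → Store
setVar r v h = store (vars h [ r ↦ v ]) (cells h)

bump : ℕ → Store → Store
bump i h = setVar i (vars h i + 1) h

≡ᵇ-refl : ∀ a → (a ≡ᵇ a) ≡ true
≡ᵇ-refl zero    = refl
≡ᵇ-refl (suc a) = ≡ᵇ-refl a

≢⇒≡ᵇ : ∀ a b → a ≢ b → (a ≡ᵇ b) ≡ false
≢⇒≡ᵇ zero    zero    ne = contradiction refl ne
≢⇒≡ᵇ zero    (suc b) ne = refl
≢⇒≡ᵇ (suc a) zero    ne = refl
≢⇒≡ᵇ (suc a) (suc b) ne = ≢⇒≡ᵇ a b (ne ∘ cong suc)

upd-same : ∀ f a v → (f [ a ↦ v ]) a ≡ v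
upd-same f a v rewrite ≡ᵇ-refl a = refl

upd-other : ∀ f {a b} v → a ≢ b → (f [ a ↦ v ]) b ≡ f b
upd-other f {a} {b} v ne rewrite ≢⇒≡ᵇ a b ne = refl

upd-≡ᵇ : ∀ f a b v → (a ≡ᵇ b) ≡ false → (f [ a ↦ v ]) b ≡ f b
upd-≡ᵇ f a b v eq rewrite eq = refl

∨-falseˡ : ∀ {a b} → (a ∨ b) ≡ false → a ≡ false
∨-falseˡ {false} _ = refl

∨-falseʳ : ∀ a {b} → (a ∨ b) ≡ false → b ≡ false
∨-falseʳ false eq = eq

∧-trueˡ : ∀ {a b} → (a ∧ b) ≡ true → a ≡ true
∧-trueˡ {true} _ = refl

∧-trueʳ : ∀ a {b} → (a ∧ b) ≡ true → b ≡ true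
∧-trueʳ true eq = eq

not-true : ∀ {a} → not a ≡ true → a ≡ false
not-true {false} _ = refl

-- Semantics of commands, and a program logic with step bounds

module Semantics (inp : ℕ → ℕ) where

  val : Term → Store → ℕ
  val (con m)    h = m
  val (var r)    h = vars h r
  val (input e)  h = inp (val e h)
  val (cell k e) h = cells h k (val e h)
  val (e ⊞ f)    h = val e h + val f h
  val (e ⊟ f)    h = val e h ∸ val f h

  exec     : Command → Store → Store
  execLoop : ℕ → Command → ℕ → Store → Store

  exec nop h                      = h
  exec (r := e) h                 = setVar r (val e h) h
  exec (k [ a ]:= e) h            = store (vars h) (setCell (cells h) k (val a h) (val e h))
  exec (p ▸ q) h                 = exec q (exec p h)
  exec (ifnz e then p else q) h   = choose (val e h) (exec p h) (exec q h)
  exec (for i / l below e loop p) h = execLoop i p (val e h) (setVar i 0 (setVar l (val e h) h))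

  execLoop i p zero    h = h
  execLoop i p (suc m) h = execLoop i p m (bump i (exec p h))

  -- Only loop iterations are counted; all else costs a constant factor, the weight.
  steps     : Command → Store → ℕ
  stepsLoop : ℕ → Command → ℕ → Store → ℕ

  steps nop h                      = 0
  steps (_ := _) h                 = 0
  steps (_ [ _ ]:= _) h            = 0
  steps (p ▸ q) h                 = steps p h + steps q (exec p h)
  steps (ifnz e then p else q) h   = choose (val e h) (steps p h) (steps q h)
  steps (for i / l below e loop p) h = stepsLoop i p (val e h) (setVar i 0 (setVar l (val e h) h))

  stepsLoop i p zero    h = 0
  stepsLoop i p (suc m) h = suc (steps p h) + stepsLoop i p m (bump i (exec p h))

  frameVar     : ∀ p h r → assigns r p ≡ false → vars (exec p h) r ≡ vars h r
  frameVarLoop : ∀ i p m h r → (i ≡ᵇ r) ≡ false → assigns r p ≡ false →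
                 vars (execLoop i p m h) r ≡ vars h r

  frameVar nop h r eq = refl
  frameVar (q := e) h r eq = upd-≡ᵇ (vars h) q r (val e h) eq
  frameVar (k [ a ]:= e) h r eq = refl
  frameVar (p ▸ q) h r eq =
    trans (frameVar q (exec p h) r (∨-falseʳ (assigns r p) eq)) (frameVar p h r (∨-falseˡ eq))
  frameVar (ifnz e then p else q) h r eq with val e h
  ... | zero  = frameVar q h r (∨-falseʳ (assigns r p) eq)
  ... | suc _ = frameVar p h r (∨-falseˡ eq)
  frameVar (for i / l below e loop p) h r eq =
    trans (frameVarLoop i p (val e h) _ r i≢r (∨-falseʳ (l ≡ᵇ r) (∨-falseʳ (i ≡ᵇ r) eq)))
      (trans (upd-≡ᵇ (vars h [ l ↦ val e h ]) i r 0 i≢r) (upd-≡ᵇ (vars h) l r (val e h) (∨-falseˡ (∨-falseʳ (i ≡ᵇ r) eq))))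
    where
    i≢r : (i ≡ᵇ r) ≡ false
    i≢r = ∨-falseˡ eq

  frameVarLoop i p zero    h r i≢r eq = refl
  frameVarLoop i p (suc m) h r i≢r eq =
    trans (frameVarLoop i p m _ r i≢r eq)
      (trans (upd-≡ᵇ (vars (exec p h)) i r _ i≢r) (frameVar p h r eq))

  frameCell     : ∀ p h k → updates k p ≡ false → cells (exec p h) k ≡ cells h k
  frameCellLoop : ∀ i p m h k → updates k p ≡ false → cells (execLoop i p m h) k ≡ cells h k

  frameCell nop h k eq = refl
  frameCell (q := e) h k eq = refl
  frameCell (j [ a ]:= e) h k eq rewrite eq = refl
  frameCell (p ▸ q) h k eq =
    trans (frameCell q (exec p h) k (∨-falseʳ (updates k p) eq)) (frameCell p h k (∨-falseˡ eq))
  frameCell (ifnz e then p else q) h k eq with val e h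
  ... | zero  = frameCell q h k (∨-falseʳ (updates k p) eq)
  ... | suc _ = frameCell p h k (∨-falseˡ eq)
  frameCell (for i / l below e loop p) h k eq = frameCellLoop i p (val e h) _ k eq

  frameCellLoop i p zero    h k eq = refl
  frameCellLoop i p (suc m) h k eq =
    trans (frameCellLoop i p m _ k eq) (frameCell p h k eq)

  record Frame (p : Command) (h g : Store) : Set where
    field
      var≡  : ∀ r → assigns r p ≡ false → vars g r ≡ vars h r
      cell≡ : ∀ k → updates k p ≡ false → cells g k ≡ cells h k

  open Frame public

  exec-frame : ∀ p h → Frame p h (exec p h)
  exec-frame p h = record { var≡ = frameVar p h ; cell≡ = frameCell p h }

  -- A Hoare triple at one initial store together with a time bound; since `exec` is total, it
  -- expresses total correctness.
  record Run (p : Command) (h : Store) (t : ℕ) (Q : Store → Set) : Set where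
    constructor run
    field
      steps≤ : steps p h ≤ t
      post   : Q (exec p h)

  open Run public

  -- The continuation receives a `Frame` besides `Q`, so a postcondition has to mention only what
  -- `p` changes.
  run-seq : ∀ {p q h t₁ t₂ Q R} → Run p h t₁ Q →
            (∀ g → Frame p h g → Q g → Run q g t₂ R) → Run (p ▸ q) h (t₁ + t₂) R
  run-seq {p} {h = h} (run s≤ Qg) next with next (exec p h) (exec-frame p h) Qg
  ... | run s≤′ Rg = run (+-mono-≤ s≤ s≤′) Rg

  run-if : ∀ {e p q h t Q} → (val e h ≢ 0 → Run p h t Q) → (val e h ≡ 0 → Run q h t Q) →
           Run (ifnz e then p else q) h t Q
  run-if {e} {p} {q} {h} {Q = Q} th el = go (val e h) refl
    where
    go : ∀ v → val e h ≡ v → Run (ifnz e then p else q) h _ _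
    go zero    eq with el eq
    ... | run a b = run (subst (λ z → choose z (steps p h) (steps q h) ≤ _) (sym eq) a)
                        (subst (λ z → Q (choose z (exec p h) (exec q h))) (sym eq) b)
    go (suc v) eq with th (λ z → 0≢1+n (trans (sym z) eq))
    ... | run a b = run (subst (λ z → choose z (steps p h) (steps q h) ≤ _) (sym eq) a)
                        (subst (λ z → Q (choose z (exec p h) (exec q h))) (sym eq) b)

  run-mono : ∀ {p h t t′ Q R} → t ≤ t′ → (∀ {g} → Q g → R g) → Run p h t Q → Run p h t′ R
  run-mono t≤ f (run a b) = run (≤-trans a t≤) (f b)

  separate : ℕ → ℕ → Command → Bool
  separate i l p = not (i ≡ᵇ l) ∧ not (assigns i p) ∧ not (assigns l p)

  -- B k bounds the iterations made up to the k-th round, nested ones included.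
  run-for : ∀ {i l e p h n} (B : ℕ → ℕ) (I : ℕ → Store → Set) →
            separate i l p ≡ true → val e h ≡ n → I 0 (setVar i 0 (setVar l n h)) →
            (∀ k g → k < n → vars g i ≡ k → vars g l ≡ n →
               Frame (for i / l below e loop p) h g → I k g →
               ∃[ t ] suc (t + B k) ≤ B (suc k) × Run p g t (λ g′ → I (suc k) (bump i g′))) →
            Run (for i / l below e loop p) h (B n) (λ g → I n g × vars g i ≡ n × vars g l ≡ n)
  run-for {i} {l} {e} {p} {h} {n} B I sep refl I₀ body =
    from-loop (rounds n 0 _ (+-identityʳ n) at-i at-l frame₀ I₀)
    where
    i≢l : (i ≡ᵇ l) ≡ false
    i≢l = not-true (∧-trueˡ sep)
    i∉p : assigns i p ≡ false
    i∉p = not-true (∧-trueˡ (∧-trueʳ (not (i ≡ᵇ l)) sep))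
    l∉p : assigns l p ≡ false
    l∉p = not-true (∧-trueʳ (not (assigns i p)) (∧-trueʳ (not (i ≡ᵇ l)) sep))
    h₀ : Store
    h₀ = setVar i 0 (setVar l n h)
    at-i : vars h₀ i ≡ 0
    at-i = upd-same (vars h [ l ↦ n ]) i 0
    at-l : vars h₀ l ≡ n
    at-l = trans (upd-≡ᵇ (vars h [ l ↦ n ]) i l 0 i≢l) (upd-same (vars h) l n)
    frame₀ : Frame (for i / l below e loop p) h h₀
    frame₀ = record
      { var≡  = λ r eq → trans (upd-≡ᵇ (vars h [ l ↦ n ]) i r 0 (∨-falseˡ eq))
                               (upd-≡ᵇ (vars h) l r n (∨-falseˡ (∨-falseʳ (i ≡ᵇ r) eq)))
      ; cell≡ = λ k eq → refl }
    -- With `m` rounds left and `k` done, the steps still to come fit between `B k` and `B n`: the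
    -- bound telescopes.
    rounds : ∀ m k g → m + k ≡ n → vars g i ≡ k → vars g l ≡ n →
           Frame (for i / l below e loop p) h g → I k g →
           stepsLoop i p m g + B k ≤ B n
           × I n (execLoop i p m g) × vars (execLoop i p m g) i ≡ n
           × vars (execLoop i p m g) l ≡ n
    rounds zero    k g refl gi gl F Ik = ≤-refl , Ik , gi , gl
    rounds (suc m) k g eq gi gl F Ik
      with body k g (subst (k <_) eq (s≤s (m≤n+m k m))) gi gl F Ik
    ... | t , t≤ , run s≤ Ik′
      with rounds m (suc k) (bump i (exec p g)) (trans (+-suc m k) eq)
             (trans (upd-same (vars (exec p g)) i _)
               (trans (cong (_+ 1) (trans (frameVar p g i i∉p) gi)) (+-comm k 1)))
             (trans (upd-≡ᵇ (vars (exec p g)) i l _ i≢l) (trans (frameVar p g l l∉p) gl))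
             (record
               { var≡  = λ r z → trans (upd-≡ᵇ (vars (exec p g)) i r _ (∨-falseˡ z))
                   (trans (frameVar p g r (∨-falseʳ (l ≡ᵇ r) (∨-falseʳ (i ≡ᵇ r) z)))
                          (var≡ F r z))
               ; cell≡ = λ j z → trans (frameCell p g j z) (cell≡ F j z) })
             Ik′
    ... | b≤ , rest = ≤-trans
            (≤-trans (≤-reflexive (arith (steps p g) (stepsLoop i p m (bump i (exec p g))) (B k)))
              (+-monoʳ-≤ (stepsLoop i p m (bump i (exec p g)))
                (≤-trans (s≤s (+-monoˡ-≤ (B k) s≤)) t≤))) b≤ , rest
      where
      arith : ∀ a b c → suc a + b + c ≡ b + suc (a + c)
      arith = solve-∀
    from-loop : stepsLoop i p n h₀ + B 0 ≤ B n
           × I n (execLoop i p n h₀) × vars (execLoop i p n h₀) i ≡ n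
           × vars (execLoop i p n h₀) l ≡ n →
           Run (for i / l below e loop p) h (B n) (λ g → I n g × vars g i ≡ n × vars g l ≡ n)
    from-loop (b , rest) = run (≤-trans (m≤m+n _ (B 0)) b) rest

  after : ∀ {r e q h T Q} → Run q (exec (r := e) h) T Q → Run ((r := e) ▸ q) h T Q
  after (run a b) = run a b

  after-cell : ∀ {j a e q h T Q} → Run q (exec (j [ a ]:= e) h) T Q → Run ((j [ a ]:= e) ▸ q) h T Q
  after-cell (run a b) = run a b

  run-frame : ∀ {p h T Q} → Run p h T Q → Run p h T (λ g → Frame p h g × Q g)
  run-frame {p} {h} (run a b) = run a (exec-frame p h , b)

  run-for-const : ∀ {i l e p h m} b (I : ℕ → Store → Set) →
    separate i l p ≡ true → val e h ≡ m → I 0 (setVar i 0 (setVar l m h)) →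
    (∀ j g → j < m → vars g i ≡ j → Frame (for i / l below e loop p) h g → I j g →
       Run p g b (λ g′ → I (suc j) (bump i g′))) →
    Run (for i / l below e loop p) h (m * suc b) (I m)
  run-for-const b I sep eq I₀ body = run-mono ≤-refl proj₁
    (run-for (λ j → j * suc b) I sep eq I₀
      (λ j g j< at-i at-l F Ij → b , ≤-refl , body j g j< at-i F Ij))

-- Compilation to the machine

-- There is no multiplication, so the index expression is written out eight times. Since the program
-- is fixed, the blow-up of nested accesses only affects the constant.
octuple : Expr → Expr
octuple e = ((e ⊕ e) ⊕ (e ⊕ e)) ⊕ ((e ⊕ e) ⊕ (e ⊕ e))

oct : ℕ → ℕ
oct i = ((i + i) + (i + i)) + ((i + i) + (i + i))

-- The eight arrays are interleaved behind the input.
address : ℕ → Expr → Expr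
address k e = (reg 4 ⊕ lit (suc k)) ⊕ octuple e

-- load (e ⊖ (e ⊖ reg 4)) reads cell min (e, length of the input), so that a
-- read past the input yields 0.
⌊_⌋ₜ : Term → Expr
⌊ con m ⌋ₜ    = lit m
⌊ var r ⌋ₜ    = reg r
⌊ input e ⌋ₜ  = load (⌊ e ⌋ₜ ⊖ (⌊ e ⌋ₜ ⊖ reg 4))
⌊ cell k e ⌋ₜ = load (address k ⌊ e ⌋ₜ)
⌊ e ⊞ f ⌋ₜ    = ⌊ e ⌋ₜ ⊕ ⌊ f ⌋ₜ
⌊ e ⊟ f ⌋ₜ    = ⌊ e ⌋ₜ ⊖ ⌊ f ⌋ₜ

⌊_⌋ : Command → Program
⌊ nop ⌋                      = skip
⌊ r := e ⌋                   = r ≔ ⌊ e ⌋ₜ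
⌊ k [ a ]:= e ⌋              = [ address k ⌊ a ⌋ₜ ]≔ ⌊ e ⌋ₜ
⌊ p ▸ q ⌋                   = ⌊ p ⌋ ⨾ ⌊ q ⌋
⌊ ifnz e then p else q ⌋     = ifNonZero ⌊ e ⌋ₜ then ⌊ p ⌋ else ⌊ q ⌋
⌊ for i / l below e loop p ⌋   =
  l ≔ ⌊ e ⌋ₜ ⨾ i ≔ lit 0 ⨾ whileNonZero (reg l ⊖ reg i) repeat (⌊ p ⌋ ⨾ i ≔ reg i ⊕ lit 1)

-- Chosen so that the machine needs at most `weight p * suc (steps p h)` steps. The 15 of a loop is
-- 8 per round, 4 each for the test and the increment, and 7 once, for the two initialisations (the
-- cost of the limit aside) and the final test.
weight : Command → ℕ
weight nop                      = 1
weight (r := e)                 = suc (cost ⌊ e ⌋ₜ)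
weight (k [ a ]:= e)            = suc (cost (address k ⌊ a ⌋ₜ) + cost ⌊ e ⌋ₜ)
weight (p ▸ q)                 = weight p + weight q
weight (ifnz e then p else q)   = suc (cost ⌊ e ⌋ₜ + (weight p + weight q))
weight (for i / l below e loop p) = cost ⌊ e ⌋ₜ + (15 + weight p)

oct≡ : ∀ i → oct i ≡ i * 8
oct≡ i = ring i
  where
  ring : ∀ i → ((i + i) + (i + i)) + ((i + i) + (i + i)) ≡ i * 8
  ring = solve-∀

+-*-injective : ∀ d {k j i i′} .{{_ : NonZero d}} → k < d → j < d →
                k + i * d ≡ j + i′ * d → k ≡ j × i ≡ i′
+-*-injective d {k} {j} {i} {i′} k<d j<d eq =
  k≡j , *-cancelʳ-≡ i i′ d (+-cancelˡ-≡ k _ _ (trans eq (cong (_+ i′ * d) (sym k≡j))))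
  where
  k≡j : k ≡ j
  k≡j = trans (sym (m<n⇒m%n≡m k<d)) (trans (sym ([m+kn]%n≡m%n k i d))
          (trans (cong (_% d) eq) (trans ([m+kn]%n≡m%n j i′ d) (m<n⇒m%n≡m j<d))))

oct-injective : ∀ {k j i i′} → k < 8 → j < 8 → k + oct i ≡ j + oct i′ → k ≡ j × i ≡ i′
oct-injective {k} {j} {i} {i′} k<8 j<8 eq = +-*-injective 8 k<8 j<8
  (trans (cong (k +_) (sym (oct≡ i))) (trans eq (cong (j +_) (oct≡ i′))))

module Simulation (inp : ℕ → ℕ) (base : ℕ) (inp-end : ∀ a → base ≤ a → inp a ≡ 0) where
  open Semantics inp

  -- The input lies below address `base`. The cell `base` itself is never written and stays zero,
  -- which serves all reads past the input; hence the arrays start one cell later, at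
  -- `base + suc k`.
  record Represents (σ : State) (h : Store) : Set where
    field
      vars≡  : ∀ r → regs σ r ≡ vars h r
      base≡  : vars h 4 ≡ base
      input≡ : ∀ a → a ≤ base → mem σ a ≡ inp a
      cells≡ : ∀ k i → k < 8 → mem σ ((base + suc k) + oct i) ≡ cells h k i

  open Represents

  truncate : ∀ m → m ∸ (m ∸ base) ≡ m ⊎ (m ∸ (m ∸ base) ≡ base × base ≤ m)
  truncate m with ≤-total m base
  ... | inj₁ m≤ = inj₁ (cong (m ∸_) (m≤n⇒m∸n≡0 m≤))
  ... | inj₂ b≤ = inj₂ (m∸[m∸n]≡n b≤ , b≤)

  eval : ∀ e {σ h} → legalTerm e ≡ true → Represents σ h → ⟦ ⌊ e ⌋ₜ ⟧ σ ≡ val e h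
  eval-address : ∀ k e {σ h} → legalTerm e ≡ true → Represents σ h →
                 ⟦ address k ⌊ e ⌋ₜ ⟧ σ ≡ (base + suc k) + oct (val e h)

  eval (con m) ok R = refl
  eval (var r) ok R = vars≡ R r
  eval (input e) {σ} {h} ok R = trans
      (cong (mem σ) (cong₂ (λ x y → x ∸ (x ∸ y)) (eval e ok R) (trans (vars≡ R 4) (base≡ R))))
      (read (truncate (val e h)))
    where
    m : ℕ
    m = val e h
    read : m ∸ (m ∸ base) ≡ m ⊎ (m ∸ (m ∸ base) ≡ base × base ≤ m) →
           mem σ (m ∸ (m ∸ base)) ≡ inp m
    read (inj₁ eq) = trans (input≡ R _ ≤base) (cong inp eq)
      where
      ≤base : m ∸ (m ∸ base) ≤ base
      ≤base = m≤n+o⇒m∸n≤o m (m ∸ base) (≤-trans (m≤n+m∸n m base) (≤-reflexive (+-comm base _)))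
    read (inj₂ (eq , b≤m)) = trans (cong (mem σ) eq)
      (trans (input≡ R base ≤-refl) (trans (inp-end base ≤-refl) (sym (inp-end m b≤m))))
  eval (cell k e) {σ} {h} ok R = trans (cong (mem σ) (eval-address k e (∧-trueʳ (k <ᵇ 8) ok) R))
    (cells≡ R k (val e h) (<ᵇ⇒< k 8 (subst T (sym (∧-trueˡ ok)) _)))
  eval (e ⊞ f) ok R =
    cong₂ _+_ (eval e (∧-trueˡ ok) R) (eval f (∧-trueʳ (legalTerm e) ok) R)
  eval (e ⊟ f) ok R =
    cong₂ _∸_ (eval e (∧-trueˡ ok) R) (eval f (∧-trueʳ (legalTerm e) ok) R)

  eval-address k e ok R =
    cong₂ (λ x y → (x + suc k) + oct y) (trans (vars≡ R 4) (base≡ R)) (eval e ok R)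

  set-var : ∀ {σ h} r {v w} → not (r ≡ᵇ 4) ≡ true → v ≡ w → Represents σ h →
            Represents (state (regs σ [ r ↦ v ]) (mem σ)) (setVar r w h)
  set-var {σ} {h} r {v} r≢4 refl R = record
    { vars≡  = λ q → cong (λ x → if r ≡ᵇ q then v else x) (vars≡ R q)
    ; base≡  = trans (upd-≡ᵇ (vars h) r 4 v (not-true r≢4)) (base≡ R)
    ; input≡ = input≡ R
    ; cells≡ = cells≡ R }

  set-cell : ∀ {σ h k a v} → k < 8 → Represents σ h →
             Represents (state (regs σ) (mem σ [ (base + suc k) + oct a ↦ v ]))
                        (store (vars h) (setCell (cells h) k a v))
  set-cell {σ} {h} {k} {a} {v} k<8 R = record
    { vars≡  = vars≡ R
    ; base≡  = base≡ R
    ; input≡ = λ b b≤ → trans (upd-other (mem σ) v (λ eq → <-irrefl (sym eq) (≤-<-trans b≤ above)))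
                              (input≡ R b b≤)
    ; cells≡ = at }
    where
    above : base < (base + suc k) + oct a
    above = ≤-trans (≤-trans (≤-reflexive (+-comm 1 base)) (+-monoʳ-≤ base (s≤s z≤n)))
                    (m≤m+n _ (oct a))
    at : ∀ j i → j < 8 → (mem σ [ (base + suc k) + oct a ↦ v ]) ((base + suc j) + oct i)
                        ≡ setCell (cells h) k a v j i
    at j i j<8 with k ≟ j
    ... | no k≢j rewrite ≢⇒≡ᵇ k j k≢j =
      trans (upd-other (mem σ) v (λ eq → k≢j (proj₁ (oct-injective {i = a} {i} k<8 j<8 (cancel eq)))))
            (cells≡ R j i j<8)
      where
      cancel : (base + suc k) + oct a ≡ (base + suc j) + oct i → k + oct a ≡ j + oct i
      cancel eq = suc-injective (+-cancelˡ-≡ base _ _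
        (trans (sym (+-assoc base (suc k) (oct a))) (trans eq (+-assoc base (suc j) (oct i)))))
    ... | yes refl rewrite ≡ᵇ-refl k with a ≟ i
    ...   | yes refl = trans (upd-same (mem σ) _ v) (sym (upd-same (cells h k) a v))
    ...   | no a≢i = trans (upd-other (mem σ) v
                        (λ eq → a≢i (proj₂ (oct-injective {i = a} {i} k<8 k<8
                           (cong (k +_) (+-cancelˡ-≡ (base + suc k) _ _ eq))))))
                     (trans (cells≡ R k i k<8) (sym (upd-other (cells h k) v a≢i)))

  Simulated : Command → State → Store → Set
  Simulated p σ h = ∃[ σ′ ] ∃[ T′ ] ⟨ ⌊ p ⌋ , σ ⟩⇓ σ′ [ T′ ]
                    × T′ ≤ weight p * suc (steps p h) × Represents σ′ (exec p h)

  branch-cost : ∀ c w w′ s → suc (c + w * suc s) ≤ suc (c + (w + w′)) * suc s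
  branch-cost c w w′ s = ≤-trans (m≤m+n _ ((suc c) * s + w′ * suc s)) (≤-reflexive (ring c w w′ s))
    where
    ring : ∀ c w w′ s → suc (c + w * suc s) + ((suc c) * s + w′ * suc s) ≡ suc (c + (w + w′)) * suc s
    ring = solve-∀

  expand : ∀ w s {x} → x ≤ w → x ≤ w * suc s
  expand w s x≤ = ≤-trans x≤ (m≤m*n w (suc s))

  simulate      : ∀ p {σ h} → legal p ≡ true → Represents σ h → Simulated p σ h
  -- Here `m` is at once the recursion argument of `execLoop` and the value of the machine's loop
  -- test, limit minus counter. They stay equal because the body assigns neither register and the
  -- increment lowers the difference by one.
  simulate-loop : ∀ i l p m {σ h} → not (i ≡ᵇ 4) ≡ true → (i ≡ᵇ l) ≡ false →
    assigns i p ≡ false → assigns l p ≡ false → legal p ≡ true →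
    vars h l ∸ vars h i ≡ m → Represents σ h →
    ∃[ σ′ ] ∃[ T′ ]
      ⟨ whileNonZero (reg l ⊖ reg i) repeat (⌊ p ⌋ ⨾ i ≔ reg i ⊕ lit 1) , σ ⟩⇓ σ′ [ T′ ]
      × T′ ≤ 4 + (8 + weight p) * stepsLoop i p m h × Represents σ′ (execLoop i p m h)

  simulate nop ok R = _ , _ , ⇓skip , s≤s z≤n , R
  simulate (r := e) {h = h} ok R = _ , _ , ⇓reg , expand (suc (cost ⌊ e ⌋ₜ)) 0 ≤-refl ,
    set-var r (∧-trueˡ ok) (eval e (∧-trueʳ (not (r ≡ᵇ 4)) ok) R) R
  simulate (k [ a ]:= e) {σ} {h} ok R = _ , _ , ⇓mem ,
    expand (suc (cost (address k ⌊ a ⌋ₜ) + cost ⌊ e ⌋ₜ)) 0 ≤-refl ,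
    subst₂ (λ x y → Represents (state (regs σ) (mem σ [ x ↦ y ])) (exec (k [ a ]:= e) h))
      (sym (eval-address k a (∧-trueˡ (∧-trueʳ (k <ᵇ 8) ok)) R))
      (sym (eval e (∧-trueʳ (legalTerm a) (∧-trueʳ (k <ᵇ 8) ok)) R))
      (set-cell {a = val a h} (<ᵇ⇒< k 8 (subst T (sym (∧-trueˡ ok)) _)) R)
  simulate (p ▸ q) {h = h} ok R with simulate p (∧-trueˡ ok) R
  ... | σ′ , T₁ , run₁ , T₁≤ , R′ with simulate q (∧-trueʳ (legal p) ok) R′
  ... | σ″ , T₂ , run₂ , T₂≤ , R″ = σ″ , T₁ + T₂ , ⇓seq run₁ run₂ ,
    ≤-trans (+-mono-≤ (≤-trans T₁≤ (*-monoʳ-≤ (weight p) (s≤s (m≤m+n s₁ s₂))))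
                      (≤-trans T₂≤ (*-monoʳ-≤ (weight q) (s≤s (m≤n+m s₂ s₁)))))
            (≤-reflexive (sym (*-distribʳ-+ (suc (s₁ + s₂)) (weight p) (weight q)))) , R″
    where
    s₁ s₂ : ℕ
    s₁ = steps p h
    s₂ = steps q (exec p h)
  simulate (ifnz e then p else q) {σ} {h} ok R
    with val e h | eval e (∧-trueˡ ok) R
  ... | zero | ev with simulate q (∧-trueʳ (legal p) (∧-trueʳ (legalTerm e) ok)) R
  ...   | σ′ , T₁ , run₁ , T₁≤ , R′ = σ′ , _ , ⇓else ev run₁ ,
    ≤-trans (s≤s (+-monoʳ-≤ (cost ⌊ e ⌋ₜ) T₁≤))
      (≤-trans (branch-cost (cost ⌊ e ⌋ₜ) (weight q) (weight p) (steps q h))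
               (≤-reflexive (cong (λ w → suc (cost ⌊ e ⌋ₜ + w) * suc (steps q h))
                                  (+-comm (weight q) (weight p))))) , R′
  simulate (ifnz e then p else q) {σ} {h} ok R
      | suc v | ev with simulate p (∧-trueˡ (∧-trueʳ (legalTerm e) ok)) R
  ...   | σ′ , T₁ , run₁ , T₁≤ , R′ = σ′ , _ , ⇓then (λ z → 0≢1+n (trans (sym z) ev)) run₁ ,
    ≤-trans (s≤s (+-monoʳ-≤ (cost ⌊ e ⌋ₜ) T₁≤))
            (branch-cost (cost ⌊ e ⌋ₜ) (weight p) (weight q) (steps p h)) , R′
  simulate (for i / l below e loop p) {σ} {h} ok R
    with ∧-trueˡ ok | ∧-trueʳ (not (i ≡ᵇ 4)) ok
  ... | i≢4 | ok₁ with ∧-trueˡ ok₁ | ∧-trueʳ (not (l ≡ᵇ 4)) ok₁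
  ... | l≢4 | ok₂ with ∧-trueˡ ok₂ | ∧-trueʳ (not (i ≡ᵇ l)) ok₂
  ... | i≢l | ok₃ with ∧-trueˡ ok₃ | ∧-trueʳ (not (assigns i p)) ok₃
  ... | i∉p | ok₄ with ∧-trueˡ ok₄ | ∧-trueʳ (not (assigns l p)) ok₄
  ... | l∉p | ok₅ with simulate-loop i l p (val e h) i≢4 (not-true i≢l) (not-true i∉p)
                         (not-true l∉p) (∧-trueʳ (legalTerm e) ok₅)
                         (cong₂ _∸_ (trans (upd-≡ᵇ (vars h [ l ↦ val e h ]) i l 0 (not-true i≢l))
                                           (upd-same (vars h) l (val e h)))
                                    (upd-same (vars h [ l ↦ val e h ]) i 0))
                         (set-var i i≢4 refl (set-var l l≢4 (eval e (∧-trueˡ ok₅) R) R))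
  ... | σ′ , T₁ , run₁ , T₁≤ , R′ = σ′ , _ , ⇓seq ⇓reg (⇓seq ⇓reg run₁) ,
    ≤-trans (+-monoʳ-≤ (suc (cost ⌊ e ⌋ₜ)) (s≤s (s≤s T₁≤)))
            (arith (cost ⌊ e ⌋ₜ) (weight p) _) , R′
    where
    arith : ∀ c w s → suc c + (2 + (4 + (8 + w) * s)) ≤ (c + (15 + w)) * suc s
    arith c w s = ≤-trans (m≤m+n _ (8 + w + (c + 7) * s)) (≤-reflexive (ring c w s))
      where
      ring : ∀ c w s → suc c + (2 + (4 + (8 + w) * s)) + (8 + w + (c + 7) * s) ≡ (c + (15 + w)) * suc s
      ring = solve-∀

  simulate-loop i l p zero {σ} {h} i≢4 i≢l i∉p l∉p ok eq R =
    σ , 4 , ⇓exit (trans (cong₂ _∸_ (vars≡ R l) (vars≡ R i)) eq) , m≤m+n 4 _ , R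
  simulate-loop i l p (suc m) {σ} {h} i≢4 i≢l i∉p l∉p ok eq R with simulate p ok R
  ... | σ′ , T₁ , run₁ , T₁≤ , R′ with simulate-loop i l p m i≢4 i≢l i∉p l∉p ok
        (trans (cong₂ _∸_ (trans (upd-≡ᵇ (vars (exec p h)) i l _ i≢l) (frameVar p h l l∉p))
                          (trans (upd-same (vars (exec p h)) i _) (cong (_+ 1) (frameVar p h i i∉p))))
          (trans (sym (∸-+-assoc (vars h l) (vars h i) 1)) (cong (_∸ 1) eq)))
        (set-var i i≢4 (cong (_+ 1) (vars≡ R′ i)) R′)
  ... | σ″ , T₂ , run₂ , T₂≤ , R″ = σ″ , _ ,
    ⇓loop (λ z → 0≢1+n (trans (sym z) (trans (cong₂ _∸_ (vars≡ R l) (vars≡ R i)) eq)))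
          (⇓seq run₁ ⇓reg) run₂ ,
    ≤-trans (+-mono-≤ (s≤s (+-monoʳ-≤ 3 (+-monoˡ-≤ 4 T₁≤))) T₂≤)
            (arith (weight p) (steps p h) _) , R″
    where
    arith : ∀ w s r → suc (3 + (w * suc s + 4)) + (4 + (8 + w) * r) ≤ 4 + (8 + w) * (suc s + r)
    arith w s r = ≤-trans (m≤m+n _ (8 * s)) (≤-reflexive (ring w s r))
      where
      ring : ∀ w s r → suc (3 + (w * suc s + 4)) + (4 + (8 + w) * r) + 8 * s
                       ≡ 4 + (8 + w) * (suc s + r)
      ring = solve-∀

-- Finite sums

∑-cong : ∀ {n} {f g : Fin n → ℕ} → (∀ u → f u ≡ g u) → ∑ f ≡ ∑ g
∑-cong = sum-cong-≗ +-0-commutativeMonoid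

-- An empty vertex contributes zero to every sum in use, so filling it is a pure addition and no
-- subtraction of an old term arises.
∑-update : ∀ {n} (f g : Fin n → ℕ) x → f x ≡ 0 → (∀ u → u ≢ x → g u ≡ f u) → ∑ g ≡ ∑ f + g x
∑-update f g zero fx≡0 eq rewrite fx≡0 =
  trans (cong (g zero +_) (∑-cong (λ u → eq (suc u) λ ()))) (+-comm (g zero) _)
∑-update f g (suc x) fx≡0 eq = trans
  (cong₂ _+_ (eq zero λ ())
    (∑-update (f ∘ suc) (g ∘ suc) x fx≡0 (λ u u≢x → eq (suc u) (λ where refl → u≢x refl))))
  (sym (+-assoc (f zero) _ _))

∑-filter : ∀ {A : Set} {n} (p : A → Bool) (w : A → ℕ) (f : Fin n → A) →
  ListAction.sum (map w (filterᵇ p (tabulate f))) ≡ ∑ (λ i → if p (f i) then w (f i) else 0)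
∑-filter {n = zero} p w f = refl
∑-filter {n = suc n} p w f with p (f zero)
... | true  = cong (w (f zero) +_) (∑-filter p w (f ∘ suc))
... | false = ∑-filter p w (f ∘ suc)

-- One step of Horner's scheme, through which uniqueness and size of base-`b` numerals follow by
-- induction.
∑-digits : ∀ {n} b (d : Fin (suc n) → ℕ) →
           ∑ (λ v → d v * b ^ toℕ v) ≡ d zero + ∑ (λ v → d (suc v) * b ^ toℕ v) * b
∑-digits {n} b d = cong₂ _+_ (*-identityʳ (d zero)) (scale n (d ∘ suc))
  where
  shift : ∀ x b p → x * (b * p) ≡ x * p * b
  shift = solve-∀
  scale′ : ∀ m (e f : Fin m → ℕ) → ∑ (λ v → e v * (b * f v)) ≡ ∑ (λ v → e v * f v) * b
  scale′ zero    e f = refl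
  scale′ (suc m) e f = trans
    (cong₂ _+_ (shift (e zero) b (f zero)) (scale′ m (e ∘ suc) (f ∘ suc)))
    (sym (*-distribʳ-+ b (e zero * f zero) _))
  scale : ∀ m (e : Fin m → ℕ) → ∑ (λ v → e v * (b * b ^ toℕ v)) ≡ ∑ (λ v → e v * b ^ toℕ v) * b
  scale m e = scale′ m e (λ v → b ^ toℕ v)

∑-digits-injective : ∀ {n} b .{{_ : NonZero b}} (d e : Fin n → ℕ) →
  (∀ v → d v < b) → (∀ v → e v < b) →
  ∑ (λ v → d v * b ^ toℕ v) ≡ ∑ (λ v → e v * b ^ toℕ v) → ∀ v → d v ≡ e v
∑-digits-injective {suc n} b d e d< e< eq v
  with +-*-injective b {i = ∑ (λ v → d (suc v) * b ^ toℕ v)} {∑ (λ v → e (suc v) * b ^ toℕ v)}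
         (d< zero) (e< zero) (trans (sym (∑-digits b d)) (trans eq (∑-digits b e)))
∑-digits-injective {suc n} b d e d< e< eq zero    | p , q = p
∑-digits-injective {suc n} b d e d< e< eq (suc v) | p , q =
  ∑-digits-injective b (d ∘ suc) (e ∘ suc) (d< ∘ suc) (e< ∘ suc) q v

∑-digits-bound : ∀ {n} b (d : Fin n → ℕ) → (∀ v → d v < b) → ∑ (λ v → d v * b ^ toℕ v) < b ^ n
∑-digits-bound {zero}  b d d< = s≤s z≤n
∑-digits-bound {suc n} b d d< = begin-strict
  ∑ (λ v → d v * b ^ toℕ v)                          ≡⟨ ∑-digits b d ⟩
  d zero + ∑ (λ v → d (suc v) * b ^ toℕ v) * b       <⟨ +-monoˡ-< _ (d< zero) ⟩
  suc (∑ (λ v → d (suc v) * b ^ toℕ v)) * b          ≤⟨ *-monoˡ-≤ b (∑-digits-bound b (d ∘ suc) (d< ∘ suc)) ⟩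
  b ^ n * b                                          ≡⟨ *-comm (b ^ n) b ⟩
  b * b ^ n                                          ∎
  where open ≤-Reasoning

-- Plays

stack-≡ : ∀ {k} {c d : Fin k} {h i} .{{p : NonZero h}} .{{q : NonZero i}} →
          c ≡ d → h ≡ i → stack c h ≡ stack d i
stack-≡ refl refl = refl

just≢nothing : ∀ {A : Set} {m : Maybe A} {s} → m ≡ just s → m ≢ nothing
just≢nothing refl ()

bit : Bool → ℕ
bit b = if b then 1 else 0

bit≢0 : ∀ {b} → bit b ≢ 0 → b ≡ true
bit≢0 {true}  _  = refl
bit≢0 {false} ne = contradiction refl ne

bit≡0 : ∀ {b} → bit b ≡ 0 → b ≡ false
bit≡0 {false} _ = refl

if-same : ∀ {A : Set} (b : Bool) {x : A} → (if b then x else x) ≡ x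
if-same true  = refl
if-same false = refl

-- One row of the list that the program builds for a vertex `x`. Each field is a sum over the
-- vertices, plus a constant that depends on the new stack, so putting one more stack on the board
-- amounts to `increase`.
record Entry : Set where
  constructor entry
  field
    source total vanish keep : ℕ

entry-≡ : ∀ {a a′ b b′ c c′ d d′} → a ≡ a′ → b ≡ b′ → c ≡ c′ → d ≡ d′ →
          entry a b c d ≡ entry a′ b′ c′ d′
entry-≡ refl refl refl refl = refl

increase : ℕ → ℕ → ℕ → ℕ → Entry → Entry
increase o s v k (entry a b c d) = entry (a + o) (b + s) (c + v) (d + k)

module Board {n k : ℕ} (G : Graph n) (t : ℕ) where
  open Graph G

  Conf : Set
  Conf = Configuration n k

  infix 4 _≗ᶜ_
  _≗ᶜ_ : Conf → Conf → Set
  δ ≗ᶜ ε = ∀ v → δ v ≡ ε v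

  merges-cong : ∀ {δ ε} → δ ≗ᶜ ε → ∀ c x u → merges G t δ c x u ≡ merges G t ε c x u
  merges-cong eq c x u = cong (λ m → adjacent x u ∧ hosts c m) (eq u)

  gain : Conf → Fin k → Fin n → Fin n → ℕ
  gain δ c x u = if merges G t δ c x u then hostedHeight (δ u) else 0

  mergedHeight≡ : ∀ (δ : Conf) c x → mergedHeight G t δ c x ≡ ∑ (gain δ c x)
  mergedHeight≡ δ c x = ∑-filter (merges G t δ c x) (hostedHeight ∘ δ) (λ i → i)

  gain-cong : ∀ {δ ε} → δ ≗ᶜ ε → ∀ c x u → gain δ c x u ≡ gain ε c x u
  gain-cong eq c x u =
    cong₂ (λ b m → if b then hostedHeight m else 0) (merges-cong eq c x u) (eq u)

  mergedHeight-cong : ∀ {δ ε} → δ ≗ᶜ ε → ∀ c x → mergedHeight G t δ c x ≡ mergedHeight G t ε c x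
  mergedHeight-cong {δ} {ε} eq c x = trans (mergedHeight≡ δ c x)
    (trans (∑-cong (gain-cong eq c x)) (sym (mergedHeight≡ ε c x)))

  placed : Stack k → ℕ → Maybe (Stack k)
  placed s h′ = if does (t ≤? height s + h′) then nothing else just (raise s h′)

  place-at : ∀ (δ : Conf) s x → place G t δ s x x ≡ placed s (mergedHeight G t δ (colour s) x)
  place-at δ s x rewrite dec-true (x ≟ᶠ x) refl = refl

  place-off : ∀ (δ : Conf) s x u → u ≢ x →
    place G t δ s x u ≡ (if merges G t δ (colour s) x u then nothing else δ u)
  place-off δ s x u u≢x rewrite dec-false (u ≟ᶠ x) u≢x = refl

  place-nothing : ∀ (δ : Conf) s x {v} → v ≢ x → δ v ≡ nothing → place G t δ s x v ≡ nothing
  place-nothing δ s x {v} ne empty = trans (place-off δ s x v ne)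
    (trans (cong (λ m → if merges G t δ (colour s) x v then nothing else m) empty)
           (if-same (merges G t δ (colour s) x v)))

  place-cong : ∀ {δ ε} → δ ≗ᶜ ε → ∀ s x → place G t δ s x ≗ᶜ place G t ε s x
  place-cong {δ} {ε} eq s x u with u ≟ᶠ x
  ... | yes _ = cong (placed s) (mergedHeight-cong eq (colour s) x)
  ... | no _  = cong₂ (λ b m → if b then nothing else m) (merges-cong eq (colour s) x u) (eq u)

  Wins : (Conf → Set) → Conf → List (Stack k) → Set
  Wins Goal δ S = ∃[ ε ] Plays G t δ S ε × Goal ε

  -- Configurations are functions, and equality of codes identifies them only pointwise; a play
  -- found from one of them has to be carried over to the other.
  plays-cong : ∀ {δ δ′ S ε} → δ ≗ᶜ δ′ → Plays G t δ S ε → ∃[ ε′ ] Plays G t δ′ S ε′ × ε ≗ᶜ ε′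
  plays-cong eq done = _ , done , eq
  plays-cong {S = s ∷ _} eq (move x empty play) with plays-cong (place-cong eq s x) play
  ... | ε′ , play′ , eq′ = ε′ , move x (trans (sym (eq x)) empty) play′ , eq′

  -- Placements preserve this, as a stack that reaches `t` vanishes. It makes colour and height the
  -- quotient and remainder of a digit by `t`; since heights are positive, digit 0 is left for the
  -- empty vertex.
  Small : Conf → Set
  Small δ = ∀ v {s} → δ v ≡ just s → height s < t

  placed-cases : ∀ (s : Stack k) h′ →
    (t ≤ height s + h′ × placed s h′ ≡ nothing) ⊎ (height s + h′ < t × placed s h′ ≡ just (raise s h′))
  placed-cases s h′ with t ≤? height s + h′
  ... | yes t≤ = inj₁ (t≤ , cong (λ b → if b then nothing else just (raise s h′))
                                 (dec-true (t ≤? height s + h′) t≤))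
  ... | no  t≰ = inj₂ (≰⇒> t≰ , cong (λ b → if b then nothing else just (raise s h′))
                                     (dec-false (t ≤? height s + h′) t≰))

  place-Small : ∀ {δ : Conf} s x → Small δ → Small (place G t δ s x)
  place-Small {δ} s x small v {s′} eq with v ≟ᶠ x
  ... | yes _ with placed-cases s (mergedHeight G t δ (colour s) x)
  ...   | inj₁ (_ , z) = contradiction (trans (sym z) eq) (λ ())
  ...   | inj₂ (h< , z) = subst (λ r → height r < t) (just-injective (trans (sym z) eq)) h<
  place-Small {δ} s x small v {s′} eq | no _ with merges G t δ (colour s) x v
  ... | false = small v eq

  -- Codes of configurations

  base : ℕ
  base = k * t

  digit : Maybe (Stack k) → ℕ
  digit nothing  = 0
  digit (just s) = toℕ (colour s) * t + height s

  code : Conf → ℕ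
  code δ = ∑ (λ v → digit (δ v) * base ^ toℕ v)

  code-cong : ∀ {δ ε} → δ ≗ᶜ ε → code δ ≡ code ε
  code-cong eq = ∑-cong (λ v → cong (λ m → digit m * base ^ toℕ v) (eq v))

  digit-bound : ∀ m → 0 < base → (∀ {s} → m ≡ just s → height s < t) → digit m < base
  digit-bound nothing  0<b small = 0<b
  digit-bound (just s) 0<b small = begin-strict
    toℕ (colour s) * t + height s   <⟨ +-monoʳ-< (toℕ (colour s) * t) (small refl) ⟩
    toℕ (colour s) * t + t          ≡⟨ +-comm _ t ⟩
    suc (toℕ (colour s)) * t        ≤⟨ *-monoˡ-≤ t (toℕ<n (colour s)) ⟩
    k * t                           ∎
    where open ≤-Reasoning

  digit-injective : .{{_ : NonZero t}} → ∀ m m′ → (∀ {s} → m ≡ just s → height s < t) →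
                    (∀ {s} → m′ ≡ just s → height s < t) → digit m ≡ digit m′ → m ≡ m′
  digit-injective nothing nothing _ _ _ = refl
  digit-injective nothing (just (stack c h)) _ _ eq =
    contradiction (m+n≡0⇒n≡0 (toℕ c * t) (sym eq)) (≢-nonZero⁻¹ h)
  digit-injective (just (stack c h)) nothing _ _ eq =
    contradiction (m+n≡0⇒n≡0 (toℕ c * t) eq) (≢-nonZero⁻¹ h)
  digit-injective (just (stack c h)) (just (stack d i)) p q eq
    with +-*-injective t (p refl) (q refl)
           (trans (+-comm h (toℕ c * t)) (trans eq (+-comm (toℕ d * t) i)))
  ... | h≡i , c≡d = cong just (stack-≡ (toℕ-injective c≡d) h≡i)

  code-injective : .{{_ : NonZero t}} → 0 < base → ∀ {δ ε} → Small δ → Small ε →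
                   code δ ≡ code ε → δ ≗ᶜ ε
  code-injective 0<b {δ} {ε} p q eq v = digit-injective (δ v) (ε v) (p v) (q v)
    (∑-digits-injective base {{>-nonZero 0<b}} (digit ∘ δ) (digit ∘ ε)
      (λ u → digit-bound (δ u) 0<b (p u)) (λ u → digit-bound (ε u) 0<b (q u)) eq v)

  code-bound : 0 < base → ∀ {δ} → Small δ → code δ < base ^ n
  code-bound 0<b {δ} p =
    ∑-digits-bound base (digit ∘ δ) (λ u → digit-bound (δ u) 0<b (p u))

  -- The code after a placement, computed from sums over the vertices

  residue : Conf → Fin k → Fin n → Fin n → ℕ
  residue δ c x u = if merges G t δ c x u then 0 else digit (δ u) * base ^ toℕ u

  -- vanish and keep are the codes of the configuration after the placement of s
  -- on x when the stack on x vanishes and when it stays.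
  summary : Stack k → Fin n → Conf → Entry
  summary s x δ = entry (code δ) total vanish
      (vanish + base ^ toℕ x * (toℕ (colour s) * t + total))
    where
    total vanish : ℕ
    total  = height s + ∑ (gain δ (colour s) x)
    vanish = ∑ (residue δ (colour s) x)

  summary-cong : ∀ s x {δ ε} → δ ≗ᶜ ε → summary s x δ ≡ summary s x ε
  summary-cong s x {δ} {ε} eq = entry-≡ (code-cong eq) tot van
      (cong₂ (λ a b → a + base ^ toℕ x * (toℕ (colour s) * t + b)) van tot)
    where
    tot : height s + ∑ (gain δ (colour s) x) ≡ height s + ∑ (gain ε (colour s) x)
    tot = cong (height s +_) (∑-cong (gain-cong eq (colour s) x))
    van : ∑ (residue δ (colour s) x) ≡ ∑ (residue ε (colour s) x)
    van = ∑-cong (λ u → cong₂ (λ b m → if b then 0 else digit m * base ^ toℕ u)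
                              (merges-cong eq (colour s) x u) (eq u))

  target : Entry → ℕ
  target (entry _ total vanish keep) = choose (t ∸ total) keep vanish

  merges-nothing : ∀ {δ : Conf} {u} c x → δ u ≡ nothing → merges G t δ c x u ≡ false
  merges-nothing {δ} {u} c x eq rewrite eq with adjacent x u
  ... | true  = refl
  ... | false = refl

  -- Away from `x`, a placement keeps exactly the digits counted by `residue`, whose term at the
  -- empty `x` is zero; what `x` then hosts is the one new summand. The case distinction in `target`
  -- is already the machine's test, `t ∸ total` being zero when the stack vanishes.
  code-place : ∀ s x (δ : Conf) → δ x ≡ nothing → code (place G t δ s x) ≡ target (summary s x δ)
  code-place s x δ empty = trans (∑-update (residue δ c x) after x residue-x after-off)
      (trans (cong (λ m → V + digit m * base ^ toℕ x) (place-at δ s x)) (finish (placed-cases s H)))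
    where
    c : Fin k
    c = colour s
    H V : ℕ
    H = mergedHeight G t δ c x
    V = ∑ (residue δ c x)
    after : Fin n → ℕ
    after v = digit (place G t δ s x v) * base ^ toℕ v
    residue-x : residue δ c x x ≡ 0
    residue-x = trans
      (cong (λ b → if b then 0 else digit (δ x) * base ^ toℕ x) (merges-nothing {δ = δ} c x empty))
      (cong (λ m → digit m * base ^ toℕ x) empty)
    after-off : ∀ u → u ≢ x → after u ≡ residue δ c x u
    after-off u u≢x rewrite place-off δ s x u u≢x with merges G t δ c x u
    ... | true  = refl
    ... | false = refl
    H≡ : height s + H ≡ height s + ∑ (gain δ c x)
    H≡ = cong (height s +_) (mergedHeight≡ δ c x)
    finish : (t ≤ height s + H × placed s H ≡ nothing) ⊎
             (height s + H < t × placed s H ≡ just (raise s H)) →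
             V + digit (placed s H) * base ^ toℕ x ≡ target (summary s x δ)
    finish (inj₁ (t≤ , eq)) rewrite eq = trans (+-identityʳ V)
      (sym (choose-zero (m≤n⇒m∸n≡0 (subst (t ≤_) H≡ t≤))))
    finish (inj₂ (<t , eq)) rewrite eq = trans
      (cong (V +_) (trans (*-comm _ (base ^ toℕ x))
        (cong (λ z → base ^ toℕ x * (toℕ c * t + z)) H≡)))
      (sym (choose-pos (λ z → <⇒≱ (subst (_< t) H≡ <t) (m∸n≡0⇒m≤n z))))

  -- Adding a stack to a configuration

  put : Conf → Fin n → Stack k → Conf
  put δ v s u = if does (u ≟ᶠ v) then just s else δ u

  clear : Conf → Fin n → Conf
  clear δ v u = if does (u ≟ᶠ v) then nothing else δ u

  put-at : ∀ δ v s → put δ v s v ≡ just s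
  put-at δ v s rewrite dec-true (v ≟ᶠ v) refl = refl

  put-off : ∀ δ v s {u} → u ≢ v → put δ v s u ≡ δ u
  put-off δ v s {u} ne rewrite dec-false (u ≟ᶠ v) ne = refl

  clear-at : ∀ δ v → clear δ v v ≡ nothing
  clear-at δ v rewrite dec-true (v ≟ᶠ v) refl = refl

  put-clear : ∀ δ v {s} → δ v ≡ just s → δ ≗ᶜ put (clear δ v) v s
  put-clear δ v eq u with u ≟ᶠ v
  ... | yes refl = eq
  ... | no _     = refl

  -- The effect on a summary of a stack of colour a and height suc i put on an
  -- empty vertex of weight p, when a stack of colour c is to be placed on a
  -- vertex of weight q and g tells whether the two vertices are adjacent.
  extend : (p q g c a i : ℕ) → Entry → Entry
  extend p q g c a i = choose (g ∸ ((a ∸ c) + (c ∸ a)))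
    (increase ((a * t + suc i) * p) (suc i) 0 (suc i * q))
    (increase ((a * t + suc i) * p) 0 ((a * t + suc i) * p) ((a * t + suc i) * p))

  distance-0 : ∀ a c → (a ∸ c) + (c ∸ a) ≡ 0 → a ≡ c
  distance-0 a c eq = ≤-antisym (m∸n≡0⇒m≤n (m+n≡0⇒m≡0 (a ∸ c) eq))
                                (m∸n≡0⇒m≤n (m+n≡0⇒n≡0 (a ∸ c) eq))

  -- The machine has no equality test. The two truncated differences add up to the distance of the
  -- colours, and taking it off the adjacency bit leaves 1 just for a neighbour of the same colour.
  extend-flag : ∀ b (a c : Fin k) {A : Set} {y z : A} →
    choose (bit b ∸ ((toℕ a ∸ toℕ c) + (toℕ c ∸ toℕ a))) y z ≡ (if b ∧ does (a ≟ᶠ c) then y else z)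
  extend-flag false a c rewrite 0∸n≡0 ((toℕ a ∸ toℕ c) + (toℕ c ∸ toℕ a)) = refl
  extend-flag true a c with a ≟ᶠ c
  ... | yes refl rewrite n∸n≡0 (toℕ a) = refl
  ... | no a≢c with (toℕ a ∸ toℕ c) + (toℕ c ∸ toℕ a) in eq
  ...   | zero  = contradiction (toℕ-injective (distance-0 (toℕ a) (toℕ c) eq)) a≢c
  ...   | suc m rewrite 0∸n≡0 m = refl

  -- Every field changes in its summand at `v` alone. A stack that will merge raises the total, and
  -- thereby `keep` by its height times the weight of `x`; any other stack survives the placement,
  -- so its digit enters `vanish` and `keep` as it enters the source.
  summary-put : ∀ s x δ v a i → δ v ≡ nothing →
    summary s x (put δ v (stack a (suc i)))
      ≡ extend (base ^ toℕ v) (base ^ toℕ x) (bit (adjacent x v)) (toℕ (colour s)) (toℕ a) i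
               (summary s x δ)
  summary-put s x δ v a i empty =
    trans step (sym (cong-app (extend-flag (adjacent x v) a c) (summary s x δ)))
    where
    c : Fin k
    c = colour s
    ε : Conf
    ε = put δ v (stack a (suc i))
    W : ℕ
    W = (toℕ a * t + suc i) * base ^ toℕ v
    off : ∀ {u} → u ≢ v → ε u ≡ δ u
    off = put-off δ v _
    merges-off : ∀ {u} → u ≢ v → merges G t ε c x u ≡ merges G t δ c x u
    merges-off {u} ne = cong (λ m → adjacent x u ∧ hosts c m) (off ne)
    code-step : code ε ≡ code δ + W
    code-step = trans
      (∑-update (λ u → digit (δ u) * base ^ toℕ u) (λ u → digit (ε u) * base ^ toℕ u) v
        (cong (λ m → digit m * base ^ toℕ v) empty)
        (λ u ne → cong (λ m → digit m * base ^ toℕ u) (off ne)))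
      (cong (λ m → code δ + digit m * base ^ toℕ v) (put-at δ v _))
    gain-step : ∑ (gain ε c x) ≡ ∑ (gain δ c x) + gain ε c x v
    gain-step = ∑-update (gain δ c x) (gain ε c x) v
      (cong (λ b → if b then hostedHeight (δ v) else 0) (merges-nothing {δ = δ} c x empty))
      (λ u ne → cong₂ (λ b m → if b then hostedHeight m else 0) (merges-off ne) (off ne))
    residue-v : residue δ c x v ≡ 0
    residue-v = trans
      (cong (λ b → if b then 0 else digit (δ v) * base ^ toℕ v) (merges-nothing {δ = δ} c x empty))
      (cong (λ m → digit m * base ^ toℕ v) empty)
    residue-step : ∑ (residue ε c x) ≡ ∑ (residue δ c x) + residue ε c x v
    residue-step = ∑-update (residue δ c x) (residue ε c x) v residue-v
      (λ u ne → cong₂ (λ b m → if b then 0 else digit m * base ^ toℕ u) (merges-off ne) (off ne))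
    flag : Bool
    flag = adjacent x v ∧ does (a ≟ᶠ c)
    gain-v : gain ε c x v ≡ (if flag then suc i else 0)
    gain-v rewrite put-at δ v (stack a (suc i)) = refl
    residue-ε : residue ε c x v ≡ (if flag then 0 else W)
    residue-ε rewrite put-at δ v (stack a (suc i)) = refl
    q : ℕ
    q = base ^ toℕ x
    ring₁ : ∀ q m h g i r → r + 0 + q * (m + (h + (g + i))) ≡ r + q * (m + (h + g)) + i * q
    ring₁ = solve-∀
    ring₂ : ∀ r w z → r + w + z ≡ r + z + w
    ring₂ = solve-∀
    step : summary s x ε ≡ (if flag then increase W (suc i) 0 (suc i * q) else increase W 0 W W)
                             (summary s x δ)
    step rewrite code-step | gain-step | residue-step | gain-v | residue-ε with flag
    ... | true  = entry-≡ refl (sym (+-assoc (height s) _ (suc i))) refl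
                    (ring₁ q (toℕ c * t) (height s) (∑ (gain δ c x)) (suc i) (∑ (residue δ c x)))
    ... | false = entry-≡ refl (sym (+-assoc (height s) _ 0)) refl
                    (trans (cong (λ z → ∑ (residue δ c x) + W + q * (toℕ c * t + (height s + z)))
                                 (+-identityʳ _))
                           (ring₂ (∑ (residue δ c x)) W _))

-- Arithmetic of the time bound

-- Doubling the right side makes up for the next square only from 3² to 4² on, hence the three base
-- cases.
square-bound : ∀ m → suc m * suc m ≤ 3 * 2 ^ m
square-bound 0 = s≤s z≤n
square-bound 1 = s≤s (s≤s (s≤s (s≤s z≤n)))
square-bound 2 = ≤ᵇ⇒≤ 9 12 _
square-bound (suc (suc (suc m))) = begin
  (4 + m) * (4 + m)                       ≤⟨ m≤m+n _ (2 + (m * m + 4 * m)) ⟩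
  (4 + m) * (4 + m) + (2 + (m * m + 4 * m)) ≡⟨ ring m ⟩
  2 * ((3 + m) * (3 + m))                 ≤⟨ *-monoʳ-≤ 2 (square-bound (suc (suc m))) ⟩
  2 * (3 * 2 ^ suc (suc m))               ≡⟨ ring′ (2 ^ suc (suc m)) ⟩
  3 * (2 * 2 ^ suc (suc m))               ∎
  where
  open ≤-Reasoning
  ring : ∀ m → (4 + m) * (4 + m) + (2 + (m * m + 4 * m)) ≡ 2 * ((3 + m) * (3 + m))
  ring = solve-∀
  ring′ : ∀ x → 2 * (3 * x) ≡ 3 * (2 * x)
  ring′ = solve-∀

-- Since `square-bound` uses only n - 1 of the n factors of the power, a factor `b` is left over.
-- This pays for all the costs of order n² b: the powers of the base and the loops over colours and
-- heights that run whether or not rows are copied.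
square-power-bound : ∀ {b} n → 2 ≤ b → n * n * b ≤ 3 * b ^ n
square-power-bound zero 2≤b = z≤n
square-power-bound {b} (suc m) 2≤b = begin
  suc m * suc m * b   ≤⟨ *-monoˡ-≤ b (square-bound m) ⟩
  3 * 2 ^ m * b       ≤⟨ *-monoˡ-≤ b (*-monoʳ-≤ 3 (^-monoˡ-≤ m 2≤b)) ⟩
  3 * b ^ m * b       ≡⟨ trans (*-assoc 3 (b ^ m) b) (cong (3 *_) (*-comm (b ^ m) b)) ⟩
  3 * (b * b ^ m)     ∎
  where open ≤-Reasoning

-- The first two terms of the binomial expansion of (m + 1) ^ n.
bernoulli : ∀ m n → m ^ n + n * m ^ (n ∸ 1) ≤ suc m ^ n
bernoulli m zero = ≤-refl
bernoulli m (suc zero) = ≤-reflexive (ring m)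
  where
  ring : ∀ m → m * 1 + 1 * 1 ≡ suc m * 1
  ring = solve-∀
bernoulli m (suc n₁@(suc n)) = step (bernoulli m n₁)
  where
  ring : ∀ m n p → m * (m * p) + (2 + n) * (m * p) ≡ m * (m * p + suc n * p) + m * p
  ring = solve-∀
  step : m * m ^ n + suc n * m ^ n ≤ suc m ^ suc n →
         m * (m * m ^ n) + (2 + n) * (m * m ^ n) ≤ suc m ^ suc (suc n)
  step ih = begin
    m * (m * m ^ n) + (2 + n) * (m * m ^ n)     ≡⟨ ring m n (m ^ n) ⟩
    m * (m * m ^ n + suc n * m ^ n) + m * m ^ n ≤⟨ +-mono-≤ (*-monoʳ-≤ m ih) (≤-trans (m≤m+n _ _) ih) ⟩
    m * suc m ^ suc n + suc m ^ suc n           ≡⟨ +-comm (m * suc m ^ suc n) _ ⟩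
    suc m ^ suc (suc n)                         ∎
    where open ≤-Reasoning

single-bound : ∀ m n {b} → suc m ≤ b → n * m ^ (n ∸ 1) ≤ b ^ n
single-bound m n lt = ≤-trans (m≤n+m _ (m ^ n)) (≤-trans (bernoulli m n) (^-monoˡ-≤ n lt))

-- With Q = t² and q = 2t − 1, a pair of adjacent vertices has only q ≤ (3/4) Q
-- states, which outweighs the linear factor.
pair-decay : ∀ {q Q} m → 4 * q ≤ 3 * Q → (m + 4) * q ^ m ≤ 4 * Q ^ m
pair-decay zero le = ≤-refl
pair-decay {q} {Q} (suc m) le = *-cancelˡ-≤ 4 (begin
  4 * ((suc m + 4) * (q * q ^ m)) ≡⟨ ring₁ m q (q ^ m) ⟩
  (5 + m) * (4 * q) * q ^ m       ≤⟨ *-monoˡ-≤ (q ^ m) (*-monoʳ-≤ (5 + m) le) ⟩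
  (5 + m) * (3 * Q) * q ^ m       ≤⟨ m≤m+n _ ((1 + m) * (Q * q ^ m)) ⟩
  (5 + m) * (3 * Q) * q ^ m + (1 + m) * (Q * q ^ m) ≡⟨ ring₂ m Q (q ^ m) ⟩
  4 * Q * ((m + 4) * q ^ m)       ≤⟨ *-monoʳ-≤ (4 * Q) (pair-decay m le) ⟩
  4 * Q * (4 * Q ^ m)             ≡⟨ ring₃ Q (Q ^ m) ⟩
  4 * (4 * (Q * Q ^ m))           ∎)
  where
  open ≤-Reasoning
  ring₁ : ∀ m q p → 4 * ((suc m + 4) * (q * p)) ≡ (5 + m) * (4 * q) * p
  ring₁ = solve-∀
  ring₂ : ∀ m Q p → (5 + m) * (3 * Q) * p + (1 + m) * (Q * p) ≡ 4 * Q * ((m + 4) * p)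
  ring₂ = solve-∀
  ring₃ : ∀ Q P → 4 * Q * (4 * P) ≡ 4 * (4 * (Q * P))
  ring₃ = solve-∀

-- Tight at `t = 2`, where a pair has 3 states instead of 4; this is the origin of the ratio 3/4.
pair-ratio : ∀ t → 2 ≤ t → 4 * (t + (t ∸ 1)) ≤ 3 * (t * t)
pair-ratio (suc zero) (s≤s ())
pair-ratio (suc (suc u)) _ = ≤-trans (m≤m+n _ (4 * u + 3 * (u * u))) (≤-reflexive (ring u))
  where
  ring : ∀ u → 4 * (2 + u + (1 + u)) + (4 * u + 3 * (u * u)) ≡ 3 * ((2 + u) * (2 + u))
  ring = solve-∀

n≤t^n : ∀ {t} n → 2 ≤ t → n ≤ t ^ n
n≤t^n zero 2≤t = z≤n
n≤t^n {t} (suc n) 2≤t = begin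
  1 + n             ≤⟨ +-mono-≤ (m^n>0 t {{>-nonZero (≤-trans (s≤s z≤n) 2≤t)}} n) (n≤t^n n 2≤t) ⟩
  t ^ n + t ^ n     ≡⟨ cong (t ^ n +_) (sym (+-identityʳ _)) ⟩
  2 * t ^ n         ≤⟨ *-monoˡ-≤ (t ^ n) 2≤t ⟩
  t * t ^ n         ∎
  where open ≤-Reasoning

-- Of the vertices, `i` are discarded, `2 m` paired and `r` single. The summand `i` of the linear
-- factor is absorbed by `t ^ i`, a power that the enumeration does not use. The rest is at most 5 m
-- t: one pair pays for `t`, as t q ≤ 2 Q, and the decay of the others pays for `m`. The constants
-- are 8 = 2 · 4 and 41 = 1 + 5 · 8.
pairs-bound : ∀ {t} i m r → 2 ≤ t → r ≤ 4 * (m * t) →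
  (i + (m + m) + r) * (t ^ r * (t + (t ∸ 1)) ^ m) ≤ 41 * t ^ (i + (m + m) + r)
pairs-bound {t} i m r 2≤t r≤ = begin
  (i + (m + m) + r) * (t ^ r * q ^ m)          ≡⟨ ring₁ i m r (t ^ r) (q ^ m) ⟩
  (i * q ^ m + (m + m + r) * q ^ m) * t ^ r    ≤⟨ *-monoˡ-≤ (t ^ r) (+-mono-≤ never paired) ⟩
  (t ^ i * Q ^ m + t ^ i * (40 * Q ^ m)) * t ^ r ≡⟨ ring₂ (t ^ i) (Q ^ m) (t ^ r) ⟩
  41 * (t ^ i * Q ^ m * t ^ r)                 ≡⟨ cong (41 *_) powers≡ ⟩
  41 * t ^ (i + (m + m) + r)                   ∎
  where
  open ≤-Reasoning
  instance
    t≢0 : NonZero t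
    t≢0 = >-nonZero (≤-trans (s≤s z≤n) 2≤t)
  q Q : ℕ
  q = t + (t ∸ 1)
  Q = t * t
  ring₁ : ∀ i m r x y → (i + (m + m) + r) * (x * y) ≡ (i * y + (m + m + r) * y) * x
  ring₁ = solve-∀
  ring₂ : ∀ a b c → (a * b + a * (40 * b)) * c ≡ 41 * (a * b * c)
  ring₂ = solve-∀
  square-^ : ∀ m → Q ^ m ≡ t ^ (m + m)
  square-^ m = trans (cong (λ z → (t * z) ^ m) (sym (*-identityʳ t)))
    (trans (^-*-assoc t 2 m) (cong (λ z → t ^ (m + z)) (+-identityʳ m)))
  powers≡ : t ^ i * Q ^ m * t ^ r ≡ t ^ (i + (m + m) + r)
  powers≡ = trans (cong (_* t ^ r) (trans (cong (t ^ i *_)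
      (square-^ m)) (sym (^-distribˡ-+-* t i (m + m)))))
    (sym (^-distribˡ-+-* t (i + (m + m)) r))
  q≤2t : q ≤ 2 * t
  q≤2t = ≤-trans (+-monoʳ-≤ t (m∸n≤m t 1)) (≤-reflexive (cong (t +_) (sym (+-identityʳ t))))
  q≤Q : q ≤ Q
  q≤Q = ≤-trans q≤2t (*-monoˡ-≤ t 2≤t)
  never : i * q ^ m ≤ t ^ i * Q ^ m
  never = *-mono-≤ (n≤t^n i 2≤t) (^-monoˡ-≤ m q≤Q)
  scaled : ∀ m → m * t * q ^ m ≤ 8 * Q ^ m
  scaled zero    = z≤n
  scaled (suc m) = begin
    suc m * t * (q * q ^ m)         ≡⟨ ring₃ m t q (q ^ m) ⟩
    t * q * (suc m * q ^ m)         ≤⟨ *-mono-≤ (*-monoʳ-≤ t q≤2t)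
                                         (≤-trans (*-monoˡ-≤ (q ^ m) (≤-trans (m≤n+m (suc m) 3) (≤-reflexive (ring₅ m))))
                                                  (pair-decay m (pair-ratio t 2≤t))) ⟩
    t * (2 * t) * (4 * Q ^ m)       ≡⟨ ring₄ t (Q ^ m) ⟩
    8 * (Q * Q ^ m)                 ∎
    where
    ring₃ : ∀ m t q p → suc m * t * (q * p) ≡ t * q * (suc m * p)
    ring₃ = solve-∀
    ring₄ : ∀ t p → t * (2 * t) * (4 * p) ≡ 8 * (t * t * p)
    ring₄ = solve-∀
    ring₅ : ∀ m → 3 + suc m ≡ m + 4
    ring₅ = solve-∀
  paired : (m + m + r) * q ^ m ≤ t ^ i * (40 * Q ^ m)
  paired = begin
    (m + m + r) * q ^ m             ≤⟨ *-monoˡ-≤ (q ^ m) (+-mono-≤ m+m≤ r≤) ⟩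
    (m * t + 4 * (m * t)) * q ^ m   ≡⟨ ring₆ (m * t) (q ^ m) ⟩
    5 * (m * t * q ^ m)             ≤⟨ *-monoʳ-≤ 5 (scaled m) ⟩
    5 * (8 * Q ^ m)                 ≡⟨ *-assoc 5 8 (Q ^ m) ⟨
    40 * Q ^ m                      ≤⟨ m≤n*m (40 * Q ^ m) (t ^ i) {{m^n≢0 t i}} ⟩
    t ^ i * (40 * Q ^ m)            ∎
    where
    ring₆ : ∀ a b → (a + 4 * a) * b ≡ 5 * (a * b)
    ring₆ = solve-∀
    m+m≤ : m + m ≤ m * t
    m+m≤ = ≤-trans (≤-reflexive (trans (cong (m +_) (sym (+-identityʳ m))) (*-comm 2 m))) (*-monoʳ-≤ m 2≤t)

-- `E` bounds the list of configurations for one vertex and counts twice, for building the list and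
-- for evaluating it; `n * E` is the only critical quantity. In units of s (k t)^n, 30 is 9 for the
-- powers, 1 for the final table, and per stack 18 for loop overhead, 1 for the loop over the
-- vertices and 1 for copying the table.
solve-bound : ∀ n k t s E K T → 1 ≤ n → 1 ≤ k → 2 ≤ t → 1 ≤ s → T ≤ (k * t) ^ n → n * E ≤ K * (k * t) ^ n →
  n * suc (k * suc (t * 1))
    + (T + s * suc (n * suc (k + k * t + n * suc (2 * (k + k * (t ∸ 1))) + (E + E)) + (k * t) ^ n))
  ≤ (30 + 2 * K) * (s * (k * t) ^ n)
solve-bound n k t s E K T 1≤n 1≤k 2≤t 1≤s T≤ nE≤ = begin
  n * suc (k * suc (t * 1)) + (T + s * suc (n * suc V + D))
    ≤⟨ +-mono-≤ setup≤ (+-mono-≤ (≤-trans T≤ D≤sD) stacks≤) ⟩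
  9 * (s * D) + (s * D + s * (D + (18 * D + 2 * (K * D)) + D))
    ≡⟨ ring₁ s D K ⟩
  (30 + 2 * K) * (s * D) ∎
  where
  open ≤-Reasoning
  b D V : ℕ
  b = k * t
  D = b ^ n
  V = k + k * t + n * suc (2 * (k + k * (t ∸ 1))) + (E + E)
  ring₁ : ∀ s D K → 9 * (s * D) + (s * D + s * (D + (18 * D + 2 * (K * D)) + D)) ≡ (30 + 2 * K) * (s * D)
  ring₁ = solve-∀
  k≤b : k ≤ b
  k≤b = m≤m*n k t {{>-nonZero (≤-trans (s≤s z≤n) 2≤t)}}
  2≤b : 2 ≤ b
  2≤b = *-mono-≤ 1≤k 2≤t
  1≤b : 1 ≤ b
  1≤b = ≤-trans (s≤s z≤n) 2≤b
  1≤D : 1 ≤ D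
  1≤D = m^n>0 b {{>-nonZero 1≤b}} n
  D≤sD : D ≤ s * D
  D≤sD = m≤n*m D s {{>-nonZero 1≤s}}
  overhead≡ : k + k * (t ∸ 1) ≡ b
  overhead≡ = go t (≤-trans (s≤s z≤n) 2≤t)
    where
    go : ∀ t → 1 ≤ t → k + k * (t ∸ 1) ≡ k * t
    go (suc t) _ = sym (*-suc k t)
  nnb≤ : n * n * b ≤ 3 * D
  nnb≤ = square-power-bound n 2≤b
  setup≤ : n * suc (k * suc (t * 1)) ≤ 9 * (s * D)
  setup≤ = begin
    n * suc (k * suc (t * 1))   ≡⟨ cong (λ z → n * suc z) (trans (cong (λ z → k * suc z) (*-identityʳ t)) (*-suc k t)) ⟩
    n * (1 + (k + b))           ≤⟨ *-monoʳ-≤ n (+-mono-≤ 1≤b (+-monoˡ-≤ b k≤b)) ⟩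
    n * (b + (b + b))           ≤⟨ *-monoˡ-≤ _ (m≤m*n n n {{>-nonZero 1≤n}}) ⟩
    n * n * (b + (b + b))       ≡⟨ ring₂ (n * n) b ⟩
    3 * (n * n * b)             ≤⟨ *-monoʳ-≤ 3 nnb≤ ⟩
    3 * (3 * D)                 ≡⟨ *-assoc 3 3 D ⟨
    9 * D                       ≤⟨ *-monoʳ-≤ 9 D≤sD ⟩
    9 * (s * D)                 ∎
    where
    ring₂ : ∀ n b → n * (b + (b + b)) ≡ 3 * (n * b)
    ring₂ = solve-∀
  vertex≤ : n * suc V ≤ 18 * D + 2 * (K * D)
  vertex≤ = begin
    n * suc V                            ≡⟨ cong (λ z → n * suc (k + b + n * suc (2 * z) + (E + E))) overhead≡ ⟩
    n * (1 + (k + b + n * (1 + 2 * b) + (E + E)))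
      ≤⟨ *-monoʳ-≤ n (+-mono-≤ 1≤b (+-monoˡ-≤ (E + E)
           (+-mono-≤ (+-monoˡ-≤ b k≤b) (*-monoʳ-≤ n (+-monoˡ-≤ (2 * b) 1≤b))))) ⟩
    n * (b + (b + b + n * (b + 2 * b) + (E + E)))  ≡⟨ ring₃ n b E ⟩
    n * (b + (b + b)) + 3 * (n * n * b) + 2 * (n * E)
      ≤⟨ +-monoˡ-≤ (2 * (n * E)) (+-monoˡ-≤ (3 * (n * n * b))
           (*-monoˡ-≤ (b + (b + b)) (m≤m*n n n {{>-nonZero 1≤n}}))) ⟩
    n * n * (b + (b + b)) + 3 * (n * n * b) + 2 * (n * E) ≡⟨ ring₄ (n * n) b (n * E) ⟩
    6 * (n * n * b) + 2 * (n * E)        ≤⟨ +-mono-≤ (*-monoʳ-≤ 6 nnb≤) (*-monoʳ-≤ 2 nE≤) ⟩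
    6 * (3 * D) + 2 * (K * D)            ≡⟨ cong (_+ 2 * (K * D)) (sym (*-assoc 6 3 D)) ⟩
    18 * D + 2 * (K * D)                 ∎
    where
    ring₃ : ∀ n b E → n * (b + (b + b + n * (b + 2 * b) + (E + E))) ≡ n * (b + (b + b)) + 3 * (n * n * b) + 2 * (n * E)
    ring₃ = solve-∀
    ring₄ : ∀ n b e → n * (b + (b + b)) + 3 * (n * b) + 2 * e ≡ 6 * (n * b) + 2 * e
    ring₄ = solve-∀
  stacks≤ : s * suc (n * suc V + D) ≤ s * (D + (18 * D + 2 * (K * D)) + D)
  stacks≤ = *-monoʳ-≤ s (+-mono-≤ (+-mono-≤ 1≤D vertex≤) ≤-refl)

-- Enumeration of the storable configurations

-- A vertex of role first w may hold a stack only while w does not; w itself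
-- and the vertices that are never to hold a stack have role skip.
data Role (n : ℕ) : Set where
  single skip : Role n
  first       : Fin n → Role n

first-injective : ∀ {n} {v w : Fin n} → first v ≡ first w → v ≡ w
first-injective refl = refl

-- Guarantees that each vertex is filled at one stage only. A partner is not filled at its own
-- stage, having role `skip`, and it belongs to a single other vertex.
record Pairing {n : ℕ} (role : Fin n → Role n) : Set where
  field
    partner-skip      : ∀ {u w} → role u ≡ first w → role w ≡ skip
    partner-injective : ∀ {u v w} → role u ≡ first w → role v ≡ first w → u ≡ v

-- What a loop over the vertices has accumulated after `m` rounds, adding at the end as the loop
-- does, whereas `∑` recurses from the front.
prefix : ∀ {n} → (Fin n → ℕ) → ∀ m → m ≤ n → ℕ
prefix f zero    _  = 0
prefix f (suc m) m< = prefix f m (<⇒≤ m<) + f (fromℕ< m<)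

prefix-suc : ∀ {n} (f : Fin (suc n) → ℕ) m (m≤ : m ≤ n) →
             prefix f (suc m) (s≤s m≤) ≡ f zero + prefix (f ∘ suc) m m≤
prefix-suc f zero    m≤ = sym (+-identityʳ (f zero))
prefix-suc f (suc m) m< = trans
  (cong (_+ f (suc (fromℕ< m<)))
    (trans (cong (prefix f (suc m)) (≤-irrelevant _ _)) (prefix-suc f m (<⇒≤ m<))))
  (+-assoc (f zero) _ _)

prefix≡∑ : ∀ {n} (f : Fin n → ℕ) → prefix f n ≤-refl ≡ ∑ f
prefix≡∑ {zero}  f = refl
prefix≡∑ {suc n} f = trans (cong (prefix f (suc n)) (≤-irrelevant ≤-refl (s≤s ≤-refl)))
  (trans (prefix-suc f n ≤-refl) (cong (f zero +_) (prefix≡∑ (f ∘ suc))))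

isSingle isFirst isSkip : ∀ {n} → Role n → ℕ
isSingle single    = 1
isSingle skip      = 0
isSingle (first _) = 0
isFirst single    = 0
isFirst skip      = 0
isFirst (first _) = 1
isSkip single    = 0
isSkip skip      = 1
isSkip (first _) = 0

-- Zero stands for `single`, so that untouched memory says that no vertex is matched or discarded.
roleCode : ∀ {n} → Role n → ℕ
roleCode single    = 0
roleCode skip      = 1
roleCode (first w) = suc (suc (toℕ w))

∑-zero : ∀ {n} (f : Fin n → ℕ) → (∀ u → f u ≡ 0) → ∑ f ≡ 0
∑-zero {zero}  f eq = refl
∑-zero {suc n} f eq = cong₂ _+_ (eq zero) (∑-zero (f ∘ suc) (eq ∘ suc))

applyUpTo-cong : ∀ {A : Set} {f g : ℕ → A} m → (∀ i → i < m → f i ≡ g i) →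
                 applyUpTo f m ≡ applyUpTo g m
applyUpTo-cong zero    eq = refl
applyUpTo-cong (suc m) eq =
  cong₂ _∷_ (eq 0 (s≤s z≤n)) (applyUpTo-cong m (λ i i< → eq (suc i) (s≤s i<)))

applyUpTo-+ : ∀ {A : Set} (f : ℕ → A) a b →
              applyUpTo f (a + b) ≡ applyUpTo f a ++ applyUpTo (λ i → f (a + i)) b
applyUpTo-+ f zero    b = refl
applyUpTo-+ f (suc a) b = cong (f 0 ∷_) (applyUpTo-+ (f ∘ suc) a b)

-- The program that fills the table of winning configurations

-- Arrays 0 to 3 hold the fields of a list of summaries, 4 and 5 the tables for
-- the stacks after the current one and from it on, 6 the powers of the base and
-- 7 the role codes.  Register 5 holds the size of the tables, 8 the position in
-- the input, 9 and 10 the colour and height of the current stack, 11 the start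
-- of the row of x in the adjacency matrix, 12 and 14 the vertex x and its
-- weight, 21 the length of the list, 25 and 27 the number of rows to be copied,
-- 26 and 29 the vertex v to be filled and its weight, 30 and 33 its digit times
-- the weights of v and of x.
appendRow copies heightBody heightsLoop colourBody coloursLoop extendRows : Command
appendRow =
  0 [ var 21 ]:= cell 0 (var 40) ⊞ var 30 ▸
  1 [ var 21 ]:= cell 1 (var 40) ⊞ var 37 ▸
  2 [ var 21 ]:= cell 2 (var 40) ⊞ var 38 ▸
  3 [ var 21 ]:= cell 3 (var 40) ⊞ var 39 ▸
  21 := var 21 ⊞ con 1
copies = for 40 / 41 below var 27 loop appendRow
heightBody =
  30 := var 30 ⊞ var 29 ▸
  33 := var 33 ⊞ var 14 ▸
  (ifnz var 34 then (37 := var 35 ⊞ con 1 ▸ 38 := con 0 ▸ 39 := var 33)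
               else (37 := con 0 ▸ 38 := var 30 ▸ 39 := var 30)) ▸
  copies
heightsLoop = for 35 / 36 below var 2 ⊟ con 1 loop heightBody
colourBody =
  33 := con 0 ▸
  34 := var 28 ⊟ ((var 31 ⊟ var 9) ⊞ (var 9 ⊟ var 31)) ▸
  heightsLoop ▸
  -- The heights 1 to t - 1 take t - 1 additions; this one passes over the digit of height 0, which
  -- codes nothing.
  30 := var 30 ⊞ var 29
coloursLoop = for 31 / 32 below var 1 loop colourBody
extendRows =
  -- `x` has to remain empty: at `v = x` the loops run, but copy no row.
  (ifnz (var 26 ⊟ var 12) ⊞ (var 12 ⊟ var 26) then (27 := var 25) else (27 := con 0)) ▸
  28 := input (var 11 ⊞ var 26) ▸
  29 := cell 6 (var 26) ▸
  30 := con 0 ▸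
  coloursLoop

roleBody rowsLoop tallyBody tally vertexBody : Command
roleBody =
  24 := cell 7 (var 22) ▸
  -- The length is frozen before `u` is filled. The block for a partner thus copies only rows in
  -- which `u` is empty, and the two never host stacks together.
  25 := var 21 ▸
  (ifnz var 24
    then (ifnz var 24 ⊟ con 1
            then (26 := var 22 ▸ extendRows ▸ 26 := var 24 ⊟ con 2 ▸ extendRows)
            else nop)
    else (26 := var 22 ▸ extendRows))
rowsLoop = for 22 / 23 below var 0 loop roleBody
tallyBody =
  (ifnz var 2 ⊟ cell 1 (var 42) then (44 := cell 3 (var 42)) else (44 := cell 2 (var 42))) ▸
  -- Addition serves as disjunction: entries of the tables are only ever distinguished as zero or
  -- nonzero.
  5 [ cell 0 (var 42) ]:= cell 5 (cell 0 (var 42)) ⊞ cell 4 (var 44)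
tally = for 42 / 43 below var 21 loop tallyBody
vertexBody =
  14 := cell 6 (var 12) ▸
  -- Products by repeated addition: register 17 becomes the digit c t + h of the new stack and 20
  -- its multiple by the weight of `x`, the code after a placement on an empty board. Both are
  -- computed once per vertex, not per configuration.
  17 := var 10 ▸
  (for 15 / 16 below var 9 loop (17 := var 17 ⊞ var 2)) ▸
  20 := con 0 ▸
  (for 18 / 19 below var 17 loop (20 := var 20 ⊞ var 14)) ▸
  0 [ con 0 ]:= con 0 ▸
  1 [ con 0 ]:= var 10 ▸
  2 [ con 0 ]:= con 0 ▸
  3 [ con 0 ]:= var 20 ▸
  21 := con 1 ▸
  rowsLoop ▸
  tally ▸
  11 := var 11 ⊞ var 0

vertexLoop copyLoop stackBody stackLoop : Command
vertexLoop = for 12 / 13 below var 0 loop vertexBody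
copyLoop = for 45 / 46 below var 5 loop
  (4 [ var 45 ]:= cell 5 (var 45) ▸ 5 [ var 45 ]:= con 0)
stackBody =
  -- The stacks are read backwards, two cells each, because the tables belong to suffixes.
  8 := var 8 ⊟ con 2 ▸
  9 := input (var 8) ▸
  10 := input (var 8 ⊞ con 1) ▸
  11 := var 3 ⊞ var 3 ▸
  vertexLoop ▸
  copyLoop
stackLoop = for 6 / 7 below var 3 loop stackBody

tabulatePowers setup markAll markEmpty answer : Command
tabulatePowers =
  6 [ con 0 ]:= con 1 ▸
  (for 50 / 51 below var 0 loop
    (52 := con 0 ▸
     53 := cell 6 (var 50) ▸
     (for 54 / 55 below var 1 loop (for 56 / 57 below var 2 loop (52 := var 52 ⊞ var 53))) ▸
     6 [ var 50 ⊞ con 1 ]:= var 52))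
setup = tabulatePowers ▸ 5 := cell 6 (var 0) ▸ 8 := var 3 ⊞ var 3
markAll = for 58 / 59 below var 5 loop (4 [ var 58 ]:= con 1)
markEmpty = 4 [ con 0 ]:= con 1
answer = ifnz cell 4 (con 0) then (0 := con 1) else (0 := con 0)

fill : Command → Command
fill init = setup ▸ init ▸ stackLoop ▸ answer

Initial : ∀ {n k} → Graph n → ℕ → List (Stack k) → Store → Set
Initial {n} {k} G t S h = vars h 0 ≡ n × vars h 1 ≡ k × vars h 2 ≡ t × vars h 3 ≡ length S
                          × (∀ j i → cells h j i ≡ 0)

heights-split : ∀ {k} {t} {S : List (Stack k)} → All (λ s → height s ≤ t) S →
                ∀ pre s post → S ≡ pre ++ s ∷ post → height s ≤ t
heights-split (h ∷ _)  []        s post refl = h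
heights-split (_ ∷ hs) (r ∷ pre) s post refl = heights-split hs pre s post refl

module Enumeration {n k : ℕ} (G : Graph n) (t : ℕ) (role : Fin n → Role n) where
  open Graph G
  open Board {n} {k} G t

  module _ (p q g c : ℕ) (es : List Entry) where

    -- The lists follow the order in which the program appends rows, so that its correctness is an
    -- equality of lists and its time can be read off their lengths.
    byHeight : ℕ → ℕ → List Entry
    byHeight a zero    = []
    byHeight a (suc i) = byHeight a i ++ map (extend p q g c a i) es

    byColour : ℕ → List Entry
    byColour zero    = []
    byColour (suc a) = byColour a ++ byHeight a (t ∸ 1)

    byHeight⁻ : ∀ a m {e} → e ∈ byHeight a m → ∃[ i ] ∃[ f ] i < m × f ∈ es × e ≡ extend p q g c a i f
    byHeight⁻ a (suc m) e∈ with ∈-++⁻ (byHeight a m) e∈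
    ... | inj₁ e∈′ with byHeight⁻ a m e∈′
    ...   | i , f , i< , f∈ , eq = i , f , m<n⇒m<1+n i< , f∈ , eq
    byHeight⁻ a (suc m) e∈ | inj₂ e∈′ with ∈-map⁻ (extend p q g c a m) e∈′
    ... | f , f∈ , eq = m , f , ≤-refl , f∈ , eq

    byHeight⁺ : ∀ a m {i f} → i < m → f ∈ es → extend p q g c a i f ∈ byHeight a m
    byHeight⁺ a (suc m) {i} i< f∈ with m≤n⇒m<n∨m≡n (s≤s⁻¹ i<)
    ... | inj₁ i<m  = ∈-++⁺ˡ (byHeight⁺ a m i<m f∈)
    ... | inj₂ refl = ∈-++⁺ʳ (byHeight a m) (∈-map⁺ (extend p q g c a m) f∈)

    byColour⁻ : ∀ m {e} → e ∈ byColour m →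
      ∃[ a ] ∃[ i ] ∃[ f ] a < m × i < t ∸ 1 × f ∈ es × e ≡ extend p q g c a i f
    byColour⁻ (suc m) e∈ with ∈-++⁻ (byColour m) e∈
    ... | inj₁ e∈′ with byColour⁻ m e∈′
    ...   | a , i , f , a< , rest = a , i , f , m<n⇒m<1+n a< , rest
    byColour⁻ (suc m) e∈ | inj₂ e∈′ with byHeight⁻ m (t ∸ 1) e∈′
    ... | i , f , rest = m , i , f , ≤-refl , rest

    byColour⁺ : ∀ m {a i f} → a < m → i < t ∸ 1 → f ∈ es → extend p q g c a i f ∈ byColour m
    byColour⁺ (suc m) {a} a< i< f∈ with m≤n⇒m<n∨m≡n (s≤s⁻¹ a<)
    ... | inj₁ a<m  = ∈-++⁺ˡ (byColour⁺ m a<m i< f∈)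
    ... | inj₂ refl = ∈-++⁺ʳ (byColour m) (byHeight⁺ m (t ∸ 1) i< f∈)

    length-byHeight : ∀ a m → length (byHeight a m) ≡ m * length es
    length-byHeight a zero    = refl
    length-byHeight a (suc m) = trans (length-++ (byHeight a m))
      (trans (cong₂ _+_ (length-byHeight a m) (length-map (extend p q g c a m) es))
             (+-comm (m * length es) (length es)))

    length-byColour : ∀ m → length (byColour m) ≡ m * ((t ∸ 1) * length es)
    length-byColour zero    = refl
    length-byColour (suc m) = trans (length-++ (byColour m))
      (trans (cong₂ _+_ (length-byColour m) (length-byHeight m (t ∸ 1)))
             (+-comm (m * ((t ∸ 1) * length es)) _))

  GoodConf : Conf → Set
  GoodConf δ = ∀ {u w} → role u ≡ first w → δ u ≡ nothing ⊎ δ w ≡ nothing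

  module _ (s : Stack k) (x : Fin n) where

    seed : Fin n → List Entry → List Entry
    seed v es = if does (v ≟ᶠ x) then [] else es

    growth : Fin n → List Entry → List Entry
    growth v es = byColour (base ^ toℕ v) (base ^ toℕ x) (bit (adjacent x v))
                           (toℕ (colour s)) (seed v es) k

    grow : Role n → Fin n → List Entry → List Entry
    grow skip      u es = es
    grow single    u es = es ++ growth u es
    grow (first w) u es = (es ++ growth u es) ++ growth w es

    stage : ∀ m → m ≤ n → List Entry
    stage zero    _  = [ summary s x allEmpty ]
    stage (suc m) m< = grow (role (fromℕ< m<)) (fromℕ< m<) (stage m (<⇒≤ m<))

    -- The vertices that the first `m` stages can fill; a partner is filled at the stage of the
    -- vertex it is assigned to, whatever its own number.
    Support : ℕ → Conf → Set
    Support m δ = ∀ {v} → δ v ≢ nothing →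
      (toℕ v < m × role v ≢ skip) ⊎ (∃[ u ] toℕ u < m × role u ≡ first v)

    Admissible : ℕ → Conf → Set
    Admissible m δ = δ x ≡ nothing × Small δ × Support m δ

    seed⁻ : ∀ v es {e} → e ∈ seed v es → v ≢ x × e ∈ es
    seed⁻ v es e∈ with v ≟ᶠ x
    seed⁻ v es () | yes _
    ... | no v≢x = v≢x , e∈

    seed⁺ : ∀ v es {e} → v ≢ x → e ∈ es → e ∈ seed v es
    seed⁺ v es v≢x e∈ rewrite dec-false (v ≟ᶠ x) v≢x = e∈

    Sound : ℕ → List Entry → Set
    Sound m es = ∀ {e} → e ∈ es → ∃[ δ ] e ≡ summary s x δ × Admissible m δ

    Complete : ℕ → List Entry → Set
    Complete m es = ∀ {δ} → GoodConf δ → Admissible m δ → summary s x δ ∈ es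

    Support-suc : ∀ {m δ} → Support m δ → Support (suc m) δ
    Support-suc sup ne with sup ne
    ... | inj₁ (v< , r)     = inj₁ (m<n⇒m<1+n v< , r)
    ... | inj₂ (u , u< , r) = inj₂ (u , m<n⇒m<1+n u< , r)

    pred-pos : ∀ {i} → i < t ∸ 1 → suc i < t
    pred-pos {i} i< = ≤-trans (s≤s i<) (suc-pred-≤ t i<)
      where
      suc-pred-≤ : ∀ t → i < t ∸ 1 → suc (t ∸ 1) ≤ t
      suc-pred-≤ (suc t) _ = ≤-refl

    -- `fresh` says that no configuration listed so far uses `v`. So `v` is empty in it, and
    -- `summary-put` turns the arithmetic of `extend` into the putting of a stack.
    growth-sound : ∀ {m es} v →
      (∀ {δ} → δ v ≢ nothing → Support m δ → ⊥) →
      ((toℕ v < suc m × role v ≢ skip) ⊎ (∃[ u ] toℕ u < suc m × role u ≡ first v)) →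
      Sound m es → Sound (suc m) (growth v es)
    growth-sound {m} {es} v fresh seen sound e∈ with byColour⁻ _ _ _ _ _ k e∈
    ... | a , i , f , a<k , i< , f∈ , refl with seed⁻ v es f∈
    ... | v≢x , f∈es with sound f∈es
    ... | δ , refl , empty , small , sup = put δ v z ,
        trans (cong (λ a → extend (base ^ toℕ v) (base ^ toℕ x) (bit (adjacent x v))
                       (toℕ (colour s)) a i (summary s x δ)) (sym (toℕ-fromℕ< a<k)))
          (sym (summary-put s x δ v (fromℕ< a<k) i δv)) ,
        trans (put-off δ v z (v≢x ∘ sym)) empty , small′ , sup′
      where
      z : Stack k
      z = stack (fromℕ< a<k) (suc i)
      δv : δ v ≡ nothing
      δv with δ v in eq
      ... | nothing = refl
      ... | just _  = ⊥-elim (fresh {δ} (just≢nothing eq) sup)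
      small′ : Small (put δ v z)
      small′ u eq with u ≟ᶠ v
      small′ u refl | yes _ = pred-pos i<
      small′ u eq   | no _  = small u eq
      sup′ : Support (suc m) (put δ v z)
      sup′ {u} ne with u ≟ᶠ v
      ... | yes refl = seen
      ... | no _ = Support-suc {δ = δ} sup ne

    -- The stack on `v` is taken away and put back: the configuration without it was listed before,
    -- and its extension by the right colour and height is the wanted summary.
    growth-complete : ∀ {es δ} v {z} → δ v ≡ just z → δ x ≡ nothing → Small δ →
      summary s x (clear δ v) ∈ es → summary s x δ ∈ growth v es
    growth-complete {es} {δ} v {stack a (suc i)} eq empty small ∈es =
      subst (_∈ growth v es)
        (trans (sym (summary-put s x (clear δ v) v a i (clear-at δ v)))
               (sym (summary-cong s x (put-clear δ v eq))))
        (byColour⁺ _ _ _ _ _ k (toℕ<n a) (∸-monoˡ-≤ 1 (small v eq)) (seed⁺ v es v≢x ∈es))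
      where
      v≢x : v ≢ x
      v≢x refl = just≢nothing eq empty

    clear-nothing : ∀ δ v {u} → δ u ≡ nothing → clear δ v u ≡ nothing
    clear-nothing δ v {u} eq with u ≟ᶠ v
    ... | yes _ = refl
    ... | no _  = eq

    clear-Good : ∀ {δ} v → GoodConf δ → GoodConf (clear δ v)
    clear-Good {δ} v good r with good r
    ... | inj₁ eq = inj₁ (clear-nothing δ v eq)
    ... | inj₂ eq = inj₂ (clear-nothing δ v eq)

    clear-Small : ∀ {δ} v → Small δ → Small (clear δ v)
    clear-Small {δ} v small u eq with u ≟ᶠ v
    ... | no _ = small u eq

    module _ (pairing : Pairing role) where
      open Pairing pairing

      stage-sound : ∀ m (m≤ : m ≤ n) → Sound m (stage m m≤)
      stage-sound zero m≤ (here refl) =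
        allEmpty , refl , refl , (λ v ()) , (λ ne → contradiction refl ne)
      stage-sound (suc m) m< {e} e∈ = go (role u) refl e∈
        where
        u : Fin n
        u = fromℕ< m<
        es : List Entry
        es = stage m (<⇒≤ m<)
        ih : Sound m es
        ih = stage-sound m (<⇒≤ m<)
        u< : toℕ u < suc m
        u< = s≤s (≤-reflexive (toℕ-fromℕ< m<))
        lift : ∀ {e} → e ∈ es → ∃[ δ ] e ≡ summary s x δ × Admissible (suc m) δ
        lift e∈ with ih e∈
        ... | δ , eq , empty , small , sup = δ , eq , empty , small , Support-suc {δ = δ} sup
        fresh-u : role u ≢ skip → ∀ {δ} → δ u ≢ nothing → Support m δ → ⊥
        fresh-u r {δ} ne sup with sup ne
        ... | inj₁ (lt , _)    = <-irrefl (toℕ-fromℕ< m<) lt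
        ... | inj₂ (_ , _ , q) = r (partner-skip q)
        fresh-w : ∀ {w} → role u ≡ first w → ∀ {δ} → δ w ≢ nothing → Support m δ → ⊥
        fresh-w r {δ} ne sup with sup ne
        ... | inj₁ (_ , q) = q (partner-skip r)
        ... | inj₂ (u′ , lt , q) with partner-injective q r
        ...   | refl = <-irrefl (toℕ-fromℕ< m<) lt
        go : ∀ r → role u ≡ r → e ∈ grow r u es → ∃[ δ ] e ≡ summary s x δ × Admissible (suc m) δ
        go skip   r e∈ = lift e∈
        go single r e∈ with ∈-++⁻ es e∈
        ... | inj₁ e∈′ = lift e∈′
        ... | inj₂ e∈′ = growth-sound u (λ {δ} → fresh-u u≢skip {δ}) (inj₁ (u< , u≢skip)) ih e∈′
          where
          u≢skip : role u ≢ skip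
          u≢skip z with () ← trans (sym r) z
        go (first w) r e∈ with ∈-++⁻ (es ++ growth u es) e∈
        ... | inj₂ e∈′ = growth-sound w (λ {δ} → fresh-w r {δ}) (inj₂ (u , u< , r)) ih e∈′
        ... | inj₁ e∈′ with ∈-++⁻ es e∈′
        ...   | inj₁ e∈″ = lift e∈″
        ...   | inj₂ e∈″ = growth-sound u (λ {δ} → fresh-u u≢skip {δ}) (inj₁ (u< , u≢skip)) ih e∈″
          where
          u≢skip : role u ≢ skip
          u≢skip z with () ← trans (sym r) z

      -- In a good configuration at most one of `u` and its partner hosts a stack. Clearing that
      -- vertex leads to a configuration of the preceding stage, and the cleared vertex tells the
      -- block in which the row is found.
      stage-complete : ∀ m (m≤ : m ≤ n) → Complete m (stage m m≤)
      stage-complete zero m≤ {δ} good (_ , _ , sup) = here (summary-cong s x all-nothing)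
        where
        all-nothing : δ ≗ᶜ allEmpty
        all-nothing v with δ v in eq
        ... | nothing = refl
        ... | just _ with sup (just≢nothing eq)
        ...   | inj₂ (_ , () , _)
      stage-complete (suc m) m< {δ} good (empty , small , sup) = go (role u) refl
        where
        u : Fin n
        u = fromℕ< m<
        es : List Entry
        es = stage m (<⇒≤ m<)
        ih : Complete m es
        ih = stage-complete m (<⇒≤ m<)
        earlier : ∀ {v} → toℕ v < suc m → v ≢ u → toℕ v < m
        earlier {v} v< v≢u with m≤n⇒m<n∨m≡n (s≤s⁻¹ v<)
        ... | inj₁ lt = lt
        ... | inj₂ eq = contradiction (toℕ-injective (trans eq (sym (toℕ-fromℕ< m<)))) v≢u
        -- Once u is empty, and so is a partner it may have, u has no influence.
        shrink : ∀ {ε} → (∀ {v} → ε v ≢ nothing → δ v ≢ nothing) →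
                 (role u ≢ skip → ε u ≡ nothing) →
                 (∀ {w} → role u ≡ first w → ε w ≡ nothing) → Support m ε
        shrink {ε} sub u-empty w-empty {v} ne with sup (sub ne)
        ... | inj₁ (v< , r) = inj₁ (earlier v< (λ where refl → ne (u-empty r)) , r)
        ... | inj₂ (u′ , u′< , r) = inj₂ (u′ , earlier u′< (λ where refl → ne (w-empty r)) , r)
        clear-sub : ∀ v {y} → clear δ v y ≢ nothing → δ y ≢ nothing
        clear-sub v ne eq = ne (clear-nothing δ v eq)
        old : (role u ≢ skip → δ u ≡ nothing) → (∀ {w} → role u ≡ first w → δ w ≡ nothing) →
              summary s x δ ∈ es
        old p q = ih good (empty , small , shrink (λ ne → ne) p q)
        new : ∀ v {z} → δ v ≡ just z → (role u ≢ skip → clear δ v u ≡ nothing) →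
              (∀ {w} → role u ≡ first w → clear δ v w ≡ nothing) → summary s x δ ∈ growth v es
        new v eq p q = growth-complete v eq empty small
          (ih (clear-Good v good) (clear-nothing δ v empty , clear-Small v small ,
               shrink (clear-sub v) p q))
        not-first : ∀ {r} → role u ≡ r → (∀ {w} → r ≢ first w) →
                    ∀ {ε : Conf} {w} → role u ≡ first w → ε w ≡ nothing
        not-first r ne q = ⊥-elim (ne (trans (sym r) q))
        go : ∀ r → role u ≡ r → summary s x δ ∈ grow r u es
        go skip r = old (λ ne → contradiction r ne) (not-first r (λ ()) {δ})
        go single r with δ u in eq
        ... | nothing = ∈-++⁺ˡ (old (λ _ → eq) (not-first r (λ ()) {δ}))
        ... | just _  = ∈-++⁺ʳ es (new u eq (λ _ → clear-at δ u) (not-first r (λ ()) {clear δ u}))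
        go (first w) r with δ u in eq | δ w in eq′
        ... | nothing | nothing = ∈-++⁺ˡ (∈-++⁺ˡ (old (λ _ → eq)
                (λ q → subst (λ w → δ w ≡ nothing) (first-injective (trans (sym r) q)) eq′)))
        ... | just _ | nothing = ∈-++⁺ˡ (∈-++⁺ʳ es (new u eq (λ _ → clear-at δ u)
                (λ q → clear-nothing δ u (subst (λ w → δ w ≡ nothing) (first-injective (trans (sym r) q)) eq′))))
        ... | nothing | just _ = ∈-++⁺ʳ (es ++ growth u es) (new w eq′
                (λ _ → clear-nothing δ w eq)
                (λ q → subst (λ v → clear δ w v ≡ nothing) (first-injective (trans (sym r) q)) (clear-at δ w)))
        ... | just _ | just _ with good r
        ...   | inj₁ z = contradiction z (just≢nothing eq)
        ...   | inj₂ z = contradiction z (just≢nothing eq′)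

    entries : List Entry
    entries = stage n ≤-refl

  -- Excludes stacks on discarded vertices, that is, those of role `skip` that are nobody's partner.
  Storable : Conf → Set
  Storable δ = ∀ {v} → δ v ≢ nothing → role v ≢ skip ⊎ (∃[ u ] role u ≡ first v)

  -- Winning configurations that disregard the roles are not enumerated and may stay unmarked.
  record Marks (Goal : Conf → Set) (S : List (Stack k)) (W : ℕ → ℕ) : Set where
    field
      marked⇒wins : ∀ {δ} → Small δ → W (code δ) ≢ 0 → Wins Goal δ S
      wins⇒marked : ∀ {δ} → Small δ → GoodConf δ → Wins Goal δ S → W (code δ) ≢ 0

  -- `X` is the set of vertices already tried, so that the loop invariant and the final result are
  -- instances of one statement.
  Updated : Stack k → (ℕ → ℕ) → (Fin n → Set) → (ℕ → ℕ) → Set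
  Updated s W X W′ = ∀ y →
      (W′ y ≢ 0 → ∃[ x ] ∃[ e ] X x × e ∈ entries s x × Entry.source e ≡ y × W (target e) ≢ 0)
    × (∀ {x e} → X x → e ∈ entries s x → Entry.source e ≡ y → W (target e) ≢ 0 → W′ y ≢ 0)

  module _ .{{_ : NonZero t}} (0<base : 0 < base) (pairing : Pairing role)
    (Goal : Conf → Set) (Goal-cong : ∀ {δ ε} → δ ≗ᶜ ε → Goal δ → Goal ε)
    (place-Good : ∀ {δ} s x → GoodConf δ → GoodConf (place G t δ s x))
    (wins⇒Storable : ∀ {δ S} → Wins Goal δ S → Storable δ) where

    -- The backward step of the dynamic programming. A nonzero entry comes from a listed
    -- configuration with the same code, which is `δ` up to pointwise equality since codes are
    -- injective; conversely, the first move of a winning play is a listed one, by completeness.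
    Marks-step : ∀ {s S W W′} → Marks Goal S W → Updated s W (λ _ → ⊤) W′ → Marks Goal (s ∷ S) W′
    Marks-step {s} {S} {W} {W′} marks upd = record { marked⇒wins = to ; wins⇒marked = from }
      where
      open Marks marks
      to : ∀ {δ} → Small δ → W′ (code δ) ≢ 0 → Wins Goal δ (s ∷ S)
      to {δ} small ne with proj₁ (upd (code δ)) ne
      ... | x , e , _ , e∈ , src , W≢0 with stage-sound s x pairing n ≤-refl e∈
      ... | ε , refl , empty , small′ , _ with code-injective 0<base small′ small src
      ... | ε≗δ with marked⇒wins (place-Small s x small′)
                      (subst (λ y → W y ≢ 0) (sym (code-place s x ε empty)) W≢0)
      ... | ζ , play , goal with plays-cong ε≗δ (move {s = s} x empty play)
      ... | ζ′ , play′ , ζ≗ζ′ = ζ′ , play′ , Goal-cong ζ≗ζ′ goal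
      from : ∀ {δ} → Small δ → GoodConf δ → Wins Goal δ (s ∷ S) → W′ (code δ) ≢ 0
      from {δ} small good wins@(ζ , move x empty play , goal) =
        proj₂ (upd (code δ)) {x} tt
          (stage-complete s x pairing n ≤-refl good (empty , small , support)) refl
          (subst (λ y → W y ≢ 0) (code-place s x δ empty)
            (wins⇒marked (place-Small s x small) (place-Good s x good) (ζ , play , goal)))
        where
        support : Support s x n δ
        support {v} ne with wins⇒Storable wins ne
        ... | inj₁ r       = inj₁ (toℕ<n v , r)
        ... | inj₂ (u , r) = inj₂ (u , toℕ<n u , r)

  -- Number of enumerated configurations

  length-seed : ∀ s x v es → length (seed s x v es) ≤ length es
  length-seed s x v es with v ≟ᶠ x
  ... | yes _ = z≤n
  ... | no _  = ≤-refl

  length-growth : ∀ s x v es → length (growth s x v es) ≡ k * ((t ∸ 1) * length (seed s x v es))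
  length-growth s x v es = length-byColour _ _ _ _ (seed s x v es) k

  module _ (all-single : ∀ u → role u ≡ single) where

    M : ℕ
    M = suc (k * (t ∸ 1))

    -- Each stage multiplies the length by `M`, except that of `x`, which leaves it unchanged. The
    -- extra factor `M` on the left avoids a subtraction in the exponent.
    stage-length : ∀ s x m (m≤ : m ≤ n) →
      (toℕ x < m → M * length (stage s x m m≤) ≡ M ^ m) × (m ≤ toℕ x → length (stage s x m m≤) ≡ M ^ m)
    stage-length s x zero m≤ = (λ ()) , (λ _ → refl)
    stage-length s x (suc m) m< = under , above
      where
      u : Fin n
      u = fromℕ< m<
      u≡ : toℕ u ≡ m
      u≡ = toℕ-fromℕ< m<
      es : List Entry
      es = stage s x m (<⇒≤ m<)
      len : length (grow s x (role u) u es) ≡ length es + k * ((t ∸ 1) * length (seed s x u es))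
      len rewrite all-single u = trans (length-++ es) (cong (length es +_) (length-growth s x u es))
      seed-off : u ≢ x → seed s x u es ≡ es
      seed-off ne rewrite dec-false (u ≟ᶠ x) ne = refl
      seed-at : u ≡ x → seed s x u es ≡ []
      seed-at eq rewrite dec-true (u ≟ᶠ x) eq = refl
      ring : ∀ L k w → L + k * (w * L) ≡ suc (k * w) * L
      ring = solve-∀
      full : u ≢ x → length (grow s x (role u) u es) ≡ M * length es
      full ne = trans len (trans (cong (λ xs → length es + k * ((t ∸ 1) * length xs)) (seed-off ne))
                                 (ring (length es) k (t ∸ 1)))
      above : suc m ≤ toℕ x → length (grow s x (role u) u es) ≡ M ^ suc m
      above lt = trans (full (λ eq → <-irrefl (trans (sym u≡) (cong toℕ eq)) lt))
                       (cong (M *_) (proj₂ (stage-length s x m (<⇒≤ m<)) (<⇒≤ lt)))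
      under : toℕ x < suc m → M * length (grow s x (role u) u es) ≡ M ^ suc m
      under lt with m≤n⇒m<n∨m≡n (s≤s⁻¹ lt)
      ... | inj₁ lt′ = cong (M *_) (trans (full (λ eq → <-irrefl (trans (cong toℕ (sym eq)) u≡) lt′))
                                          (proj₁ (stage-length s x m (<⇒≤ m<)) lt′))
      ... | inj₂ eq = cong (M *_) (trans len (trans (cong (λ xs → length es + k * ((t ∸ 1) * length xs))
              (seed-at (toℕ-injective (trans u≡ (sym eq)))))
              (trans (cong (length es +_) (trans (cong (k *_) (*-zeroʳ (t ∸ 1))) (*-zeroʳ k)))
                (trans (+-identityʳ _) (proj₂ (stage-length s x m (<⇒≤ m<)) (≤-reflexive (sym eq)))))))

    entries-length : ∀ s x → length (entries s x) ≤ M ^ (n ∸ 1)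
    entries-length s x = cancel n (toℕ<n x) (proj₁ (stage-length s x n ≤-refl) (toℕ<n x))
      where
      cancel : ∀ n {L} → toℕ x < n → M * L ≡ M ^ n → L ≤ M ^ (n ∸ 1)
      cancel (suc n) {L} _ eq = ≤-reflexive (*-cancelˡ-≡ L (M ^ n) M eq)

  count : (Role n → ℕ) → ℕ
  count f = ∑ (f ∘ role)

  growth≤ : k ≡ 1 → ∀ s x v es → length (growth s x v es) ≤ (t ∸ 1) * length es
  growth≤ k≡1 s x v es = ≤-trans (≤-reflexive (trans (length-growth s x v es)
                               (trans (cong (_* ((t ∸ 1) * length (seed s x v es))) k≡1) (+-identityʳ _))))
                             (*-monoʳ-≤ (t ∸ 1) (length-seed s x v es))

  -- Both blocks of a pair copy the same rows, so a pair contributes the factor 1 + 2 (t - 1) = 2 t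
  -- - 1. The saving at `x` is given up; the pairs make up for it.
  entries-length-pairs : k ≡ 1 → 0 < t → ∀ s x → length (entries s x) ≤ t ^ count isSingle * (t + (t ∸ 1)) ^ count isFirst
  entries-length-pairs k≡1 0<t s x = subst₂ (λ a b → length (entries s x) ≤ t ^ a * q ^ b)
      (prefix≡∑ (isSingle ∘ role)) (prefix≡∑ (isFirst ∘ role)) (go n ≤-refl)
    where
    q : ℕ
    q = t + (t ∸ 1)
    r f : ∀ m → m ≤ n → ℕ
    r = prefix (isSingle ∘ role)
    f = prefix (isFirst ∘ role)
    t≡ : suc (t ∸ 1) ≡ t
    t≡ = suc-pred′ t 0<t
      where
      suc-pred′ : ∀ t → 0 < t → suc (t ∸ 1) ≡ t
      suc-pred′ (suc t) _ = refl
    go : ∀ m (m≤ : m ≤ n) → length (stage s x m m≤) ≤ t ^ r m m≤ * q ^ f m m≤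
    go zero    m≤ = ≤-refl
    go (suc m) m< with role (fromℕ< m<) | go m (<⇒≤ m<)
    ... | skip | ih rewrite +-identityʳ (r m (<⇒≤ m<)) | +-identityʳ (f m (<⇒≤ m<)) = ih
    ... | single | ih rewrite +-comm (r m (<⇒≤ m<)) 1 | +-identityʳ (f m (<⇒≤ m<)) = begin
      length (es ++ growth s x u es)             ≡⟨ length-++ es ⟩
      length es + length (growth s x u es)       ≤⟨ +-monoʳ-≤ (length es) (growth≤ k≡1 s x u es) ⟩
      suc (t ∸ 1) * length es                    ≡⟨ cong (_* length es) t≡ ⟩
      t * length es                              ≤⟨ *-monoʳ-≤ t ih ⟩
      t * (t ^ r m (<⇒≤ m<) * q ^ f m (<⇒≤ m<))  ≡⟨ *-assoc t _ _ ⟨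
      t * t ^ r m (<⇒≤ m<) * q ^ f m (<⇒≤ m<)    ∎
      where
      open ≤-Reasoning
      u : Fin n
      u = fromℕ< m<
      es : List Entry
      es = stage s x m (<⇒≤ m<)
    ... | first w | ih rewrite +-comm (f m (<⇒≤ m<)) 1 | +-identityʳ (r m (<⇒≤ m<)) = begin
      length ((es ++ growth s x u es) ++ growth s x w es)
        ≡⟨ trans (length-++ (es ++ growth s x u es)) (cong (_+ length (growth s x w es)) (length-++ es)) ⟩
      length es + length (growth s x u es) + length (growth s x w es)
        ≤⟨ +-mono-≤ (+-monoʳ-≤ (length es) (growth≤ k≡1 s x u es)) (growth≤ k≡1 s x w es) ⟩
      suc (t ∸ 1) * length es + (t ∸ 1) * length es   ≡⟨ cong (λ z → z * length es + (t ∸ 1) * length es) t≡ ⟩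
      t * length es + (t ∸ 1) * length es             ≡⟨ *-distribʳ-+ (length es) t (t ∸ 1) ⟨
      q * length es                                   ≤⟨ *-monoʳ-≤ q ih ⟩
      q * (t ^ r m (<⇒≤ m<) * q ^ f m (<⇒≤ m<))       ≡⟨ ring q (t ^ r m (<⇒≤ m<)) (q ^ f m (<⇒≤ m<)) ⟩
      t ^ r m (<⇒≤ m<) * (q * q ^ f m (<⇒≤ m<))       ∎
      where
      open ≤-Reasoning
      ring : ∀ q a b → q * (a * b) ≡ a * (q * b)
      ring = solve-∀
      u : Fin n
      u = fromℕ< m<
      es : List Entry
      es = stage s x m (<⇒≤ m<)

  -- Correctness and running time of the table program

  module Filling (inp : ℕ → ℕ) (S : List (Stack k))
    (inp-adjacent : ∀ u v → inp (length S + length S + toℕ u * n + toℕ v) ≡ bit (adjacent u v))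
    (inp-stack : ∀ pre s post → S ≡ pre ++ s ∷ post →
       inp (length pre + length pre) ≡ toℕ (colour s) × inp (length pre + length pre + 1) ≡ height s)
    where
    open Semantics inp

    row : Store → ℕ → Entry
    row g i = entry (cells g 0 i) (cells g 1 i) (cells g 2 i) (cells g 3 i)

    table : Store → List Entry
    table g = applyUpTo (row g) (vars g 21)

    row-append-old : ∀ g i → i ≢ vars g 21 → row (exec appendRow g) i ≡ row g i
    row-append-old g i ne = entry-≡
      (upd-other (cells g 0) _ (ne ∘ sym)) (upd-other (cells g 1) _ (ne ∘ sym))
      (upd-other (cells g 2) _ (ne ∘ sym)) (upd-other (cells g 3) _ (ne ∘ sym))

    row-append-new : ∀ g → row (exec appendRow g) (vars g 21)
      ≡ increase (vars g 30) (vars g 37) (vars g 38) (vars g 39) (row g (vars g 40))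
    row-append-new g = entry-≡
      (upd-same (cells g 0) (vars g 21) _) (upd-same (cells g 1) (vars g 21) _)
      (upd-same (cells g 2) (vars g 21) _) (upd-same (cells g 3) (vars g 21) _)

    -- `rows≡` is what allows block after block to be copied from the same old rows while the list
    -- grows.
    record Grown (h g : Store) (xs : List Entry) : Set where
      constructor grown
      field
        table≡ : table g ≡ table h ++ xs
        rows≡  : ∀ i → i < vars h 21 → row g i ≡ row h i

    Grown-length : ∀ {h g xs} → Grown h g xs → vars h 21 ≤ vars g 21
    Grown-length {h} {g} {xs} (grown eq _) = ≤-trans (m≤m+n _ (length xs)) (≤-reflexive (sym (begin
      vars g 21                    ≡⟨ length-applyUpTo (row g) (vars g 21) ⟨
      length (table g)             ≡⟨ cong length eq ⟩
      length (table h ++ xs)       ≡⟨ length-++ (table h) ⟩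
      length (table h) + length xs ≡⟨ cong (_+ length xs) (length-applyUpTo (row h) (vars h 21)) ⟩
      vars h 21 + length xs        ∎)))
      where open ≡-Reasoning

    Grown-trans : ∀ {h g f xs ys} → Grown h g xs → Grown g f ys → Grown h f (xs ++ ys)
    Grown-trans {h} {g} {f} {xs} {ys} G₁@(grown eq rows) (grown eq′ rows′) = grown
      (trans eq′ (trans (cong (_++ ys) eq) (++-assoc (table h) xs ys)))
      (λ i i< → trans (rows′ i (≤-trans i< (Grown-length G₁))) (rows i i<))

    Grown-refl : ∀ {h g} → vars g 21 ≡ vars h 21 → (∀ i → row g i ≡ row h i) → Grown h g []
    Grown-refl {h} {g} eq rows = grown
      (trans (cong (applyUpTo (row g)) eq)
        (trans (applyUpTo-cong (vars h 21) (λ i _ → rows i)) (sym (++-identityʳ (table h)))))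
      (λ i _ → rows i)

    -- Source and destination are parts of the same arrays; `cnt ≤ vars h 21` keeps the rows that
    -- are read below the cells that are written.
    copies-run : ∀ h cnt → vars h 27 ≡ cnt → cnt ≤ vars h 21 →
      Run copies h cnt (λ g → Grown h g
        (map (increase (vars h 30) (vars h 37) (vars h 38) (vars h 39)) (applyUpTo (row h) cnt)))
    copies-run h cnt at-27 cnt≤ = run-mono (≤-reflexive (*-identityʳ cnt)) finish
      (run-for-const 0 Inv refl at-27 start body)
      where
      L : ℕ
      L = vars h 21
      f : Entry → Entry
      f = increase (vars h 30) (vars h 37) (vars h 38) (vars h 39)
      Inv : ℕ → Store → Set
      Inv j g = vars g 21 ≡ L + j × (∀ i → i < L → row g i ≡ row h i)
                × (∀ i → i < j → row g (L + i) ≡ f (row h i))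
      start : Inv 0 (setVar 40 0 (setVar 41 cnt h))
      start = sym (+-identityʳ L) , (λ i _ → refl) , (λ i ())
      finish : ∀ {g} → Inv cnt g → Grown h g (map f (applyUpTo (row h) cnt))
      finish {g} (len , old , new) = grown
        (trans (cong (applyUpTo (row g)) len) (trans (applyUpTo-+ (row g) L cnt)
          (cong₂ _++_ (applyUpTo-cong L old)
            (trans (applyUpTo-cong cnt new) (sym (map-applyUpTo (row h) f cnt)))))) old
      body : ∀ j g → j < cnt → vars g 40 ≡ j → Frame copies h g → Inv j g →
             Run appendRow g 0 (λ g′ → Inv (suc j) (bump 40 g′))
      body j g j< at-40 F (len , old , new) = run z≤n
        ( trans (cong (_+ 1) len) (trans (+-assoc L j 1) (cong (L +_) (+-comm j 1)))
        , (λ i i< → trans (row-append-old g i (λ eq → <-irrefl (trans eq len) (≤-trans i< (m≤m+n L j))))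
                          (old i i<))
        , at )
        where
        at : ∀ i → i < suc j → row (exec appendRow g) (L + i) ≡ f (row h i)
        at i i< with m≤n⇒m<n∨m≡n (s≤s⁻¹ i<)
        ... | inj₁ i<j = trans (row-append-old g (L + i)
                (λ eq → <-irrefl (+-cancelˡ-≡ L i j (trans eq len)) i<j)) (new i i<j)
        ... | inj₂ refl = begin
          row (exec appendRow g) (L + i)         ≡⟨ cong (row (exec appendRow g)) len ⟨
          row (exec appendRow g) (vars g 21)     ≡⟨ row-append-new g ⟩
          increase (vars g 30) (vars g 37) (vars g 38) (vars g 39) (row g (vars g 40))
            ≡⟨ cong (λ e → increase (vars g 30) (vars g 37) (vars g 38) (vars g 39) e)
                    (trans (cong (row g) at-40) (old i (≤-trans j< cnt≤))) ⟩
          increase (vars g 30) (vars g 37) (vars g 38) (vars g 39) (row h i)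
            ≡⟨ entry-≡ (cong (_ +_) (var≡ F 30 refl)) (cong (_ +_) (var≡ F 37 refl))
                       (cong (_ +_) (var≡ F 38 refl)) (cong (_ +_) (var≡ F 39 refl)) ⟩
          f (row h i)                            ∎
          where open ≡-Reasoning

    increase-choose : ∀ m {o s s′ v v′ w w′} e →
      increase o (choose m s s′) (choose m v v′) (choose m w w′) e
        ≡ choose m (increase o s v w) (increase o s′ v′ w′) e
    increase-choose zero    e = refl
    increase-choose (suc m) e = refl

    module _ (p q b c : ℕ) where

      flag : ℕ → ℕ
      flag a = b ∸ ((a ∸ c) + (c ∸ a))

      -- Registers 30 and 33 carry the only two products in `extend`, digit times `p` and height
      -- times `q`, each updated by one addition per height. The offsets are thus fixed before the
      -- rows are copied, and a row costs constant time.
      heights-run : ∀ h a cnt → vars h 2 ≡ t → vars h 14 ≡ q → vars h 27 ≡ cnt → vars h 29 ≡ p →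
        vars h 34 ≡ flag a → cnt ≤ vars h 21 → vars h 30 ≡ (a * t + 0) * p → vars h 33 ≡ 0 →
        Run heightsLoop h ((t ∸ 1) * suc cnt)
          (λ g → Grown h g (byHeight p q b c (applyUpTo (row h) cnt) a (t ∸ 1))
                 × vars g 30 ≡ (a * t + (t ∸ 1)) * p)
      heights-run h a cnt at-2 at-14 at-27 at-29 at-34 cnt≤ at-30 at-33 =
        run-mono ≤-refl (λ (G′ , o , _) → G′ , o)
          (run-for-const cnt Inv refl (cong (_∸ 1) at-2) start body)
        where
        es : List Entry
        es = applyUpTo (row h) cnt
        Inv : ℕ → Store → Set
        Inv i g = Grown h g (byHeight p q b c es a i) × vars g 30 ≡ (a * t + i) * p
                  × vars g 33 ≡ i * q
        start : Inv 0 (setVar 35 0 (setVar 36 (t ∸ 1) h))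
        start = Grown-refl {h} refl (λ i → refl) , at-30 , at-33
        ring : ∀ x i p → (x + i) * p + p ≡ (x + suc i) * p
        ring = solve-∀
        body : ∀ i g → i < t ∸ 1 → vars g 35 ≡ i → Frame heightsLoop h g → Inv i g →
               Run heightBody g cnt (λ g′ → Inv (suc i) (bump 35 g′))
        body i g i< at-35 F (grow′ , g30 , g33) =
          after (after (run-seq {t₁ = 0} {Q = Chosen}
            (run-if (λ ne → run z≤n (sym (choose-pos ne) , sym (choose-pos ne) , sym (choose-pos ne)))
                    (λ eq → run z≤n (sym (choose-zero eq) , sym (choose-zero eq) , sym (choose-zero eq))))
            last))
          where
          m o w : ℕ
          m = vars g 34
          o = vars g 30 + vars g 29
          w = vars g 33 + vars g 14
          Chosen : Store → Set
          Chosen f = vars f 37 ≡ choose m (vars g 35 + 1) 0 × vars f 38 ≡ choose m 0 o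
                     × vars f 39 ≡ choose m w o
          g₂ : Store
          g₂ = setVar 33 w (setVar 30 o g)
          split : Command
          split = ifnz var 34 then (37 := var 35 ⊞ con 1 ▸ 38 := con 0 ▸ 39 := var 33)
                              else (37 := con 0 ▸ 38 := var 30 ▸ 39 := var 30)
          o≡ : o ≡ (a * t + suc i) * p
          o≡ = trans (cong₂ _+_ g30 (trans (var≡ F 29 refl) at-29)) (ring (a * t) i p)
          w≡ : w ≡ suc i * q
          w≡ = trans (cong₂ _+_ g33 (trans (var≡ F 14 refl) at-14)) (+-comm (i * q) q)
          m≡ : m ≡ flag a
          m≡ = trans (var≡ F 34 refl) at-34
          last : ∀ f → Frame split g₂ f → Chosen f → Run copies f cnt (λ g′ → Inv (suc i) (bump 35 g′))
          last f F′ (f37 , f38 , f39) = run-mono ≤-refl finish (run-frame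
            (copies-run f cnt (trans (var≡ F′ 27 refl) (trans (var≡ F 27 refl) at-27))
              (≤-trans cnt≤ (≤-trans (Grown-length grow′) (≤-reflexive (sym (var≡ F′ 21 refl)))))))
            where
            rows-f : ∀ j → row f j ≡ row g j
            rows-f j = entry-≡ (cong-app (cell≡ F′ 0 refl) j) (cong-app (cell≡ F′ 1 refl) j)
                               (cong-app (cell≡ F′ 2 refl) j) (cong-app (cell≡ F′ 3 refl) j)
            g→f : Grown g f []
            g→f = Grown-refl {g} (var≡ F′ 21 refl) rows-f
            shape : ∀ e → increase (vars f 30) (vars f 37) (vars f 38) (vars f 39) e
                          ≡ extend p q b c a i e
            shape e rewrite f37 | f38 | f39 | var≡ F′ 30 refl =
              trans (increase-choose m {o} {vars g 35 + 1} {0} {0} {o} {w} {o} e) eq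
              where
              eq : choose m (increase o (vars g 35 + 1) 0 w) (increase o 0 o o) e ≡ extend p q b c a i e
              eq rewrite at-35 | +-comm i 1 | m≡ | o≡ | w≡ = refl
            base-rows : applyUpTo (row f) cnt ≡ es
            base-rows = applyUpTo-cong cnt
              (λ j j< → trans (rows-f j) (Grown.rows≡ grow′ j (≤-trans j< cnt≤)))
            new : List Entry
            new = map (increase (vars f 30) (vars f 37) (vars f 38) (vars f 39)) (applyUpTo (row f) cnt)
            finish : ∀ {g′} → Frame copies f g′ × Grown f g′ new → Inv (suc i) (bump 35 g′)
            finish {g′} (F″ , G′) =
                subst (λ xs → Grown h (bump 35 g′) (byHeight p q b c es a i ++ xs))
                  (trans (map-cong shape (applyUpTo (row f) cnt))
                         (cong (map (extend p q b c a i)) base-rows))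
                  (Grown-trans grow′ (Grown-trans g→f (grown (Grown.table≡ G′) (Grown.rows≡ G′))))
              , trans (var≡ F″ 30 refl) (trans (var≡ F′ 30 refl) o≡)
              , trans (var≡ F″ 33 refl) (trans (var≡ F′ 33 refl) w≡)

      colours-run : ∀ h cnt → 0 < t → vars h 1 ≡ k → vars h 2 ≡ t → vars h 9 ≡ c → vars h 14 ≡ q →
        vars h 27 ≡ cnt → vars h 28 ≡ b → vars h 29 ≡ p → cnt ≤ vars h 21 → vars h 30 ≡ 0 →
        Run coloursLoop h (k * suc ((t ∸ 1) * suc cnt))
          (λ g → Grown h g (byColour p q b c (applyUpTo (row h) cnt) k))
      colours-run h cnt 0<t at-1 at-2 at-9 at-14 at-27 at-28 at-29 cnt≤ at-30 =
        run-mono ≤-refl proj₁ (run-for-const ((t ∸ 1) * suc cnt) Inv refl at-1 start body)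
        where
        es : List Entry
        es = applyUpTo (row h) cnt
        Inv : ℕ → Store → Set
        Inv a g = Grown h g (byColour p q b c es a) × vars g 30 ≡ (a * t + 0) * p
        start : Inv 0 (setVar 31 0 (setVar 32 k h))
        start = Grown-refl {h} refl (λ i → refl) , at-30
        body : ∀ a g → a < k → vars g 31 ≡ a → Frame coloursLoop h g → Inv a g →
               Run colourBody g ((t ∸ 1) * suc cnt) (λ g′ → Inv (suc a) (bump 31 g′))
        body a g a< at-31 F (grow′ , g30) = after (after
          (run-mono (≤-reflexive (+-identityʳ _)) (λ z → z) (run-seq
            (heights-run g₂ a cnt (trans (var≡ F 2 refl) at-2) (trans (var≡ F 14 refl) at-14)
              (trans (var≡ F 27 refl) at-27) (trans (var≡ F 29 refl) at-29) flag≡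
              (≤-trans cnt≤ (Grown-length grow′)) g30 refl)
            (λ f F′ (G′ , f30) → run z≤n
              ( subst (λ xs → Grown h (bump 31 (setVar 30 (vars f 30 + vars f 29) f))
                                    (byColour p q b c es a ++ byHeight p q b c xs a (t ∸ 1)))
                  base-rows (Grown-trans grow′ (grown (Grown.table≡ G′) (Grown.rows≡ G′)))
              , trans (cong₂ _+_ f30 (trans (var≡ F′ 29 refl) (trans (var≡ F 29 refl) at-29)))
                      (next t 0<t a p))))))
          where
          g₂ : Store
          g₂ = setVar 34 (vars g 28 ∸ ((vars g 31 ∸ vars g 9) + (vars g 9 ∸ vars g 31))) (setVar 33 0 g)
          flag≡ : vars g₂ 34 ≡ flag a
          flag≡ rewrite at-31 | var≡ F 28 refl | var≡ F 9 refl | at-28 | at-9 = refl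
          base-rows : applyUpTo (row g) cnt ≡ es
          base-rows = applyUpTo-cong cnt (λ j j< → Grown.rows≡ grow′ j (≤-trans j< cnt≤))
          next : ∀ t → 0 < t → ∀ a p → (a * t + (t ∸ 1)) * p + p ≡ (suc a * t + 0) * p
          next (suc t) _ = ring t
            where
            ring : ∀ t a p → (a * suc t + t) * p + p ≡ (suc t + a * suc t + 0) * p
            ring = solve-∀

    record Ready (s : Stack k) (x : Fin n) (h : Store) : Set where
      field
        at-0   : vars h 0 ≡ n
        at-1   : vars h 1 ≡ k
        at-2   : vars h 2 ≡ t
        at-9   : vars h 9 ≡ toℕ (colour s)
        at-10  : vars h 10 ≡ height s
        at-11  : vars h 11 ≡ length S + length S + toℕ x * n
        at-12  : vars h 12 ≡ toℕ x
        at-14  : vars h 14 ≡ base ^ toℕ x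
        powers : ∀ v → cells h 6 (toℕ v) ≡ base ^ toℕ {n} v
        roles  : ∀ v → cells h 7 (toℕ v) ≡ roleCode (role v)

    ready-frame : ∀ {p h g s x} → Frame p h g →
      assigns 0 p ≡ false → assigns 1 p ≡ false → assigns 2 p ≡ false → assigns 9 p ≡ false →
      assigns 10 p ≡ false → assigns 11 p ≡ false → assigns 12 p ≡ false → assigns 14 p ≡ false →
      updates 6 p ≡ false → updates 7 p ≡ false → Ready s x h → Ready s x g
    ready-frame F e₀ e₁ e₂ e₉ e₁₀ e₁₁ e₁₂ e₁₄ e₆ e₇ R = record
      { at-0   = trans (var≡ F 0 e₀) at-0
      ; at-1   = trans (var≡ F 1 e₁) at-1
      ; at-2   = trans (var≡ F 2 e₂) at-2
      ; at-9   = trans (var≡ F 9 e₉) at-9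
      ; at-10  = trans (var≡ F 10 e₁₀) at-10
      ; at-11  = trans (var≡ F 11 e₁₁) at-11
      ; at-12  = trans (var≡ F 12 e₁₂) at-12
      ; at-14  = trans (var≡ F 14 e₁₄) at-14
      ; powers = λ v → trans (cong-app (cell≡ F 6 e₆) (toℕ v)) (powers v)
      ; roles  = λ v → trans (cong-app (cell≡ F 7 e₇) (toℕ v)) (roles v) }
      where open Ready R

    module _ (0<t : 0 < t) (s : Stack k) (x : Fin n) where
      open Ready

      -- The iterations of the colour and height loops themselves, which occur even when no row is
      -- copied.
      overhead : ℕ
      overhead = k + k * (t ∸ 1)

      extendRows-run : ∀ h v m → Ready s x h → vars h 26 ≡ toℕ v → vars h 25 ≡ m → m ≤ vars h 21 →
        Run extendRows h (overhead + length (growth s x v (applyUpTo (row h) m)))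
          (λ g → Grown h g (growth s x v (applyUpTo (row h) m)))
      extendRows-run h v m R at-26 at-25 m≤ = run-seq {t₁ = 0} {Q = Chosen}
          (run-if chosen-off chosen-at) last
        where
        es : List Entry
        es = applyUpTo (row h) m
        Chosen : Store → Set
        Chosen f = ∃[ cnt ] vars f 27 ≡ cnt × cnt ≤ m × applyUpTo (row h) cnt ≡ seed s x v es
        distance≡ : (vars h 26 ∸ vars h 12) + (vars h 12 ∸ vars h 26) ≡ (toℕ v ∸ toℕ x) + (toℕ x ∸ toℕ v)
        distance≡ = cong₂ (λ a b → (a ∸ b) + (b ∸ a)) at-26 (at-12 R)
        chosen-off : (vars h 26 ∸ vars h 12) + (vars h 12 ∸ vars h 26) ≢ 0 → Run (27 := var 25) h 0 Chosen
        chosen-off ne = run z≤n (m , at-25 , ≤-refl , sym (seed-off v≢x))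
          where
          v≢x : v ≢ x
          v≢x refl = ne (trans distance≡ (cong (λ z → z + z) (n∸n≡0 (toℕ v))))
          seed-off : v ≢ x → seed s x v es ≡ es
          seed-off v≢x rewrite dec-false (v ≟ᶠ x) v≢x = refl
        chosen-at : (vars h 26 ∸ vars h 12) + (vars h 12 ∸ vars h 26) ≡ 0 → Run (27 := con 0) h 0 Chosen
        chosen-at eq = run z≤n (0 , refl , z≤n , sym
            (seed-at (toℕ-injective (distance-0 (toℕ v) (toℕ x) (trans (sym distance≡) eq)))))
          where
          seed-at : v ≡ x → seed s x v es ≡ []
          seed-at v≡x rewrite dec-true (v ≟ᶠ x) v≡x = refl
        split : Command
        split = ifnz (var 26 ⊟ var 12) ⊞ (var 12 ⊟ var 26) then (27 := var 25) else (27 := con 0)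
        last : ∀ f → Frame split h f → Chosen f →
               Run (28 := input (var 11 ⊞ var 26) ▸ 29 := cell 6 (var 26) ▸ 30 := con 0 ▸ coloursLoop) f
                   (overhead + length (growth s x v es)) (λ g → Grown h g (growth s x v es))
        last f F (cnt , f27 , cnt≤ , rows) = after (after (after (run-mono steps-bound finish
            (colours-run (base ^ toℕ v) (base ^ toℕ x) (bit (adjacent x v)) (toℕ (colour s)) f₃ cnt 0<t
              (trans (var≡ F 1 refl) (at-1 R)) (trans (var≡ F 2 refl) (at-2 R))
              (trans (var≡ F 9 refl) (at-9 R)) (trans (var≡ F 14 refl) (at-14 R)) f27
              (trans (cong₂ (λ a b → inp (a + b)) (trans (var≡ F 11 refl) (at-11 R))
                                                  (trans (var≡ F 26 refl) at-26)) (inp-adjacent x v))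
              (trans (cong₂ (λ (A : ℕ → ℕ) b → A b) (cell≡ F 6 refl) (trans (var≡ F 26 refl) at-26)) (powers R v))
              (≤-trans cnt≤ (≤-trans m≤ (≤-reflexive (sym (var≡ F 21 refl))))) refl))))
          where
          f₃ : Store
          f₃ = setVar 30 0 (setVar 29 (cells f 6 (vars f 26))
                 (setVar 28 (inp (vars f 11 + vars f 26)) f))
          rows-f : ∀ j → row f j ≡ row h j
          rows-f j = entry-≡ (cong-app (cell≡ F 0 refl) j) (cong-app (cell≡ F 1 refl) j)
                             (cong-app (cell≡ F 2 refl) j) (cong-app (cell≡ F 3 refl) j)
          rows′ : applyUpTo (row f) cnt ≡ seed s x v es
          rows′ = trans (applyUpTo-cong cnt (λ j _ → rows-f j)) rows
          finish : ∀ {g} → Grown f₃ g (byColour (base ^ toℕ v) (base ^ toℕ x) (bit (adjacent x v))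
                     (toℕ (colour s)) (applyUpTo (row f) cnt) k) → Grown h g (growth s x v es)
          finish {g} G′ = Grown-trans (Grown-refl {h} {f₃} (var≡ F 21 refl) rows-f)
            (subst (λ xs → Grown f₃ g (byColour (base ^ toℕ v) (base ^ toℕ x) (bit (adjacent x v))
                                          (toℕ (colour s)) xs k)) rows′ G′)
          steps-bound : k * suc ((t ∸ 1) * suc cnt) ≤ overhead + length (growth s x v es)
          steps-bound = ≤-reflexive (trans (ring k (t ∸ 1) cnt) (cong (overhead +_) (sym (trans
            (length-byColour _ _ _ _ (seed s x v es) k)
            (cong (λ z → k * ((t ∸ 1) * z)) (trans (cong length (sym rows)) (length-applyUpTo (row h) cnt)))))))
            where
            ring : ∀ k w c → k * suc (w * suc c) ≡ k + k * w + k * (w * c)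
            ring = solve-∀

      run-then : ∀ {e p q h T Q} → val e h ≢ 0 → Run p h T Q → Run (ifnz e then p else q) h T Q
      run-then ne r = run-if (λ _ → r) (λ eq → contradiction eq ne)

      run-else : ∀ {e p q h T Q} → val e h ≡ 0 → Run q h T Q → Run (ifnz e then p else q) h T Q
      run-else eq r = run-if (λ ne → contradiction eq ne) (λ _ → r)

      -- An amortised bound: each iteration of the copying loop creates a row and is charged to the
      -- growth of the list. The factor 2 allows for the second call of `extendRows` for a partner.
      roleBody-run : ∀ h u → Ready s x h → vars h 22 ≡ toℕ u →
        ∃[ T ] T + length (table h) ≤ 2 * overhead + length (grow s x (role u) u (table h))
             × Run roleBody h T (λ g → table g ≡ grow s x (role u) u (table h))
      roleBody-run h u R at-22 = go (role u) refl
        where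
        es : List Entry
        es = table h
        m : ℕ
        m = vars h 21
        h₂ : Store
        h₂ = setVar 25 m (setVar 24 (cells h 7 (vars h 22)) h)
        at-24 : ∀ {r} → role u ≡ r → cells h 7 (vars h 22) ≡ roleCode r
        at-24 r = trans (cong (cells h 7) at-22) (trans (roles R u) (cong roleCode r))
        R₃ : Ready s x (setVar 26 (vars h 22) h₂)
        R₃ = ready-frame
          (exec-frame (24 := cell 7 (var 22) ▸ 25 := var 21 ▸ 26 := var 22) h)
          refl refl refl refl refl refl refl refl refl refl R
        steps≡ : ∀ o a b → o + a + b ≤ 2 * o + (b + a)
        steps≡ o a b = ≤-trans (m≤n+m _ o) (≤-reflexive (ring o a b))
          where
          ring : ∀ o a b → o + (o + a + b) ≡ 2 * o + (b + a)
          ring = solve-∀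
        steps≡′ : ∀ o a b c → o + a + (o + c) + b ≡ 2 * o + (b + a + c)
        steps≡′ = solve-∀
        go : ∀ r → role u ≡ r →
          ∃[ T ] T + length es ≤ 2 * overhead + length (grow s x r u es)
               × Run roleBody h T (λ g → table g ≡ grow s x r u es)
        go single r = overhead + length (growth s x u es) ,
          ≤-trans (steps≡ overhead (length (growth s x u es)) (length es))
                  (≤-reflexive (cong (2 * overhead +_) (sym (length-++ es)))) ,
          after (after (run-else (at-24 r) (after (run-mono ≤-refl (λ G′ → Grown.table≡ G′)
            (extendRows-run (setVar 26 (vars h 22) h₂) u m R₃ at-22 refl ≤-refl)))))
        go skip r = 0 , m≤n+m (length es) (2 * overhead) ,
          after (after (run-then (λ z → 0≢1+n (trans (sym z) (at-24 r)))
            (run-else (cong (_∸ 1) (at-24 r)) (run z≤n refl))))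
        go (first w) r = overhead + length (growth s x u es) + (overhead + length (growth s x w es)) ,
          ≤-reflexive (trans (steps≡′ overhead (length (growth s x u es)) (length es) (length (growth s x w es)))
            (cong (2 * overhead +_) (sym (trans (length-++ (es ++ growth s x u es))
              (cong (_+ length (growth s x w es)) (length-++ es)))))) ,
          after (after (run-then (λ z → 0≢1+n (trans (sym z) (at-24 r)))
            (run-then (λ z → 0≢1+n (trans (sym z) (cong (_∸ 1) (at-24 r))))
              (after (run-seq (extendRows-run (setVar 26 (vars h 22) h₂) u m R₃ at-22 refl ≤-refl) second)))))
          where
          second : ∀ f → Frame extendRows (setVar 26 (vars h 22) h₂) f →
            Grown (setVar 26 (vars h 22) h₂) f (growth s x u es) →
            Run (26 := var 24 ⊟ con 2 ▸ extendRows) f (overhead + length (growth s x w es))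
                (λ g → table g ≡ (es ++ growth s x u es) ++ growth s x w es)
          second f F G′ = after (run-mono
              (≤-reflexive (cong (λ xs → overhead + length (growth s x w xs)) rows)) finish
              (extendRows-run f₁ w m R₄
                (cong (_∸ 2) (trans (var≡ F 24 refl) (at-24 r))) (var≡ F 25 refl) (Grown-length G′)))
            where
            f₁ : Store
            f₁ = setVar 26 (vars f 24 ∸ 2) f
            R₄ : Ready s x f₁
            R₄ = ready-frame (exec-frame (26 := var 24 ⊟ con 2) f)
                   refl refl refl refl refl refl refl refl refl refl
                   (ready-frame F refl refl refl refl refl refl refl refl refl refl R₃)
            rows : applyUpTo (row f₁) m ≡ es
            rows = applyUpTo-cong m (Grown.rows≡ G′)
            finish : ∀ {g} → Grown f₁ g (growth s x w (applyUpTo (row f₁) m)) →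
                     table g ≡ (es ++ growth s x u es) ++ growth s x w es
            finish {g} G″ = trans (Grown.table≡ G″)
              (cong₂ _++_ (Grown.table≡ G′) (cong (growth s x w) rows))

      -- The bound in `run-for` is a function on all numbers, hence this total version of `stage`,
      -- with a dummy value beyond `n`.
      stageAt : ℕ → List Entry
      stageAt j with j ≤? n
      ... | yes j≤ = stage s x j j≤
      ... | no _   = []

      stageAt≡ : ∀ j (j≤ : j ≤ n) → stageAt j ≡ stage s x j j≤
      stageAt≡ j j≤ with j ≤? n
      ... | yes p = cong (stage s x j) (≤-irrelevant p j≤)
      ... | no ¬p = contradiction j≤ ¬p

      rowsLoop-run : ∀ h → Ready s x h → table h ≡ [ summary s x allEmpty ] →
        Run rowsLoop h (n * suc (2 * overhead) + length (entries s x)) (λ g → table g ≡ entries s x)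
      rowsLoop-run h R init = run-mono
          (+-monoʳ-≤ _ (≤-reflexive (cong length (stageAt≡ n ≤-refl)))) (λ (I , _) → I ≤-refl)
          (run-for B Inv refl (at-0 R) (λ _ → init) body)
        where
        -- The length of the list acts as the potential of the amortised bound.
        B : ℕ → ℕ
        B j = j * suc (2 * overhead) + length (stageAt j)
        Inv : ℕ → Store → Set
        Inv j g = (j≤ : j ≤ n) → table g ≡ stage s x j j≤
        body : ∀ j g → j < n → vars g 22 ≡ j → vars g 23 ≡ n → Frame rowsLoop h g → Inv j g →
          ∃[ T ] suc (T + B j) ≤ B (suc j) × Run roleBody g T (λ g′ → Inv (suc j) (bump 22 g′))
        body j g j< at-22 _ F inv
          with roleBody-run g (fromℕ< j<) (ready-frame F refl refl refl refl refl refl refl refl refl refl R)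
                            (trans at-22 (sym (toℕ-fromℕ< j<)))
        ... | T , T≤ , r = T , bound , run-mono ≤-refl
              (λ eq j<′ → trans eq (cong (grow s x (role (fromℕ< j<)) (fromℕ< j<)) (inv (<⇒≤ j<′)))) r
          where
          now : table g ≡ stage s x j (<⇒≤ j<)
          now = inv (<⇒≤ j<)
          bound : suc (T + B j) ≤ B (suc j)
          bound = begin
            suc (T + (j * suc (2 * overhead) + length (stageAt j)))
              ≡⟨ ring₁ T (j * suc (2 * overhead)) (length (stageAt j)) ⟩
            suc (j * suc (2 * overhead)) + (T + length (stageAt j))
              ≡⟨ cong (λ xs → suc (j * suc (2 * overhead)) + (T + length xs))
                      (trans (stageAt≡ j (<⇒≤ j<)) (sym now)) ⟩
            suc (j * suc (2 * overhead)) + (T + length (table g))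
              ≤⟨ +-monoʳ-≤ (suc (j * suc (2 * overhead))) T≤ ⟩
            suc (j * suc (2 * overhead))
              + (2 * overhead + length (grow s x (role (fromℕ< j<)) (fromℕ< j<) (table g)))
              ≡⟨ ring₂ (j * suc (2 * overhead)) (2 * overhead) _ ⟩
            suc j * suc (2 * overhead) + length (grow s x (role (fromℕ< j<)) (fromℕ< j<) (table g))
              ≡⟨ cong (λ xs → suc j * suc (2 * overhead) + length xs)
                   (trans (cong (grow s x (role (fromℕ< j<)) (fromℕ< j<)) now) (sym (stageAt≡ (suc j) j<))) ⟩
            B (suc j) ∎
            where
            open ≤-Reasoning
            ring₁ : ∀ a b c → suc (a + (b + c)) ≡ suc b + (a + c)
            ring₁ = solve-∀
            ring₂ : ∀ b a c → suc b + (a + c) ≡ suc a + b + c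
            ring₂ = solve-∀

      +≢0⁻ : ∀ a {b} → a + b ≢ 0 → a ≢ 0 ⊎ b ≢ 0
      +≢0⁻ zero    ne = inj₂ ne
      +≢0⁻ (suc a) ne = inj₁ λ ()

      record Tallied (h g : Store) (es : List Entry) : Set where
        field
          found  : ∀ {y} → cells g 5 y ≢ 0 → cells h 5 y ≢ 0 ⊎
                   (∃[ e ] e ∈ es × Entry.source e ≡ y × cells h 4 (target e) ≢ 0)
          kept   : ∀ {y} → cells h 5 y ≢ 0 → cells g 5 y ≢ 0
          counted : ∀ {e} → e ∈ es → cells h 4 (target e) ≢ 0 → cells g 5 (Entry.source e) ≢ 0

      tally-run : ∀ h → vars h 2 ≡ t → Run tally h (vars h 21) (λ g → Tallied h g (table h))
      tally-run h at-2 = run-mono (≤-reflexive (*-identityʳ m)) finish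
          (run-for-const 0 Inv refl refl start body)
        where
        m : ℕ
        m = vars h 21
        W : ℕ → ℕ
        W = cells h 4
        source : ℕ → ℕ
        source i = Entry.source (row h i)
        Inv : ℕ → Store → Set
        Inv j g = (∀ y → cells g 5 y ≢ 0 → cells h 5 y ≢ 0 ⊎ (∃[ i ] i < j × source i ≡ y × W (target (row h i)) ≢ 0))
                × (∀ y → cells h 5 y ≢ 0 → cells g 5 y ≢ 0)
                × (∀ i → i < j → W (target (row h i)) ≢ 0 → cells g 5 (source i) ≢ 0)
        start : Inv 0 (setVar 42 0 (setVar 43 m h))
        start = (λ y → inj₁) , (λ y ne → ne) , (λ i ())
        finish : ∀ {g} → Inv m g → Tallied h g (table h)
        finish {g} (to , keep , from) = record
          { found = λ {y} ne → found′ (to y ne)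
          ; kept = λ {y} → keep y
          ; counted = λ e∈ ne → counted′ (∈-applyUpTo⁻ (row h) e∈) ne }
          where
          found′ : ∀ {y} → cells h 5 y ≢ 0 ⊎ (∃[ i ] i < m × source i ≡ y × W (target (row h i)) ≢ 0) →
                   cells h 5 y ≢ 0 ⊎ (∃[ e ] e ∈ table h × Entry.source e ≡ y × W (target e) ≢ 0)
          found′ (inj₁ ne) = inj₁ ne
          found′ (inj₂ (i , i< , eq , ne)) = inj₂ (row h i , ∈-applyUpTo⁺ (row h) i< , eq , ne)
          counted′ : ∀ {e} → ∃[ i ] i < m × e ≡ row h i → W (target e) ≢ 0 → cells g 5 (Entry.source e) ≢ 0
          counted′ (i , i< , refl) ne = from i i< ne
        body : ∀ j g → j < m → vars g 42 ≡ j → Frame tally h g → Inv j g →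
               Run tallyBody g 0 (λ g′ → Inv (suc j) (bump 42 g′))
        body j g j< at-42 F (to , keep , from) = run-seq {t₁ = 0} {t₂ = 0} {Q = λ f → vars f 44 ≡ target (row h j)}
            (run-if (λ ne → run z≤n (sym (trans target≡ (choose-pos ne))))
                    (λ eq → run z≤n (sym (trans target≡ (choose-zero eq)))))
            last
          where
          target≡ : target (row h j)
            ≡ choose (vars g 2 ∸ cells g 1 (vars g 42)) (cells g 3 (vars g 42)) (cells g 2 (vars g 42))
          target≡ rewrite at-42 | var≡ F 2 refl | at-2 | cell≡ F 1 refl | cell≡ F 2 refl | cell≡ F 3 refl = refl
          split : Command
          split = ifnz var 2 ⊟ cell 1 (var 42) then (44 := cell 3 (var 42)) else (44 := cell 2 (var 42))
          last : ∀ f → Frame split g f → vars f 44 ≡ target (row h j) →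
            Run (5 [ cell 0 (var 42) ]:= cell 5 (cell 0 (var 42)) ⊞ cell 4 (var 44)) f 0
                (λ g′ → Inv (suc j) (bump 42 g′))
          last f F′ f44 = run z≤n (to′ , keep′ , from′)
            where
            a : ℕ
            a = cells f 0 (vars f 42)
            a≡ : a ≡ source j
            a≡ rewrite var≡ F′ 42 refl | cell≡ F′ 0 refl | at-42 | cell≡ F 0 refl = refl
            W≡ : cells f 4 (vars f 44) ≡ W (target (row h j))
            W≡ rewrite f44 | cell≡ F′ 4 refl | cell≡ F 4 refl = refl
            new : ℕ → ℕ
            new = cells f 5 [ a ↦ cells f 5 a + cells f 4 (vars f 44) ]
            new-at : new (source j) ≡ cells g 5 (source j) + W (target (row h j))
            new-at = trans (cong new (sym a≡)) (trans (upd-same (cells f 5) a _)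
              (cong₂ _+_ (trans (cong-app (cell≡ F′ 5 refl) a) (cong (cells g 5) a≡)) W≡))
            new-off : ∀ {y} → y ≢ source j → new y ≡ cells g 5 y
            new-off ne = trans (upd-other (cells f 5) _ (λ z → ne (trans (sym z) a≡))) (cong-app (cell≡ F′ 5 refl) _)
            to′ : ∀ y → new y ≢ 0 → cells h 5 y ≢ 0 ⊎ (∃[ i ] i < suc j × source i ≡ y × W (target (row h i)) ≢ 0)
            to′ y ne with y ≟ source j
            ... | no off = later (to y (subst (_≢ 0) (new-off off) ne))
              where
              later : cells h 5 y ≢ 0 ⊎ (∃[ i ] i < j × source i ≡ y × W (target (row h i)) ≢ 0) → _
              later (inj₁ z) = inj₁ z
              later (inj₂ (i , i< , rest)) = inj₂ (i , m<n⇒m<1+n i< , rest)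
            ... | yes refl with +≢0⁻ (cells g 5 (source j)) (subst (_≢ 0) new-at ne)
            ...   | inj₂ z = inj₂ (j , ≤-refl , refl , z)
            ...   | inj₁ z with to (source j) z
            ...     | inj₁ z′ = inj₁ z′
            ...     | inj₂ (i , i< , rest) = inj₂ (i , m<n⇒m<1+n i< , rest)
            grows : ∀ {y} → cells g 5 y ≢ 0 → new y ≢ 0
            grows {y} ne eq with y ≟ source j
            ... | no off  = ne (trans (sym (new-off off)) eq)
            ... | yes refl = ne (m+n≡0⇒m≡0 _ (trans (sym new-at) eq))
            keep′ : ∀ y → cells h 5 y ≢ 0 → new y ≢ 0
            keep′ y ne = grows (keep y ne)
            from′ : ∀ i → i < suc j → W (target (row h i)) ≢ 0 → new (source i) ≢ 0
            from′ i i< ne with m≤n⇒m<n∨m≡n (s≤s⁻¹ i<)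
            ... | inj₁ i<j  = grows (from i i<j ne)
            ... | inj₂ refl = λ eq → ne (m+n≡0⇒n≡0 (cells g 5 (source j)) (trans (sym new-at) eq))

    record Context (h : Store) : Set where
      field
        at-0   : vars h 0 ≡ n
        at-1   : vars h 1 ≡ k
        at-2   : vars h 2 ≡ t
        powers : ∀ v → cells h 6 (toℕ v) ≡ base ^ toℕ {n} v
        roles  : ∀ v → cells h 7 (toℕ v) ≡ roleCode (role v)

    context-frame : ∀ {p h g} → Frame p h g →
      assigns 0 p ≡ false → assigns 1 p ≡ false → assigns 2 p ≡ false →
      updates 6 p ≡ false → updates 7 p ≡ false → Context h → Context g
    context-frame F e₀ e₁ e₂ e₆ e₇ C = record
      { at-0   = trans (var≡ F 0 e₀) at-0
      ; at-1   = trans (var≡ F 1 e₁) at-1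
      ; at-2   = trans (var≡ F 2 e₂) at-2
      ; powers = λ v → trans (cong-app (cell≡ F 6 e₆) (toℕ v)) (powers v)
      ; roles  = λ v → trans (cong-app (cell≡ F 7 e₇) (toℕ v)) (roles v) }
      where open Context C

    tallied-cong : ∀ {f h g g′ es} → cells f 4 ≡ cells h 4 → cells f 5 ≡ cells h 5 → cells g 5 ≡ cells g′ 5 →
      ∀ {0<t s x} → Tallied 0<t s x f g es → Tallied 0<t s x h g′ es
    tallied-cong {g′ = g′} {es} e₁ e₂ e₃ T = record
      { found   = λ {y} ne → subst₂ (λ (A B : ℕ → ℕ) → A y ≢ 0 ⊎
                    (∃[ e ] e ∈ es × Entry.source e ≡ y × B (target e) ≢ 0)) e₂ e₁
                    (Tallied.found T (subst (λ (A : ℕ → ℕ) → A y ≢ 0) (sym e₃) ne))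
      ; kept    = λ {y} ne → subst (λ (A : ℕ → ℕ) → A y ≢ 0) e₃
                    (Tallied.kept T (subst (λ (A : ℕ → ℕ) → A y ≢ 0) (sym e₂) ne))
      ; counted = λ {e} e∈ ne → subst (λ (A : ℕ → ℕ) → A (Entry.source e) ≢ 0) e₃
                    (Tallied.counted T e∈ (subst (λ (A : ℕ → ℕ) → A (target e) ≢ 0) (sym e₁) ne)) }

    code-empty : code allEmpty ≡ 0
    code-empty = ∑-zero {n} _ (λ _ → refl)

    summary-empty : ∀ s x → summary s x allEmpty
      ≡ entry 0 (height s) 0 ((height s + toℕ (colour s) * t) * base ^ toℕ x)
    summary-empty s x = entry-≡ code-empty total van
      (trans (cong₂ (λ a b → a + base ^ toℕ x * (toℕ (colour s) * t + b)) van total)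
             (trans (*-comm (base ^ toℕ x) _) (cong (_* base ^ toℕ x) (+-comm (toℕ (colour s) * t) (height s)))))
      where
      total : height s + ∑ (gain allEmpty (colour s) x) ≡ height s
      total = trans (cong (height s +_) (∑-zero _ (λ u → cong (λ b → if b then 0 else 0)
                (merges-nothing {δ = allEmpty} {u} (colour s) x refl)))) (+-identityʳ _)
      van : ∑ (residue allEmpty (colour s) x) ≡ 0
      van = ∑-zero _ (λ u → cong (λ b → if b then 0 else 0)
              (merges-nothing {δ = allEmpty} {u} (colour s) x refl))

    powers-run : ∀ h → vars h 0 ≡ n → vars h 1 ≡ k → vars h 2 ≡ t →
      Run tabulatePowers h (n * suc (k * suc (t * 1))) (λ g → ∀ i → i ≤ n → cells g 6 i ≡ base ^ i)
    powers-run h at-0 at-1 at-2 = after-cell (run-mono ≤-refl (λ z → z)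
        (run-for-const (k * suc (t * 1)) Inv refl at-0 start body))
      where
      Inv : ℕ → Store → Set
      Inv j g = ∀ i → i ≤ j → cells g 6 i ≡ base ^ i
      start : ∀ i → i ≤ 0 → (cells h 6 [ 0 ↦ 1 ]) i ≡ base ^ i
      start zero z≤n = refl
      inner rowᶜ bodyᶜ : Command
      inner = for 56 / 57 below var 2 loop (52 := var 52 ⊞ var 53)
      rowᶜ = for 54 / 55 below var 1 loop inner
      bodyᶜ = 52 := con 0 ▸ 53 := cell 6 (var 50) ▸ rowᶜ ▸ 6 [ var 50 ⊞ con 1 ]:= var 52
      body : ∀ j g → j < n → vars g 50 ≡ j → Frame (for 50 / 51 below var 0 loop bodyᶜ) _ g → Inv j g →
             Run bodyᶜ g (k * suc (t * 1)) (λ g′ → Inv (suc j) (bump 50 g′))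
      body j g j< at-50 F inv = after (after (run-mono (≤-reflexive (+-identityʳ _)) (λ z → z)
          (run-seq {t₂ = 0} (run-for-const (t * 1) (λ i f → vars f 52 ≡ i * (t * base ^ j)) refl
                     (trans (var≡ F 1 refl) at-1) refl row-body)
            (λ f F′ f52 → run z≤n (λ i i≤ → at f F′ f52 i i≤)))))
        where
        g₂ : Store
        g₂ = setVar 53 (cells g 6 (vars g 50)) (setVar 52 0 g)
        p≡ : cells g 6 (vars g 50) ≡ base ^ j
        p≡ = trans (cong (cells g 6) at-50) (inv j ≤-refl)
        row-body : ∀ i f → i < k → vars f 54 ≡ i → Frame rowᶜ g₂ f → vars f 52 ≡ i * (t * base ^ j) →
          Run inner f (t * 1) (λ f′ → vars f′ 52 ≡ suc i * (t * base ^ j))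
        row-body i f i< _ F′ f52 = run-mono ≤-refl (λ eq → trans eq (+-comm (i * (t * base ^ j)) _))
          (run-for-const 0 (λ l e → vars e 52 ≡ i * (t * base ^ j) + l * base ^ j) refl
            (trans (var≡ F′ 2 refl) (trans (var≡ F 2 refl) at-2)) (trans f52 (sym (+-identityʳ _)))
            (λ l e l< _ F″ eq → run z≤n (trans (cong₂ _+_ eq (trans (var≡ F″ 53 refl) (trans (var≡ F′ 53 refl) p≡)))
              (ring (i * (t * base ^ j)) (l * base ^ j) (base ^ j)))))
          where
          ring : ∀ a b c → a + b + c ≡ a + (c + b)
          ring = solve-∀
        at : ∀ f → Frame rowᶜ g₂ f → vars f 52 ≡ k * (t * base ^ j) → ∀ i → i ≤ suc j →
             (cells f 6 [ vars f 50 + 1 ↦ vars f 52 ]) i ≡ base ^ i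
        at f F′ f52 i i≤ with m≤n⇒m<n∨m≡n i≤
        ... | inj₁ i<  = trans (upd-other (cells f 6) _ (λ eq → <-irrefl (trans (sym eq) at-50′) i<))
                           (trans (cong-app (cell≡ F′ 6 refl) i) (inv i (s≤s⁻¹ i<)))
          where
          at-50′ : vars f 50 + 1 ≡ suc j
          at-50′ = trans (cong (_+ 1) (trans (var≡ F′ 50 refl) at-50)) (+-comm j 1)
        ... | inj₂ refl = trans (cong (cells f 6 [ vars f 50 + 1 ↦ vars f 52 ]) (sym at-50′))
                           (trans (upd-same (cells f 6) (vars f 50 + 1) _) (trans f52 (sym (*-assoc k t (base ^ j)))))
          where
          at-50′ : vars f 50 + 1 ≡ suc j
          at-50′ = trans (cong (_+ 1) (trans (var≡ F′ 50 refl) at-50)) (+-comm j 1)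

    record Fresh (h : Store) : Set where
      field
        context : Context h
        at-3    : vars h 3 ≡ length S
        at-5    : vars h 5 ≡ base ^ n
        at-8    : vars h 8 ≡ length S + length S
        zeros   : ∀ y → cells h 5 y ≡ 0

    module _ (0<t : 0 < t) (E : ℕ) (entries≤ : ∀ s x → length (entries s x) ≤ E) where

      -- The first two summands are the repeated additions for the digit of the new stack and for
      -- its weighted digit, the third the loop overhead; then the list is built and evaluated, at
      -- most `E` iterations each.
      vertexSteps : ℕ
      vertexSteps = k + k * t + n * suc (2 * (k + k * (t ∸ 1))) + (E + E)

      vertexBody-run : ∀ s x h → height s ≤ t → Context h → vars h 9 ≡ toℕ (colour s) →
        vars h 10 ≡ height s → vars h 11 ≡ length S + length S + toℕ x * n → vars h 12 ≡ toℕ x →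
        Run vertexBody h vertexSteps (λ g →
          vars g 11 ≡ length S + length S + suc (toℕ x) * n × Tallied 0<t s x h g (entries s x))
      vertexBody-run s x h h≤t C at-9 at-10 at-11 at-12 =
        run-mono bound (λ z → z) (after (after (run-seq loop₁ part₂)))
        where
        open Context C using (at-0; at-1; at-2)
        c z q : ℕ
        c = toℕ (colour s)
        z = height s + c * t
        q = base ^ toℕ x
        step₁ step₂ loopᶜ₁ loopᶜ₂ : Command
        step₁ = 17 := var 17 ⊞ var 2
        step₂ = 20 := var 20 ⊞ var 14
        loopᶜ₁ = for 15 / 16 below var 9 loop step₁
        loopᶜ₂ = for 18 / 19 below var 17 loop step₂
        h₁ : Store
        h₁ = setVar 17 (vars h 10) (setVar 14 (cells h 6 (vars h 12)) h)
        R₁ : Ready s x h₁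
        R₁ = record { at-0 = at-0 ; at-1 = at-1 ; at-2 = at-2 ; at-9 = at-9 ; at-10 = at-10
                    ; at-11 = at-11 ; at-12 = at-12
                    ; at-14 = trans (cong (cells h 6) at-12) (Context.powers C x)
                    ; powers = Context.powers C ; roles = Context.roles C }
        loop₁ : Run loopᶜ₁ h₁ (c * 1) (λ g → vars g 17 ≡ z)
        loop₁ = run-for-const 0 (λ j g → vars g 17 ≡ height s + j * t) refl at-9
          (trans at-10 (sym (+-identityʳ _)))
          (λ j g j< at-15 F eq → run z≤n (trans (cong₂ _+_ eq (trans (var≡ F 2 refl) at-2))
            (ring (height s) (j * t) t)))
          where
          ring : ∀ a b c → a + b + c ≡ a + (c + b)
          ring = solve-∀
        part₂ : ∀ g → Frame loopᶜ₁ h₁ g → vars g 17 ≡ z →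
          Run (20 := con 0 ▸ loopᶜ₂ ▸ 0 [ con 0 ]:= con 0 ▸ 1 [ con 0 ]:= var 10 ▸ 2 [ con 0 ]:= con 0 ▸
               3 [ con 0 ]:= var 20 ▸ 21 := con 1 ▸ rowsLoop ▸ tally ▸ 11 := var 11 ⊞ var 0) g
            (z * 1 + ((n * suc (2 * (k + k * (t ∸ 1))) + length (entries s x)) + (length (entries s x) + 0)))
            (λ g → vars g 11 ≡ length S + length S + suc (toℕ x) * n × Tallied 0<t s x h g (entries s x))
        part₂ g₁ F₁ g17 = after (run-seq loop₂ part₃)
          where
          R₂ : Ready s x (setVar 20 0 g₁)
          R₂ = ready-frame (exec-frame (20 := con 0) g₁) refl refl refl refl refl refl refl refl refl refl
                 (ready-frame F₁ refl refl refl refl refl refl refl refl refl refl R₁)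
          loop₂ : Run loopᶜ₂ (setVar 20 0 g₁) (z * 1) (λ g → vars g 20 ≡ z * q)
          loop₂ = run-for-const 0 (λ j g → vars g 20 ≡ j * q) refl g17 refl
            (λ j g j< at-18 F eq → run z≤n
              (trans (cong₂ _+_ eq (trans (var≡ F 14 refl) (Ready.at-14 R₂))) (+-comm (j * q) q)))
          part₃ : ∀ g → Frame loopᶜ₂ (setVar 20 0 g₁) g → vars g 20 ≡ z * q → _
          part₃ g₂ F₂ g20 = after-cell (after-cell (after-cell (after-cell (after
              (run-seq (rowsLoop-run 0<t s x g₃ R₃ init) part₄)))))
            where
            inits : Command
            inits = 0 [ con 0 ]:= con 0 ▸ 1 [ con 0 ]:= var 10 ▸ 2 [ con 0 ]:= con 0 ▸
                    3 [ con 0 ]:= var 20 ▸ 21 := con 1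
            g₃ : Store
            g₃ = exec inits g₂
            R₃ : Ready s x g₃
            R₃ = ready-frame (exec-frame inits g₂) refl refl refl refl refl refl refl refl refl refl
                   (ready-frame F₂ refl refl refl refl refl refl refl refl refl refl R₂)
            init : table g₃ ≡ [ summary s x allEmpty ]
            init = cong [_] (trans (entry-≡ refl (Ready.at-10 R₃) refl g20) (sym (summary-empty s x)))
            part₄ : ∀ g → Frame rowsLoop g₃ g → table g ≡ entries s x → _
            part₄ g₄ F₄ tab = run-seq
                (run-mono (≤-reflexive len) (λ z → z) (tally-run 0<t s x g₄ (trans (var≡ F₄ 2 refl) (Ready.at-2 R₃))))
                (λ g₅ F₅ T → run z≤n
                  ( trans (cong₂ _+_ (trans (var≡ F₅ 11 refl) (trans (var≡ F₄ 11 refl) (Ready.at-11 R₃)))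
                                     (trans (var≡ F₅ 0 refl) (trans (var≡ F₄ 0 refl) (Ready.at-0 R₃))))
                          (ring (length S + length S) (toℕ x * n) n)
                  , tallied-cong {f = g₄} {h} {g₅}
                      (trans (cell≡ F₄ 4 refl) (trans (cell≡ F₂ 4 refl) (cell≡ F₁ 4 refl)))
                      (trans (cell≡ F₄ 5 refl) (trans (cell≡ F₂ 5 refl) (cell≡ F₁ 5 refl))) refl
                      (subst (Tallied 0<t s x g₄ g₅) tab T)))
              where
              len : vars g₄ 21 ≡ length (entries s x)
              len = trans (sym (length-applyUpTo (row g₄) (vars g₄ 21))) (cong length tab)
              ring : ∀ a b c → a + b + c ≡ a + (c + b)
              ring = solve-∀
        bound : c * 1 + (z * 1 + ((n * suc (2 * (k + k * (t ∸ 1))) + length (entries s x))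
                                  + (length (entries s x) + 0))) ≤ vertexSteps
        bound = ≤-trans (+-mono-≤ (≤-reflexive (*-identityʳ c)) (+-mono-≤ (≤-reflexive (*-identityʳ z))
                  (+-mono-≤ (+-monoʳ-≤ _ (entries≤ s x)) (≤-trans (≤-reflexive (+-identityʳ _)) (entries≤ s x)))))
                (≤-trans (+-mono-≤ (<⇒≤ (toℕ<n (colour s))) (+-monoˡ-≤ _ z≤))
                         (≤-reflexive (ring k (k * t) (n * suc (2 * (k + k * (t ∸ 1)))) E)))
          where
          ring : ∀ a b c e → a + (b + (c + e + e)) ≡ a + b + c + (e + e)
          ring = solve-∀
          -- The bound on the heights is used here: the digit of the new stack, which is the length
          -- of a loop, is at most (c + 1) t even when its height is `t`.
          z≤ : z ≤ k * t
          z≤ = ≤-trans (+-monoˡ-≤ (c * t) h≤t) (*-monoˡ-≤ t (toℕ<n (colour s)))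

      vertexLoop-run : ∀ s h → height s ≤ t → Context h → vars h 9 ≡ toℕ (colour s) →
        vars h 10 ≡ height s → vars h 11 ≡ length S + length S → (∀ y → cells h 5 y ≡ 0) →
        Run vertexLoop h (n * suc vertexSteps) (λ g → Updated s (cells h 4) (λ _ → ⊤) (cells g 5))
      vertexLoop-run s h h≤t C at-9 at-10 at-11 zeros = run-mono ≤-refl (λ {g} → finish {g})
          (run-for-const vertexSteps Inv refl (Context.at-0 C) start body)
        where
        Inv : ℕ → Store → Set
        Inv m g = vars g 11 ≡ length S + length S + m * n
                  × Updated s (cells h 4) (λ x → toℕ x < m) (cells g 5)
        start : Inv 0 (setVar 12 0 (setVar 13 n h))
        start = trans at-11 (sym (+-identityʳ _)) ,
                λ y → (λ ne → contradiction (zeros y) ne) , (λ ())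
        finish : ∀ {g} → Inv n g → Updated s (cells h 4) (λ _ → ⊤) (cells g 5)
        finish {g} (_ , upd) y with upd y
        ... | to , from = (λ ne → weaken (to ne)) , (λ {x} _ → from (toℕ<n x))
          where
          W : ℕ → ℕ
          W = cells h 4
          weaken : ∃[ x ] ∃[ e ] toℕ x < n × e ∈ entries s x × Entry.source e ≡ y × W (target e) ≢ 0 →
                   ∃[ x ] ∃[ e ] ⊤ × e ∈ entries s x × Entry.source e ≡ y × W (target e) ≢ 0
          weaken (x , e , _ , rest) = x , e , tt , rest
        body : ∀ m g → m < n → vars g 12 ≡ m → Frame vertexLoop h g → Inv m g →
               Run vertexBody g vertexSteps (λ g′ → Inv (suc m) (bump 12 g′))
        body m g m< at-12 F (g11 , upd) = run-mono ≤-refl (λ {g} → next {g})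
            (vertexBody-run s x g h≤t (context-frame F refl refl refl refl refl C)
              (trans (var≡ F 9 refl) at-9) (trans (var≡ F 10 refl) at-10)
              (trans g11 (cong (λ z → length S + length S + z * n) (sym x≡)))
              (trans at-12 (sym x≡)))
          where
          x : Fin n
          x = fromℕ< m<
          x≡ : toℕ x ≡ m
          x≡ = toℕ-fromℕ< m<
          W : ℕ → ℕ
          W = cells h 4
          W≡ : cells g 4 ≡ W
          W≡ = cell≡ F 4 refl
          next : ∀ {g′} → vars g′ 11 ≡ length S + length S + suc (toℕ x) * n × Tallied 0<t s x g g′ (entries s x) →
                 Inv (suc m) (bump 12 g′)
          next {g′} (e11 , T) = trans e11 (cong (λ z → length S + length S + suc z * n) x≡) ,
              λ y → to y , from y
            where
            to : ∀ y → cells g′ 5 y ≢ 0 →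
              ∃[ x ] ∃[ e ] toℕ x < suc m × e ∈ entries s x × Entry.source e ≡ y × W (target e) ≢ 0
            to y ne with Tallied.found T ne
            ... | inj₂ (e , e∈ , src , W≢0) = x , e , s≤s (≤-reflexive x≡) , e∈ , src ,
                    subst (λ (A : ℕ → ℕ) → A (target e) ≢ 0) W≡ W≢0
            ... | inj₁ old with proj₁ (upd y) old
            ...   | x′ , e , lt , rest = x′ , e , m<n⇒m<1+n lt , rest
            from : ∀ y {x′ e} → toℕ x′ < suc m → e ∈ entries s x′ → Entry.source e ≡ y → W (target e) ≢ 0 →
                   cells g′ 5 y ≢ 0
            from y {x′} {e} lt e∈ refl W≢0 with m≤n⇒m<n∨m≡n (s≤s⁻¹ lt)
            ... | inj₁ lt′ = Tallied.kept T (proj₂ (upd y) lt′ e∈ refl W≢0)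
            ... | inj₂ eq with toℕ-injective (trans eq (sym x≡))
            ...   | refl = Tallied.counted T e∈ (subst (λ (A : ℕ → ℕ) → A (target e) ≢ 0) (sym W≡) W≢0)

      copyLoop-run : ∀ h N → vars h 5 ≡ N → Run copyLoop h N (λ g →
        (∀ y → y < N → cells g 4 y ≡ cells h 5 y) × (∀ y → y < N → cells g 5 y ≡ 0)
        × (∀ y → N ≤ y → cells g 5 y ≡ cells h 5 y))
      copyLoop-run h N at-5 = run-mono (≤-reflexive (*-identityʳ N)) (λ z → z)
          (run-for-const 0 Inv refl at-5 ((λ y ()) , (λ y ()) , (λ y _ → refl)) body)
        where
        Inv : ℕ → Store → Set
        Inv j g = (∀ y → y < j → cells g 4 y ≡ cells h 5 y) × (∀ y → y < j → cells g 5 y ≡ 0)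
                  × (∀ y → j ≤ y → cells g 5 y ≡ cells h 5 y)
        body : ∀ j g → j < N → vars g 45 ≡ j → Frame copyLoop h g → Inv j g →
               Run (4 [ var 45 ]:= cell 5 (var 45) ▸ 5 [ var 45 ]:= con 0) g 0
                   (λ g′ → Inv (suc j) (bump 45 g′))
        body j g j< refl F (done′ , zero′ , rest) = run z≤n (done″ , zero″ , rest″)
          where
          done″ : ∀ y → y < suc j → (cells g 4 [ vars g 45 ↦ cells g 5 (vars g 45) ]) y ≡ cells h 5 y
          done″ y y< with m≤n⇒m<n∨m≡n (s≤s⁻¹ y<)
          ... | inj₁ lt = trans (upd-other (cells g 4) _ (λ eq → <-irrefl (sym eq) lt)) (done′ y lt)
          ... | inj₂ refl = trans (upd-same (cells g 4) (vars g 45) _) (rest y ≤-refl)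
          zero″ : ∀ y → y < suc j → (cells g 5 [ vars g 45 ↦ 0 ]) y ≡ 0
          zero″ y y< with m≤n⇒m<n∨m≡n (s≤s⁻¹ y<)
          ... | inj₁ lt = trans (upd-other (cells g 5) _ (λ eq → <-irrefl (sym eq) lt)) (zero′ y lt)
          ... | inj₂ refl = upd-same (cells g 5) (vars g 45) _
          rest″ : ∀ y → suc j ≤ y → (cells g 5 [ vars g 45 ↦ 0 ]) y ≡ cells h 5 y
          rest″ y j<y = trans (upd-other (cells g 5) _ (λ eq → <-irrefl eq j<y)) (rest y (<⇒≤ j<y))

      module _ .{{_ : NonZero t}} (0<base : 0 < base) (pairing : Pairing role)
        (Goal : Conf → Set) (Goal-cong : ∀ {δ ε} → δ ≗ᶜ ε → Goal δ → Goal ε)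
        (place-Good : ∀ {δ} s x → GoodConf δ → GoodConf (place G t δ s x))
        (wins⇒Storable : ∀ {δ S} → Wins Goal δ S → Storable δ)
        (heights≤ : ∀ pre s post → S ≡ pre ++ s ∷ post → height s ≤ t) where

        solveSteps : ℕ
        solveSteps = length S * suc (n * suc vertexSteps + base ^ n)

        -- In the invariant, `post` is the suffix whose table is complete, and `initLast` peels the
        -- next stack off `pre`. The accumulating table is zero at all indices between rounds, so
        -- that the tallies of a new round start from nothing.
        stackLoop-run : ∀ h → Context h → vars h 3 ≡ length S → vars h 5 ≡ base ^ n →
          vars h 8 ≡ length S + length S → (∀ y → cells h 5 y ≡ 0) → Marks Goal [] (cells h 4) →
          Run stackLoop h solveSteps (λ g → Marks Goal S (cells g 4))
        stackLoop-run h C at-3 at-5 at-8 zeros marks = run-mono ≤-refl (λ {g} → finish {g})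
            (run-for-const (n * suc vertexSteps + base ^ n) Inv refl at-3
              (S , [] , sym (++-identityʳ S) , refl , at-8 , marks , zeros) body)
          where
          Inv : ℕ → Store → Set
          Inv i g = ∃[ pre ] ∃[ post ] S ≡ pre ++ post × length post ≡ i
                    × vars g 8 ≡ length pre + length pre × Marks Goal post (cells g 4)
                    × (∀ y → cells g 5 y ≡ 0)
          finish : ∀ {g} → Inv (length S) g → Marks Goal S (cells g 4)
          finish ([] , post , refl , _ , _ , M , _) = M
          finish (x ∷ pre , post , eq , len , _) = contradiction
            (trans len (trans (cong length eq) (cong suc (length-++ pre)))) (<⇒≢ (s≤s (m≤n+m (length post) (length pre))))
          body : ∀ i g → i < length S → vars g 6 ≡ i → Frame stackLoop h g → Inv i g →
                 Run stackBody g (n * suc vertexSteps + base ^ n) (λ g′ → Inv (suc i) (bump 6 g′))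
          body i g i< at-6 F (pre , post , S≡ , len , g8 , M , Z) with initLast pre
          ... | [] = contradiction (trans (cong length S≡) len) (λ eq → <-irrefl (sym eq) i<)
          ... | ys ∷ʳ′ s = after (after (after (after (run-seq
                (vertexLoop-run s g₄ (heights≤ ys s post S≡′)
                  (context-frame (exec-frame loads g) refl refl refl refl refl
                    (context-frame F refl refl refl refl refl C))
                  (trans (cong inp g8′) (proj₁ (inp-stack ys s post S≡′)))
                  (trans (cong (λ z → inp (z + 1)) g8′) (proj₂ (inp-stack ys s post S≡′)))
                  (cong₂ _+_ g3 g3) Z)
                last))))
            where
            loads : Command
            loads = 8 := var 8 ⊟ con 2 ▸ 9 := input (var 8) ▸ 10 := input (var 8 ⊞ con 1) ▸ 11 := var 3 ⊞ var 3
            g₄ : Store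
            g₄ = exec loads g
            S≡′ : S ≡ ys ++ s ∷ post
            S≡′ = trans S≡ (++-assoc ys [ s ] post)
            g3 : vars g 3 ≡ length S
            g3 = trans (var≡ F 3 refl) at-3
            g8′ : vars g 8 ∸ 2 ≡ length ys + length ys
            g8′ = trans (cong (_∸ 2) (trans g8 (cong (λ z → z + z) (trans (length-++ ys) (+-comm (length ys) 1)))))
                        (cong (_∸ 1) (+-suc (length ys) (length ys)))
            last : ∀ f → Frame vertexLoop g₄ f → Updated s (cells g 4) (λ _ → ⊤) (cells f 5) →
                   Run copyLoop f (base ^ n) (λ g′ → Inv (suc i) (bump 6 g′))
            last f F′ upd = run-mono ≤-refl (λ {g} → conclude {g}) (run-frame (copyLoop-run f (base ^ n)
                (trans (var≡ F′ 5 refl) (trans (var≡ F 5 refl) at-5))))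
              where
              M′ : Marks Goal (s ∷ post) (cells f 5)
              M′ = Marks-step 0<base pairing Goal Goal-cong place-Good wins⇒Storable M upd
              -- Copying clears only the indices below the size of the table; beyond it nothing was
              -- written, as each nonzero entry belongs to the code of a small configuration.
              outside : ∀ y → base ^ n ≤ y → cells f 5 y ≡ 0
              outside y N≤y with cells f 5 y in eq
              ... | zero  = refl
              ... | suc _ with proj₁ (upd y) (λ z → 0≢1+n (trans (sym z) eq))
              ...   | x , e , _ , e∈ , src , _ with stage-sound s x pairing n ≤-refl e∈
              ...     | δ , refl , _ , small , _ = contradiction N≤y
                          (<⇒≱ (subst (_< base ^ n) src (code-bound 0<base {δ} small)))
              conclude : ∀ {g′} → Frame copyLoop f g′ × _ → Inv (suc i) (bump 6 g′)
              conclude {g′} (F″ , copied , zeroed , kept) =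
                ys , s ∷ post , S≡′ , cong suc len ,
                trans (var≡ F″ 8 refl) (trans (var≡ F′ 8 refl) g8′) ,
                record
                  { marked⇒wins = λ {δ} small ne → Marks.marked⇒wins M′ small
                      (subst (_≢ 0) (copied (code δ) (code-bound 0<base {δ} small)) ne)
                  ; wins⇒marked = λ {δ} small good wins → subst (_≢ 0)
                      (sym (copied (code δ) (code-bound 0<base {δ} small)))
                      (Marks.wins⇒marked M′ small good wins) } ,
                clean
                where
                clean : ∀ y → cells g′ 5 y ≡ 0
                clean y with y <? base ^ n
                ... | yes lt = zeroed y lt
                ... | no ≮   = trans (kept y (≮⇒≥ ≮)) (outside y (≮⇒≥ ≮))

        fill-run : ∀ init T h → vars h 0 ≡ n → vars h 1 ≡ k → vars h 2 ≡ t → vars h 3 ≡ length S →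
          (∀ y → cells h 4 y ≡ 0) → (∀ y → cells h 5 y ≡ 0) →
          (∀ v → cells h 7 (toℕ v) ≡ roleCode (role v)) →
          (∀ g → Fresh g → (∀ y → cells g 4 y ≡ 0) →
             Run init g T (λ f → Fresh f × Marks Goal [] (cells f 4))) →
          Run (fill init) h (n * suc (k * suc (t * 1)) + (T + solveSteps))
              (λ g → Answers (Wins Goal allEmpty S) (vars g 0))
        fill-run init T h at-0 at-1 at-2 at-3 zeros₄ zeros₅ roles init-run =
          run-mono (≤-reflexive (cong₂ _+_ (+-identityʳ (n * suc (k * suc (t * 1)))) (cong (T +_) (+-identityʳ solveSteps)))) (λ z → z)
            (run-seq {p = setup} {t₁ = n * suc (k * suc (t * 1)) + 0} {Q = λ g → Fresh g × (∀ y → cells g 4 y ≡ 0)}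
              (run-seq {t₂ = 0} (powers-run h at-0 at-1 at-2) prepare)
              (λ g F (fresh , z₄) → run-seq (init-run g fresh z₄) (λ f F′ (fresh′ , M) →
                run-seq {t₂ = 0} (stackLoop-run f (Fresh.context fresh′) (Fresh.at-3 fresh′) (Fresh.at-5 fresh′)
                  (Fresh.at-8 fresh′) (Fresh.zeros fresh′) M) respond)))
          where
          prepare : ∀ g → Frame tabulatePowers h g → (∀ i → i ≤ n → cells g 6 i ≡ base ^ i) →
            Run (5 := cell 6 (var 0) ▸ 8 := var 3 ⊞ var 3) g 0 (λ g → Fresh g × (∀ y → cells g 4 y ≡ 0))
          prepare g F pow = run z≤n
            ( record
              { context = record
                { at-0 = trans (var≡ F 0 refl) at-0
                ; at-1 = trans (var≡ F 1 refl) at-1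
                ; at-2 = trans (var≡ F 2 refl) at-2
                ; powers = λ v → pow (toℕ v) (<⇒≤ (toℕ<n v))
                ; roles = λ v → trans (cong-app (cell≡ F 7 refl) (toℕ v)) (roles v) }
              ; at-3 = trans (var≡ F 3 refl) at-3
              ; at-5 = trans (cong (cells g 6) (trans (var≡ F 0 refl) at-0)) (pow n ≤-refl)
              ; at-8 = cong₂ _+_ (trans (var≡ F 3 refl) at-3) (trans (var≡ F 3 refl) at-3)
              ; zeros = λ y → trans (cong-app (cell≡ F 5 refl) y) (zeros₅ y) }
            , λ y → trans (cong-app (cell≡ F 4 refl) y) (zeros₄ y) )
          respond : ∀ {f} g → Frame stackLoop f g → Marks Goal S (cells g 4) →
                    Run answer g 0 (λ g → Answers (Wins Goal allEmpty S) (vars g 0))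
          respond g F M = run-if
            (λ ne → run z≤n (inj₁ (Marks.marked⇒wins M (λ v ()) (subst (λ y → cells g 4 y ≢ 0) (sym code-empty) ne) , refl)))
            (λ eq → run z≤n (inj₂ ((λ wins → Marks.wins⇒marked M (λ v ()) (λ _ → inj₁ refl) wins
                                               (trans (cong (cells g 4) code-empty) eq)) , refl)))

    fresh-frame : ∀ {p h g} → Frame p h g →
      assigns 0 p ≡ false → assigns 1 p ≡ false → assigns 2 p ≡ false → assigns 3 p ≡ false →
      assigns 5 p ≡ false → assigns 8 p ≡ false → updates 5 p ≡ false → updates 6 p ≡ false →
      updates 7 p ≡ false → Fresh h → Fresh g
    fresh-frame F e₀ e₁ e₂ e₃ e₅ e₈ u₅ u₆ u₇ R = record
      { context = context-frame F e₀ e₁ e₂ u₆ u₇ (Fresh.context R)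
      ; at-3 = trans (var≡ F 3 e₃) (Fresh.at-3 R)
      ; at-5 = trans (var≡ F 5 e₅) (Fresh.at-5 R)
      ; at-8 = trans (var≡ F 8 e₈) (Fresh.at-8 R)
      ; zeros = λ y → trans (cong-app (cell≡ F 5 u₅) y) (Fresh.zeros R y) }

    markAll-run : 0 < base → ∀ g → Fresh g → (∀ y → cells g 4 y ≡ 0) →
      Run markAll g (base ^ n) (λ f → Fresh f × Marks (λ _ → ⊤) [] (cells f 4))
    markAll-run 0<base g fresh zeros = run-mono (≤-reflexive (*-identityʳ _)) (λ {f} → finish {f}) (run-frame
        (run-for-const 0 (λ j f → ∀ y → y < j → cells f 4 y ≡ 1) refl (Fresh.at-5 fresh) (λ y ()) body))
      where
      body : ∀ j f → j < base ^ n → vars f 58 ≡ j → Frame markAll g f → (∀ y → y < j → cells f 4 y ≡ 1) →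
        Run (4 [ var 58 ]:= con 1) f 0 (λ f′ → ∀ y → y < suc j → cells f′ 4 y ≡ 1)
      body j f j< refl F inv = run z≤n at
        where
        at : ∀ y → y < suc j → (cells f 4 [ vars f 58 ↦ 1 ]) y ≡ 1
        at y y< with m≤n⇒m<n∨m≡n (s≤s⁻¹ y<)
        ... | inj₁ lt = trans (upd-other (cells f 4) 1 (λ eq → <-irrefl (sym eq) lt)) (inv y lt)
        ... | inj₂ refl = upd-same (cells f 4) (vars f 58) 1
      finish : ∀ {f} → Frame markAll g f × (∀ y → y < base ^ n → cells f 4 y ≡ 1) →
               Fresh f × Marks (λ _ → ⊤) [] (cells f 4)
      finish {f} (F , ones) = fresh-frame F refl refl refl refl refl refl refl refl refl fresh , record
        { marked⇒wins = λ {δ} _ _ → δ , done , tt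
        ; wins⇒marked = λ {δ} small _ _ eq →
            0≢1+n (trans (sym eq) (ones (code δ) (code-bound 0<base {δ} small))) }

    AllEmpty : Conf → Set
    AllEmpty δ = ∀ v → δ v ≡ nothing

    markEmpty-run : .{{_ : NonZero t}} → 0 < base → ∀ g → Fresh g → (∀ y → cells g 4 y ≡ 0) →
      Run markEmpty g 0 (λ f → Fresh f × Marks AllEmpty [] (cells f 4))
    markEmpty-run 0<base g fresh zeros = run z≤n
        (fresh-frame (exec-frame markEmpty g) refl refl refl refl refl refl refl refl refl fresh , record
          { marked⇒wins = λ {δ} small ne → δ , done , λ v →
              code-injective 0<base {δ} {allEmpty} small (λ _ ()) (trans (zero-code (code δ) ne) (sym code-empty)) v
          ; wins⇒marked = λ _ _ wins → one (cleared wins) })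
      where
      one : ∀ {y} → y ≡ 0 → (cells g 4 [ 0 ↦ 1 ]) y ≢ 0
      one refl ()
      cleared : ∀ {δ} → Wins AllEmpty δ [] → code δ ≡ 0
      cleared (_ , done , goal) = trans (code-cong goal) code-empty
      zero-code : ∀ y → (cells g 4 [ 0 ↦ 1 ]) y ≢ 0 → y ≡ 0
      zero-code zero    ne = refl
      zero-code (suc y) ne = contradiction (zeros (suc y)) ne

    -- With two colours, the moves are counted by the second term of the binomial
    -- expansion of (k t) ^ n, so that no vertex needs a partner.
    many-run : (all-single : ∀ u → role u ≡ single) → 2 ≤ k → 2 ≤ t → 1 ≤ n → 1 ≤ length S →
      All (λ s → height s ≤ t) S → ∀ Goal → (∀ {δ ε} → δ ≗ᶜ ε → Goal δ → Goal ε) →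
      ∀ init T → T ≤ base ^ n →
      (∀ g → Fresh g → (∀ y → cells g 4 y ≡ 0) → Run init g T (λ f → Fresh f × Marks Goal [] (cells f 4))) →
      ∀ h → Initial G t S h →
      ∃[ T′ ] Run (fill init) h T′ (λ g → Answers (Wins Goal allEmpty S) (vars g 0))
              × T′ ≤ 32 * (length S * (k * t) ^ n)
    many-run all-single 2≤k 2≤t 1≤n 1≤s bounded Goal Goal-cong init T T≤ init-run h
      (at-0 , at-1 , at-2 , at-3 , zeros) = _ ,
      fill-run (≤-trans (s≤s z≤n) 2≤t) E (entries-length all-single)
        {{>-nonZero (≤-trans (s≤s z≤n) 2≤t)}} (≤-trans (s≤s z≤n) (*-mono-≤ 1≤k 2≤t))
        (record { partner-skip = λ {u} r → no-first u r
                ; partner-injective = λ {u} r _ → no-first u r }) Goal Goal-cong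
        (λ _ _ _ {u} r → no-first u r)
        (λ _ {v} _ → inj₁ (λ r → case-single (trans (sym (all-single v)) r)))
        (heights-split bounded) init T h at-0 at-1 at-2 at-3 (zeros 4) (zeros 5)
        (λ v → trans (zeros 7 (toℕ v)) (cong roleCode (sym (all-single v)))) init-run ,
      solve-bound n k t (length S) E 1 T 1≤n 1≤k 2≤t 1≤s T≤ nE≤
      where
      no-first : ∀ {A : Set} u {w} → role u ≡ first w → A
      no-first u r with () ← trans (sym (all-single u)) r
      case-single : ∀ {A : Set} → single {n} ≡ skip → A
      case-single ()
      1≤k : 1 ≤ k
      1≤k = ≤-trans (s≤s z≤n) 2≤k
      E : ℕ
      E = M all-single ^ (n ∸ 1)
      -- This is M + 1 ≤ k t, which amounts to two colours; `single-bound` spends the spare unit on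
      -- the factor `n`.
      width : ∀ k t → 2 ≤ k → 2 ≤ t → suc (suc (k * (t ∸ 1))) ≤ k * t
      width k (suc u) 2≤k _ = ≤-trans (+-monoˡ-≤ (k * u) 2≤k) (≤-reflexive (sym (*-suc k u)))
      nE≤ : n * E ≤ 1 * base ^ n
      nE≤ = ≤-trans (single-bound (M all-single) n (width k t 2≤k 2≤t)) (≤-reflexive (sym (+-identityʳ _)))

-- Matching of a graph

matchStep matchRow matching isolateRow isolating starStep starRow starring : Command
matchStep =
  ifnz cell 7 (var 60) ⊞ cell 7 (var 63) then nop else
    (ifnz input (var 62 ⊞ var 63)
      then (7 [ var 60 ]:= var 63 ⊞ con 2 ▸ 7 [ var 63 ]:= con 1)
      else nop)
matchRow = (for 63 / 64 below var 0 loop matchStep) ▸ 62 := var 62 ⊞ var 0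
matching = 62 := var 3 ⊞ var 3 ▸ (for 60 / 61 below var 0 loop matchRow)
isolateRow =
  66 := con 0 ▸
  (for 63 / 64 below var 0 loop (66 := var 66 ⊞ input (var 62 ⊞ var 63))) ▸
  (ifnz cell 7 (var 60) ⊞ var 66 then nop else (7 [ var 60 ]:= con 1)) ▸
  62 := var 62 ⊞ var 0
isolating = 62 := var 3 ⊞ var 3 ▸ (for 60 / 61 below var 0 loop isolateRow)
starStep =
  ifnz input (var 62 ⊞ var 63)
    then (ifnz cell 7 (var 63) then nop else (67 := var 67 ⊞ con 1))
    else nop
starRow =
  67 := con 0 ▸
  (for 63 / 64 below var 0 loop starStep) ▸
  -- A nonzero truncated difference is a strict inequality; the added 1 turns it into 2 t ≤ number
  -- of leaves.
  (ifnz (var 67 ⊞ con 1) ⊟ (var 2 ⊞ var 2) then (65 := con 1) else nop) ▸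
  62 := var 62 ⊞ var 0
starring = 65 := con 0 ▸ 62 := var 3 ⊞ var 3 ▸ (for 60 / 61 below var 0 loop starRow)

∑-mono : ∀ {n} {f g : Fin n → ℕ} → (∀ u → f u ≤ g u) → ∑ f ≤ ∑ g
∑-mono {zero}  le = z≤n
∑-mono {suc n} le = +-mono-≤ (le zero) (∑-mono (le ∘ suc))

∑-term : ∀ {n} (f : Fin n → ℕ) x → f x ≤ ∑ f
∑-term f zero    = m≤m+n (f zero) _
∑-term f (suc x) = ≤-trans (∑-term (f ∘ suc) x) (m≤n+m _ (f zero))

∑-scale : ∀ {n} b (f : Fin n → ℕ) → ∑ (λ u → f u * b) ≡ ∑ f * b
∑-scale {zero}  b f = refl
∑-scale {suc n} b f = trans (cong (f zero * b +_) (∑-scale b (f ∘ suc))) (sym (*-distribʳ-+ b (f zero) _))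

∑-one : ∀ n → ∑ {n} (λ _ → 1) ≡ n
∑-one zero    = refl
∑-one (suc n) = cong suc (∑-one n)

roleCode-single : ∀ {n} (r : Role n) → roleCode r ≡ 0 → r ≡ single
roleCode-single single eq = refl

module Pairs {n : ℕ} (G : Graph n) (inp : ℕ → ℕ) (|S| : ℕ)
  (inp-adjacent : ∀ u v → inp (|S| + |S| + toℕ u * n + toℕ v) ≡ (if Graph.adjacent G u v then 1 else 0))
  where
  open Graph G
  open Semantics inp

  Isolated : Fin n → Set
  Isolated v = ∀ w → adjacent v w ≡ false

  -- `balanced` makes the number of `skip` vertices minus that of pairs an exact subtraction; the
  -- difference counts the discarded vertices in the time bound.
  record Settled (role : Fin n → Role n) : Set where
    field
      pairing  : Pairing role
      edge     : ∀ {u w} → role u ≡ first w → adjacent u w ≡ true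
      partner  : ∀ {w} → role w ≡ skip → (∃[ u ] role u ≡ first w) ⊎ Isolated w
      balanced : ∑ (isFirst ∘ role) ≤ ∑ (isSkip ∘ role)

  module _ {role : Fin n → Role n} (settled : Settled role) where
    open Settled settled
    open Pairing pairing

    couple : Fin n → Fin n → Fin n → Role n
    couple u w v = if does (v ≟ᶠ w) then skip else (if does (v ≟ᶠ u) then first w else role v)

    module _ {u w : Fin n} (u-single : role u ≡ single) (w-single : role w ≡ single)
             (u~w : adjacent u w ≡ true) where

      u≢w : u ≢ w
      u≢w refl with () ← trans (sym u~w) (irreflexive u)

      couple-w : couple u w w ≡ skip
      couple-w rewrite dec-true (w ≟ᶠ w) refl = refl

      couple-u : couple u w u ≡ first w
      couple-u rewrite dec-false (u ≟ᶠ w) u≢w | dec-true (u ≟ᶠ u) refl = refl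

      couple-off : ∀ {v} → v ≢ u → v ≢ w → couple u w v ≡ role v
      couple-off {v} ne ne′ rewrite dec-false (v ≟ᶠ w) ne′ | dec-false (v ≟ᶠ u) ne = refl

      couple-first : ∀ {a b} → couple u w a ≡ first b → (a ≡ u × b ≡ w) ⊎ role a ≡ first b
      couple-first {a} eq with a ≟ᶠ w | a ≟ᶠ u
      couple-first {a} () | yes _ | _
      couple-first {a} refl | no _ | yes a≡u = inj₁ (a≡u , refl)
      ... | no _ | no _ = inj₂ eq

      couple-single : ∀ {a} → couple u w a ≡ single → role a ≡ single
      couple-single {a} eq with a ≟ᶠ w | a ≟ᶠ u
      couple-single {a} () | yes _ | _
      couple-single {a} () | no _ | yes _
      ... | no _ | no _ = eq

      not-single : ∀ {a r} → role a ≡ r → r ≢ single → a ≢ u × a ≢ w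
      not-single eq ne = (λ a≡u → ne (trans (sym eq) (trans (cong role a≡u) u-single))) ,
                         (λ a≡w → ne (trans (sym eq) (trans (cong role a≡w) w-single)))

      couple-settled : Settled (couple u w)
      couple-settled = record
        { pairing = record { partner-skip = λ {a} → skip′ {a} ; partner-injective = injective′ }
        ; edge = edge′
        ; partner = partner′
        ; balanced = balanced′ }
        where
        keep : ∀ {a r} → role a ≡ r → r ≢ single → couple u w a ≡ r
        keep {a} eq ne with not-single {a} eq ne
        ... | a≢u , a≢w = trans (couple-off a≢u a≢w) eq
        skip′ : ∀ {a b} → couple u w a ≡ first b → couple u w b ≡ skip
        skip′ {a} {b} eq with couple-first {a} eq
        ... | inj₁ (refl , refl) = couple-w
        ... | inj₂ eq′ = keep {b} (partner-skip eq′) (λ ())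
        injective′ : ∀ {a b x} → couple u w a ≡ first x → couple u w b ≡ first x → a ≡ b
        injective′ {a} {b} p q with couple-first {a} p | couple-first {b} q
        ... | inj₁ (refl , _) | inj₁ (refl , _) = refl
        ... | inj₂ p′ | inj₂ q′ = partner-injective p′ q′
        -- The new partner was single until now, so it is not a partner already.
        ... | inj₁ (_ , refl) | inj₂ q′ with () ← trans (sym (partner-skip q′)) w-single
        injective′ {a} {b} p q | inj₂ p′ | inj₁ (_ , refl) with () ← trans (sym (partner-skip p′)) w-single
        edge′ : ∀ {a b} → couple u w a ≡ first b → adjacent a b ≡ true
        edge′ {a} eq with couple-first {a} eq
        ... | inj₁ (refl , refl) = u~w
        ... | inj₂ eq′ = edge eq′
        partner′ : ∀ {a} → couple u w a ≡ skip → (∃[ b ] couple u w b ≡ first a) ⊎ Isolated a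
        partner′ {a} eq = by (a ≟ᶠ w) (a ≟ᶠ u)
          where
          by : Dec (a ≡ w) → Dec (a ≡ u) → (∃[ b ] couple u w b ≡ first a) ⊎ Isolated a
          by (yes refl) _ = inj₁ (u , couple-u)
          by (no _) (yes refl) with () ← trans (sym couple-u) eq
          by (no a≢w) (no a≢u) with partner (trans (sym (couple-off a≢u a≢w)) eq)
          ... | inj₁ (b , r) = inj₁ (b , keep r (λ ()))
          ... | inj₂ iso     = inj₂ iso
        balanced′ : ∑ (isFirst ∘ couple u w) ≤ ∑ (isSkip ∘ couple u w)
        balanced′ = begin
          ∑ (isFirst ∘ couple u w)                   ≡⟨ ∑-update (isFirst ∘ role) _ u (cong isFirst u-single) off-u ⟩
          ∑ (isFirst ∘ role) + isFirst (couple u w u) ≡⟨ cong (λ r → ∑ (isFirst ∘ role) + isFirst r) couple-u ⟩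
          ∑ (isFirst ∘ role) + 1                     ≤⟨ +-monoˡ-≤ 1 balanced ⟩
          ∑ (isSkip ∘ role) + 1                      ≡⟨ cong (λ r → ∑ (isSkip ∘ role) + isSkip r) couple-w ⟨
          ∑ (isSkip ∘ role) + isSkip (couple u w w)  ≡⟨ ∑-update (isSkip ∘ role) _ w (cong isSkip w-single) off-w ⟨
          ∑ (isSkip ∘ couple u w)                    ∎
          where
          open ≤-Reasoning
          off-u : ∀ v → v ≢ u → isFirst (couple u w v) ≡ isFirst (role v)
          off-u v v≢u with v ≟ᶠ w
          ... | yes refl = sym (cong isFirst w-single)
          ... | no v≢w rewrite dec-false (v ≟ᶠ u) v≢u = refl
          off-w : ∀ v → v ≢ w → isSkip (couple u w v) ≡ isSkip (role v)
          off-w v v≢w with v ≟ᶠ u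
          ... | yes refl rewrite dec-false (v ≟ᶠ w) v≢w = sym (cong isSkip u-single)
          ... | no v≢u rewrite dec-false (v ≟ᶠ w) v≢w = refl

    discard : Fin n → Fin n → Role n
    discard u v = if does (v ≟ᶠ u) then skip else role v

    module _ {u : Fin n} (u-single : role u ≡ single) (u-isolated : Isolated u) where

      discard-at : discard u u ≡ skip
      discard-at rewrite dec-true (u ≟ᶠ u) refl = refl

      discard-off : ∀ {v} → v ≢ u → discard u v ≡ role v
      discard-off {v} ne rewrite dec-false (v ≟ᶠ u) ne = refl

      discard-back : ∀ {v r} → discard u v ≡ r → r ≢ skip → role v ≡ r
      discard-back {v} eq ne with v ≟ᶠ u
      ... | yes _ = contradiction (sym eq) ne
      ... | no _  = eq

      discard-settled : Settled (discard u)
      discard-settled = record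
        { pairing = record
          { partner-skip = λ eq → skip-stays (partner-skip (discard-back eq (λ ())))
          ; partner-injective = λ p q → partner-injective (discard-back p (λ ())) (discard-back q (λ ())) }
        ; edge = λ eq → edge (discard-back eq (λ ()))
        ; partner = partner′
        ; balanced = ≤-trans (∑-mono first≤) (≤-trans balanced (∑-mono skip≤)) }
        where
        skip-stays : ∀ {v} → role v ≡ skip → discard u v ≡ skip
        skip-stays {v} eq with v ≟ᶠ u
        ... | yes _ = refl
        ... | no _  = eq
        partner′ : ∀ {a} → discard u a ≡ skip → (∃[ b ] discard u b ≡ first a) ⊎ Isolated a
        partner′ {a} eq = by (a ≟ᶠ u)
          where
          by : Dec (a ≡ u) → (∃[ b ] discard u b ≡ first a) ⊎ Isolated a
          by (yes refl) = inj₂ u-isolated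
          by (no a≢u) with partner (trans (sym (discard-off a≢u)) eq)
          ... | inj₂ iso     = inj₂ iso
          ... | inj₁ (b , r) = inj₁ (b , trans (discard-off b≢u) r)
            where
            b≢u : b ≢ u
            b≢u refl with () ← trans (sym r) u-single
        first≤ : ∀ v → isFirst (discard u v) ≤ isFirst (role v)
        first≤ v with v ≟ᶠ u
        ... | yes _ = z≤n
        ... | no _  = ≤-refl
        skip≤ : ∀ v → isSkip (role v) ≤ isSkip (discard u v)
        skip≤ v with v ≟ᶠ u
        ... | yes refl rewrite u-single = z≤n
        ... | no _  = ≤-refl

  Coded : (ℕ → ℕ) → (Fin n → Role n) → Set
  Coded A role = ∀ v → A (toℕ v) ≡ roleCode (role v)

  next-row : ∀ a m → a + m * n + n ≡ a + suc m * n
  next-row a m = trans (+-assoc a (m * n) n) (cong (a +_) (+-comm (m * n) n))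

  -- Maximality of the matching on the set `P` of inspected pairs. Single vertices only become
  -- fewer, so a pair once inspected never has to be revisited.
  Seen : (ℕ → ℕ → Set) → (Fin n → Role n) → Set
  Seen P role = ∀ {u w} → P (toℕ u) (toℕ w) → adjacent u w ≡ true → role u ≡ single → role w ≡ single → ⊥

  Matched : (ℕ → ℕ → Set) → (ℕ → ℕ) → Set
  Matched P A = ∃[ role ] Coded A role × Settled role × Seen P role

  matching-run : ∀ h → vars h 0 ≡ n → vars h 3 ≡ |S| → Matched (λ _ _ → ⊥) (cells h 7) →
    Run matching h (n * suc (n * 1)) (λ g → Matched (λ _ _ → ⊤) (cells g 7))
  matching-run h at-0 at-3 start = after (run-mono ≤-refl (λ {g} → finish {g})
      (run-for-const (n * 1) Outer refl at-0
        (trans (cong₂ _+_ at-3 at-3) (sym (+-identityʳ _)) , weaken (λ _ _ → ⊥) (λ a b → a < 0) (cells h 7) (λ _ _ ()) start) outer))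
    where
    weaken : ∀ (P Q : ℕ → ℕ → Set) A → (∀ {a b} → a < n → b < n → Q a b → P a b) → Matched P A → Matched Q A
    weaken P Q A sub (role , coded , settled , seen) =
      role , coded , settled , λ {u} {w} q → seen (sub (toℕ<n u) (toℕ<n w) q)
    Outer : ℕ → Store → Set
    Outer j g = vars g 62 ≡ |S| + |S| + j * n × Matched (λ a b → a < j) (cells g 7)
    finish : ∀ {g} → Outer n g → Matched (λ _ _ → ⊤) (cells g 7)
    finish {g} (_ , M) = weaken (λ a _ → a < n) (λ _ _ → ⊤) (cells g 7) (λ a< _ _ → a<) M
    rowLoop : Command
    rowLoop = for 63 / 64 below var 0 loop matchStep
    outer : ∀ j g → j < n → vars g 60 ≡ j → Frame (for 60 / 61 below var 0 loop matchRow) _ g → Outer j g →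
            Run matchRow g (n * 1) (λ g′ → Outer (suc j) (bump 60 g′))
    outer j g j< at-60 F (g62 , M) = run-mono (≤-reflexive (+-identityʳ _)) (λ z → z) (run-seq {t₂ = 0}
        (run-for-const 0 (λ i f → Matched (P i) (cells f 7)) refl g0 (weaken (λ a _ → a < j) (P 0) (cells g 7) initial M) inner)
        (λ f F′ M′ → run z≤n
          ( trans (cong₂ _+_ (trans (var≡ F′ 62 refl) g62) (trans (var≡ F′ 0 refl) g0))
                  (next-row (|S| + |S|) j)
          , weaken (P n) (λ a _ → a < suc j) (cells f 7) last M′ )))
      where
      g0 : vars g 0 ≡ n
      g0 = trans (var≡ F 0 refl) at-0
      -- The pairs before (j , i) in the lexicographic order of the two loops.
      P : ℕ → ℕ → ℕ → Set
      P i a b = a < j ⊎ (a ≡ j × b < i)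
      initial : ∀ {a b} → a < n → b < n → P 0 a b → a < j
      initial _ _ (inj₁ lt) = lt
      last : ∀ {a b} → a < n → b < n → a < suc j → P n a b
      last _ b< a< with m≤n⇒m<n∨m≡n (s≤s⁻¹ a<)
      ... | inj₁ lt = inj₁ lt
      ... | inj₂ eq = inj₂ (eq , b<)
      u : Fin n
      u = fromℕ< j<
      u≡ : toℕ u ≡ j
      u≡ = toℕ-fromℕ< j<
      inner : ∀ i f → i < n → vars f 63 ≡ i → Frame rowLoop g f → Matched (P i) (cells f 7) →
              Run matchStep f 0 (λ f′ → Matched (P (suc i)) (cells f′ 7))
      inner i f i< at-63 F′ (role , coded , settled , seen) = run-if
          (λ ne → run z≤n (role , coded , settled , extend-seen (λ z → z) λ _ p q → ne
            (cong₂ _+_ (trans A-u (cong roleCode p)) (trans A-w (cong roleCode q)))))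
          (λ eq → run-if
            (λ ne → run z≤n (couple settled u w , recoded (single-u eq) (single-w eq) (edge-uw ne) ,
                couple-settled settled (single-u eq) (single-w eq) (edge-uw ne) ,
                coupled-seen (single-u eq) (single-w eq) (edge-uw ne)))
            (λ z → run z≤n (role , coded , settled , extend-seen (λ z → z) λ a _ _ →
                case-true a (bit≡0 (trans (sym bit≡) z)))))
        where
        case-true : adjacent u (fromℕ< i<) ≡ true → adjacent u (fromℕ< i<) ≡ false → ⊥
        case-true p q with () ← trans (sym p) q
        w : Fin n
        w = fromℕ< i<
        w≡ : toℕ w ≡ i
        w≡ = toℕ-fromℕ< i<
        f60 : vars f 60 ≡ toℕ u
        f60 = trans (var≡ F′ 60 refl) (trans at-60 (sym u≡))
        f63 : vars f 63 ≡ toℕ w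
        f63 = trans at-63 (sym w≡)
        A-u : cells f 7 (vars f 60) ≡ roleCode (role u)
        A-u = trans (cong (cells f 7) f60) (coded u)
        A-w : cells f 7 (vars f 63) ≡ roleCode (role w)
        A-w = trans (cong (cells f 7) f63) (coded w)
        bit≡ : inp (vars f 62 + vars f 63) ≡ bit (adjacent u w)
        bit≡ = trans (cong₂ (λ a b → inp (a + b))
                 (trans (var≡ F′ 62 refl) (trans g62 (cong (λ z → |S| + |S| + z * n) (sym u≡)))) f63)
                 (inp-adjacent u w)
        single-u : cells f 7 (vars f 60) + cells f 7 (vars f 63) ≡ 0 → role u ≡ single
        single-u eq = roleCode-single (role u) (trans (sym A-u) (m+n≡0⇒m≡0 _ eq))
        single-w : cells f 7 (vars f 60) + cells f 7 (vars f 63) ≡ 0 → role w ≡ single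
        single-w eq = roleCode-single (role w) (trans (sym A-w) (m+n≡0⇒n≡0 (cells f 7 (vars f 60)) eq))
        edge-uw : inp (vars f 62 + vars f 63) ≢ 0 → adjacent u w ≡ true
        edge-uw ne = bit≢0 (λ z → ne (trans bit≡ z))
        extend-seen : ∀ {role′ : Fin n → Role n} → (∀ {v} → role′ v ≡ single → role v ≡ single) →
          (adjacent u w ≡ true → role′ u ≡ single → role′ w ≡ single → ⊥) → Seen (P (suc i)) role′
        extend-seen old new {a} {b} (inj₁ lt) e p q = seen (inj₁ lt) e (old p) (old q)
        extend-seen old new {a} {b} (inj₂ (a≡ , b<)) e p q with m≤n⇒m<n∨m≡n (s≤s⁻¹ b<)
        ... | inj₁ lt = seen (inj₂ (a≡ , lt)) e (old p) (old q)
        ... | inj₂ b≡ with toℕ-injective (trans a≡ (sym u≡)) | toℕ-injective (trans b≡ (sym w≡))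
        ...   | refl | refl = new e p q
        coupled-seen : ∀ p q e → Seen (P (suc i)) (couple settled u w)
        coupled-seen p q e = extend-seen (λ {v} → couple-single settled p q e {v})
          (λ _ z _ → first≢single (trans (sym (couple-u settled p q e)) z))
          where
          first≢single : first w ≢ single
          first≢single ()
        recoded : ∀ (p : role u ≡ single) (q : role w ≡ single) (e : adjacent u w ≡ true) →
          Coded ((cells f 7 [ vars f 60 ↦ vars f 63 + 2 ]) [ vars f 63 ↦ 1 ]) (couple settled u w)
        recoded p q e v with v ≟ᶠ w | v ≟ᶠ u
        ... | yes refl | _ = trans (cong ((cells f 7 [ vars f 60 ↦ vars f 63 + 2 ]) [ vars f 63 ↦ 1 ]) (sym f63))
                               (upd-same (cells f 7 [ vars f 60 ↦ vars f 63 + 2 ]) (vars f 63) 1)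
        ... | no v≢w | yes refl = trans (upd-other (cells f 7 [ vars f 60 ↦ vars f 63 + 2 ]) 1 (λ z → v≢w (toℕ-injective (trans (sym z) f63))))
              (trans (cong (cells f 7 [ vars f 60 ↦ vars f 63 + 2 ]) (sym f60))
                (trans (upd-same (cells f 7) (vars f 60) _) (trans (+-comm (vars f 63) 2) (cong (2 +_) f63))))
        ... | no v≢w | no v≢u = trans (upd-other (cells f 7 [ vars f 60 ↦ vars f 63 + 2 ]) 1 (λ z → v≢w (toℕ-injective (trans (sym z) f63))))
              (trans (upd-other (cells f 7) _ (λ z → v≢u (toℕ-injective (trans (sym z) f60)))) (coded v))

  degree : Fin n → ℕ
  degree u = ∑ (λ v → bit (adjacent u v))

  degree≡0 : ∀ {u} → degree u ≡ 0 → Isolated u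
  degree≡0 {u} eq v = bit≡0 (n≤0⇒n≡0 (≤-trans (∑-term (λ v → bit (adjacent u v)) v) (≤-reflexive eq)))

  degree≢0 : ∀ {u} → degree u ≢ 0 → ∃[ v ] adjacent u v ≡ true
  degree≢0 {u} = search (adjacent u)
    where
    search : ∀ {m} (f : Fin m → Bool) → ∑ (λ v → bit (f v)) ≢ 0 → ∃[ v ] f v ≡ true
    search {zero}  f ne = contradiction refl ne
    search {suc m} f ne with f zero in eq
    ... | true  = zero , eq
    ... | false with search (f ∘ suc) ne
    ...   | v , fv = suc v , fv

  Reduced : (ℕ → Set) → (ℕ → ℕ) → Set
  Reduced P A = ∃[ role ] Coded A role × Settled role × Seen (λ _ _ → ⊤) role
                × (∀ {u} → P (toℕ u) → role u ≡ single → ∃[ v ] adjacent u v ≡ true)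

  -- Discarding only removes single vertices, so the matching stays maximal; the single vertices
  -- that remain have a neighbour, from which `single-count` starts.
  isolating-run : ∀ h → vars h 0 ≡ n → vars h 3 ≡ |S| → Matched (λ _ _ → ⊤) (cells h 7) →
    Run isolating h (n * suc (n * 1)) (λ g → Reduced (λ _ → ⊤) (cells g 7))
  isolating-run h at-0 at-3 (role₀ , coded₀ , settled₀ , seen₀) = after (run-mono ≤-refl (λ {g} → finish {g})
      (run-for-const (n * 1) Outer refl at-0
        (trans (cong₂ _+_ at-3 at-3) (sym (+-identityʳ _)) , role₀ , coded₀ , settled₀ , seen₀ , λ ()) outer))
    where
    Outer : ℕ → Store → Set
    Outer j g = vars g 62 ≡ |S| + |S| + j * n × Reduced (_< j) (cells g 7)
    finish : ∀ {g} → Outer n g → Reduced (λ _ → ⊤) (cells g 7)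
    finish (_ , role , coded , settled , seen , touched) =
      role , coded , settled , seen , λ {u} _ → touched (toℕ<n u)
    sumStep rowLoop mark : Command
    sumStep = 66 := var 66 ⊞ input (var 62 ⊞ var 63)
    rowLoop = for 63 / 64 below var 0 loop sumStep
    mark = ifnz cell 7 (var 60) ⊞ var 66 then nop else (7 [ var 60 ]:= con 1)
    outer : ∀ j g → j < n → vars g 60 ≡ j → Frame (for 60 / 61 below var 0 loop isolateRow) _ g → Outer j g →
            Run isolateRow g (n * 1) (λ g′ → Outer (suc j) (bump 60 g′))
    outer j g j< at-60 F (g62 , role , coded , settled , seen , touched) =
      after (run-mono (≤-reflexive (+-identityʳ _)) (λ z → z) (run-seq {t₂ = 0} (run-for-const 0
          (λ i f → (i≤ : i ≤ n) → vars f 66 ≡ prefix (λ v → bit (adjacent u v)) i i≤) refl g0 (λ _ → refl) inner)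
        tail))
      where
      u : Fin n
      u = fromℕ< j<
      u≡ : toℕ u ≡ j
      u≡ = toℕ-fromℕ< j<
      g0 : vars g 0 ≡ n
      g0 = trans (var≡ F 0 refl) at-0
      inner : ∀ i f → i < n → vars f 63 ≡ i → Frame rowLoop (setVar 66 0 g) f →
        ((i≤ : i ≤ n) → vars f 66 ≡ prefix (λ v → bit (adjacent u v)) i i≤) →
        Run sumStep f 0 (λ f′ → (i≤ : suc i ≤ n) → vars (bump 63 f′) 66 ≡ prefix (λ v → bit (adjacent u v)) (suc i) i≤)
      inner i f i< at-63 F′ inv = run z≤n λ i<′ → cong₂ _+_ (inv (<⇒≤ i<′))
        (trans (cong₂ (λ a b → inp (a + b))
                 (trans (var≡ F′ 62 refl) (trans g62 (cong (λ z → |S| + |S| + z * n) (sym u≡))))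
                 (trans at-63 (sym (toℕ-fromℕ< i<))))
               (inp-adjacent u (fromℕ< i<)))
      step62 : ∀ {f} → Frame rowLoop (setVar 66 0 g) f → vars f 62 + vars f 0 ≡ |S| + |S| + suc j * n
      step62 F′ = trans (cong₂ _+_ (trans (var≡ F′ 62 refl) g62) (trans (var≡ F′ 0 refl) g0))
                        (next-row (|S| + |S|) j)
      tail : ∀ f → Frame rowLoop (setVar 66 0 g) f →
        ((i≤ : n ≤ n) → vars f 66 ≡ prefix (λ v → bit (adjacent u v)) n i≤) →
        Run (mark ▸ 62 := var 62 ⊞ var 0) f 0 (λ g′ → Outer (suc j) (bump 60 g′))
      tail f F′ sum = run-seq {p = mark} {t₁ = 0} {t₂ = 0} {Q = λ f′ → Reduced (_< suc j) (cells f′ 7)}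
          (run-if
            (λ ne → run z≤n (role , coded-f , settled , seen , λ {v} → extend role (λ z → z)
               (λ s → degree≢0 (λ d → ne (cong₂ _+_ (trans A-u (cong roleCode s)) (trans deg≡ d)))) {v}))
            (λ eq → run z≤n (discard settled u , recoded eq ,
               discard-settled settled (single-u eq) (isolated eq) ,
               (λ {a} {b} t e p q → seen t e (discard-back settled (single-u eq) (isolated eq) p (λ ()))
                                             (discard-back settled (single-u eq) (isolated eq) q (λ ()))) ,
               λ {v} → extend (discard settled u)
                 (λ p → discard-back settled (single-u eq) (isolated eq) p (λ ()))
                 (λ s → contradiction (trans (sym (discard-at settled (single-u eq) (isolated eq))) s) λ ()) {v})))
          (λ e F″ R → run z≤n
            (trans (cong₂ _+_ (var≡ F″ 62 refl) (var≡ F″ 0 refl)) (step62 F′) , R))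
        where
        coded-f : Coded (cells f 7) role
        coded-f v = trans (cong-app (cell≡ F′ 7 refl) (toℕ v)) (coded v)
        f60 : vars f 60 ≡ toℕ u
        f60 = trans (var≡ F′ 60 refl) (trans at-60 (sym u≡))
        A-u : cells f 7 (vars f 60) ≡ roleCode (role u)
        A-u = trans (cong (cells f 7) f60) (coded-f u)
        deg≡ : vars f 66 ≡ degree u
        deg≡ = trans (sum ≤-refl) (prefix≡∑ (λ v → bit (adjacent u v)))
        single-u : cells f 7 (vars f 60) + vars f 66 ≡ 0 → role u ≡ single
        single-u eq = roleCode-single (role u) (trans (sym A-u) (m+n≡0⇒m≡0 _ eq))
        isolated : cells f 7 (vars f 60) + vars f 66 ≡ 0 → Isolated u
        isolated eq = degree≡0 (trans (sym deg≡) (m+n≡0⇒n≡0 (cells f 7 (vars f 60)) eq))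
        extend : ∀ role′ → (∀ {v} → role′ v ≡ single → role v ≡ single) →
          (role′ u ≡ single → ∃[ x ] adjacent u x ≡ true) →
          ∀ {v} → toℕ v < suc j → role′ v ≡ single → ∃[ x ] adjacent v x ≡ true
        extend role′ old new {v} v< s with m≤n⇒m<n∨m≡n (s≤s⁻¹ v<)
        ... | inj₁ lt = touched lt (old s)
        ... | inj₂ eq with toℕ-injective (trans eq (sym u≡))
        ...   | refl = new s
        recoded : cells f 7 (vars f 60) + vars f 66 ≡ 0 → Coded (cells f 7 [ vars f 60 ↦ 1 ]) (discard settled u)
        recoded eq v with v ≟ᶠ u
        ... | yes refl = trans (cong (cells f 7 [ vars f 60 ↦ 1 ]) (sym f60)) (upd-same (cells f 7) (vars f 60) 1)
        ... | no v≢u = trans (upd-other (cells f 7) 1 (λ z → v≢u (toℕ-injective (trans (sym z) f60)))) (coded-f v)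

  leaves : (Fin n → Role n) → Fin n → ℕ
  leaves role c = ∑ (λ v → bit (adjacent c v) * isSingle (role v))

  Starred : (Fin n → Role n) → ℕ → ℕ → ℕ → Set
  Starred role t j b = (b ≡ 0 × (∀ {c} → toℕ c < j → leaves role c ≤ 2 * t))
                       ⊎ (b ≡ 1 × (∃[ c ] 2 * t ≤ leaves role c))

  starring-run : ∀ h t role → vars h 0 ≡ n → vars h 2 ≡ t → vars h 3 ≡ |S| → Coded (cells h 7) role →
    Run starring h (n * suc (n * 1)) (λ g → Starred role t n (vars g 65))
  starring-run h t role at-0 at-2 at-3 coded = after (after (run-mono ≤-refl proj₂
      (run-for-const (n * 1) Outer refl at-0
        (trans (cong₂ _+_ at-3 at-3) (sym (+-identityʳ _)) , inj₁ (refl , λ ())) outer)))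
    where
    h₀ : Store
    h₀ = setVar 62 (vars h 3 + vars h 3) (setVar 65 0 h)
    Outer : ℕ → Store → Set
    Outer j g = vars g 62 ≡ |S| + |S| + j * n × Starred role t j (vars g 65)
    rowLoop mark : Command
    rowLoop = for 63 / 64 below var 0 loop starStep
    mark = ifnz (var 67 ⊞ con 1) ⊟ (var 2 ⊞ var 2) then (65 := con 1) else nop
    outer : ∀ j g → j < n → vars g 60 ≡ j → Frame (for 60 / 61 below var 0 loop starRow) h₀ g → Outer j g →
            Run starRow g (n * 1) (λ g′ → Outer (suc j) (bump 60 g′))
    outer j g j< at-60 F (g62 , starred) =
      after (run-mono (≤-reflexive (+-identityʳ _)) (λ z → z) (run-seq {t₂ = 0} (run-for-const 0
          (λ i f → (i≤ : i ≤ n) → vars f 67 ≡ prefix leaf i i≤) refl g0 (λ _ → refl) inner)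
        tail))
      where
      u : Fin n
      u = fromℕ< j<
      u≡ : toℕ u ≡ j
      u≡ = toℕ-fromℕ< j<
      leaf : Fin n → ℕ
      leaf v = bit (adjacent u v) * isSingle (role v)
      g0 : vars g 0 ≡ n
      g0 = trans (var≡ F 0 refl) at-0
      single-code : ∀ (r : Role n) → roleCode r ≡ 0 → isSingle r ≡ 1
      single-code single eq = refl
      other-code : ∀ (r : Role n) → roleCode r ≢ 0 → isSingle r ≡ 0
      other-code single    ne = contradiction refl ne
      other-code skip      ne = refl
      other-code (first _) ne = refl
      inner : ∀ i f → i < n → vars f 63 ≡ i → Frame rowLoop (setVar 67 0 g) f →
        ((i≤ : i ≤ n) → vars f 67 ≡ prefix leaf i i≤) →
        Run starStep f 0 (λ f′ → (i≤ : suc i ≤ n) → vars (bump 63 f′) 67 ≡ prefix leaf (suc i) i≤)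
      inner i f i< at-63 F′ inv = run-if
          (λ ne → run-if
            (λ ne′ → run z≤n (λ i<′ → zero-leaf i<′ (cong₂ (λ b s → bit b * s)
               (bit≢0 (λ z → ne (trans bit≡ z)))
               (other-code (role w) (λ z → ne′ (trans code≡ z))))))
            (λ eq → run z≤n (λ i<′ → cong₂ _+_ (inv (<⇒≤ i<′)) (sym (cong₂ (λ b s → bit b * s)
               (bit≢0 (λ z → ne (trans bit≡ z))) (single-code (role w) (trans (sym code≡) eq)))))))
          (λ eq → run z≤n (λ i<′ → zero-leaf i<′
             (cong (λ b → bit b * isSingle (role w)) (bit≡0 (trans (sym bit≡) eq)))))
        where
        w : Fin n
        w = fromℕ< i<
        f63 : vars f 63 ≡ toℕ w
        f63 = trans at-63 (sym (toℕ-fromℕ< i<))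
        bit≡ : inp (vars f 62 + vars f 63) ≡ bit (adjacent u w)
        bit≡ = trans (cong₂ (λ a b → inp (a + b))
                 (trans (var≡ F′ 62 refl) (trans g62 (cong (λ z → |S| + |S| + z * n) (sym u≡)))) f63)
                 (inp-adjacent u w)
        code≡ : cells f 7 (vars f 63) ≡ roleCode (role w)
        code≡ = trans (cong (cells f 7) f63) (trans (cong-app (trans (cell≡ F′ 7 refl) (cell≡ F 7 refl)) (toℕ w)) (coded w))
        zero-leaf : ∀ (i<′ : suc i ≤ n) → leaf w ≡ 0 → vars f 67 ≡ prefix leaf (suc i) i<′
        zero-leaf i<′ z = trans (inv (<⇒≤ i<′)) (trans (sym (+-identityʳ _)) (cong (prefix leaf i (<⇒≤ i<′) +_) (sym z)))
      step62 : ∀ {f} → Frame rowLoop (setVar 67 0 g) f → vars f 62 + vars f 0 ≡ |S| + |S| + suc j * n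
      step62 F′ = trans (cong₂ _+_ (trans (var≡ F′ 62 refl) g62) (trans (var≡ F′ 0 refl) g0))
                        (next-row (|S| + |S|) j)
      tail : ∀ f → Frame rowLoop (setVar 67 0 g) f → ((i≤ : n ≤ n) → vars f 67 ≡ prefix leaf n i≤) →
        Run (mark ▸ 62 := var 62 ⊞ var 0) f 0 (λ g′ → Outer (suc j) (bump 60 g′))
      tail f F′ sum = run-seq {p = mark} {t₁ = 0} {t₂ = 0} {Q = λ f′ → Starred role t (suc j) (vars f′ 65)}
          (run-if
            (λ ne → run z≤n (inj₂ (refl , u , many ne)))
            (λ eq → run z≤n (few (≤-trans (≤-reflexive (sym count≡)) (≤-trans (m≤m+n _ 1) (≤-trans (m∸n≡0⇒m≤n eq) (≤-reflexive 2t≡))))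
                                 (subst (Starred role t j) (sym (var≡ F′ 65 refl)) starred))))
          (λ e F″ R → run z≤n (trans (cong₂ _+_ (var≡ F″ 62 refl) (var≡ F″ 0 refl)) (step62 F′) , R))
        where
        count≡ : vars f 67 ≡ leaves role u
        count≡ = trans (sum ≤-refl) (prefix≡∑ leaf)
        2t≡ : vars f 2 + vars f 2 ≡ 2 * t
        2t≡ = cong₂ _+_ f2 (trans f2 (sym (+-identityʳ t)))
          where
          f2 : vars f 2 ≡ t
          f2 = trans (var≡ F′ 2 refl) (trans (var≡ F 2 refl) at-2)
        many : (vars f 67 + 1) ∸ (vars f 2 + vars f 2) ≢ 0 → 2 * t ≤ leaves role u
        many ne = subst₂ _≤_ 2t≡ count≡ (s≤s⁻¹ (subst (vars f 2 + vars f 2 <_) (+-comm (vars f 67) 1)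
                    (≰⇒> (λ le → ne (m≤n⇒m∸n≡0 le)))))
        few : leaves role u ≤ 2 * t → Starred role t j (vars f 65) → Starred role t (suc j) (vars f 65)
        few le (inj₂ star) = inj₂ star
        few le (inj₁ (z , old)) = inj₁ (z , new)
          where
          new : ∀ {c} → toℕ c < suc j → leaves role c ≤ 2 * t
          new {c} c< with m≤n⇒m<n∨m≡n (s≤s⁻¹ c<)
          ... | inj₁ lt = old lt
          ... | inj₂ eq with toℕ-injective (trans eq (sym u≡))
          ...   | refl = le

  -- Every single vertex is a neighbour of an end of some matching edge.
  single-count : ∀ {role t} → Settled role → Seen (λ _ _ → ⊤) role →
    (∀ {u} → role u ≡ single → ∃[ v ] adjacent u v ≡ true) → (∀ c → leaves role c ≤ 2 * t) →
    ∑ (isSingle ∘ role) ≤ 4 * (∑ (isFirst ∘ role) * t)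
  single-count {role} {t} settled seen touched few = begin
    ∑ (isSingle ∘ role)                       ≤⟨ ∑-mono covered ⟩
    ∑ (λ v → ∑ (λ u → share u (role u) v))    ≡⟨ ∑-comm +-0-commutativeMonoid (λ v u → share u (role u) v) ⟩
    ∑ (λ u → ∑ (λ v → share u (role u) v))    ≤⟨ ∑-mono (λ u → total u (role u)) ⟩
    ∑ (λ u → isFirst (role u) * (4 * t))      ≡⟨ ∑-scale (4 * t) (isFirst ∘ role) ⟩
    ∑ (isFirst ∘ role) * (4 * t)              ≡⟨ ring (∑ (isFirst ∘ role)) t ⟩
    4 * (∑ (isFirst ∘ role) * t)              ∎
    where
    open ≤-Reasoning
    open Settled settled
    ring : ∀ m t → m * (4 * t) ≡ 4 * (m * t)
    ring = solve-∀
    leaf : Fin n → Fin n → ℕ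
    leaf c v = bit (adjacent c v) * isSingle (role v)
    -- A pair is charged at its `first` vertex with the single neighbours of both ends, at most 2 t
    -- each, hence the 4 t per pair. A single vertex is charged at least once: its neighbour is not
    -- single by maximality and not discarded, so it is an end of a pair.
    share : Fin n → Role n → Fin n → ℕ
    share u single    v = 0
    share u skip      v = 0
    share u (first w) v = leaf u v + leaf w v
    total : ∀ u r → ∑ (share u r) ≤ isFirst r * (4 * t)
    total u single    = ≤-reflexive (∑-zero {n} _ (λ _ → refl))
    total u skip      = ≤-reflexive (∑-zero {n} _ (λ _ → refl))
    total u (first w) = ≤-trans (≤-reflexive (∑-distrib-+ +-0-commutativeMonoid (leaf u) (leaf w)))
      (≤-trans (+-mono-≤ (few u) (few w)) (≤-reflexive (ring′ t)))
      where
      ring′ : ∀ t → 2 * t + 2 * t ≡ 1 * (4 * t)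
      ring′ = solve-∀
    leaf≡ : ∀ {c v} → adjacent v c ≡ true → role v ≡ single → leaf c v ≡ 1
    leaf≡ {c} {v} e s = cong₂ (λ b r → bit b * isSingle r) (trans (symmetric c v) e) s
    covered : ∀ v → isSingle (role v) ≤ ∑ (λ u → share u (role u) v)
    covered v with role v in s
    ... | skip    = z≤n
    ... | first _ = z≤n
    ... | single with touched s
    ...   | c , e with role c in r
    ...     | single = contradiction r (λ r → seen tt e s r)
    ...     | first w = ≤-trans one (∑-term (λ u → share u (role u) v) c)
      where
      one : 1 ≤ share c (role c) v
      one rewrite r = ≤-trans (≤-reflexive (sym (leaf≡ e s))) (m≤m+n _ _)
    ...     | skip with partner r
    ...       | inj₂ iso with () ← trans (sym e) (trans (symmetric v c) (iso v))
    covered v | single | c , e | skip | inj₁ (u , ru) = ≤-trans one (∑-term (λ u → share u (role u) v) u)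
      where
      one : 1 ≤ share u (role u) v
      one rewrite ru = ≤-trans (≤-reflexive (sym (leaf≡ e s))) (m≤n+m _ _)

  role-count : ∀ (role : Fin n → Role n) →
    ∑ (isSingle ∘ role) + ∑ (isFirst ∘ role) + ∑ (isSkip ∘ role) ≡ n
  role-count role = trans (cong (_+ ∑ (isSkip ∘ role)) (sym (∑-distrib-+ +-0-commutativeMonoid (isSingle ∘ role) _)))
    (trans (sym (∑-distrib-+ +-0-commutativeMonoid (λ v → isSingle (role v) + isFirst (role v)) _))
      (trans (∑-cong one) (∑-one n)))
    where
    one : ∀ v → isSingle (role v) + isFirst (role v) + isSkip (role v) ≡ 1
    one v with role v
    ... | single  = refl
    ... | skip    = refl
    ... | first _ = refl

-- One colour and a vertex with many independent neighbours

starAnswer : Command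
starAnswer =
  68 := con 0 ▸
  69 := con 0 ▸
  8 := con 0 ▸
  (for 71 / 72 below var 3 loop
    -- After the loop, register 69 still holds the height of the last stack.
    (69 := input (var 8 ⊞ con 1) ▸
     (ifnz var 2 ⊟ var 69 then (68 := var 68 ⊞ var 69) else nop) ▸
     8 := var 8 ⊞ con 2)) ▸
  (ifnz (var 68 ⊞ con 1) ⊟ var 2 then (0 := con 1)
    else (ifnz (var 69 ⊞ con 1) ⊟ var 2 then (0 := con 1) else (0 := con 0)))

∑-search : ∀ {n} (f : Fin n → ℕ) → 0 < ∑ f → ∃[ v ] 0 < f v
∑-search {zero} f ()
∑-search {suc n} f lt with f zero in eq
... | suc m = zero , subst (0 <_) (sym eq) (s≤s z≤n)
... | zero with ∑-search (f ∘ suc) lt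
...   | v , pos = suc v , pos

height-pos : ∀ {k} (s : Stack k) → 0 < height s
height-pos (stack _ h) = >-nonZero⁻¹ h

module Heights {k : ℕ} (t : ℕ) where

  -- A stack of height `t` vanishes wherever it is placed and leaves nothing behind for later
  -- merges, so only lower stacks count.
  part : ℕ → ℕ
  part h = choose (t ∸ h) h 0

  part-low : ∀ {h} → h < t → part h ≡ h
  part-low {h} h<t with t ∸ h in eq
  ... | zero  = contradiction (m∸n≡0⇒m≤n eq) (<⇒≱ h<t)
  ... | suc _ = refl

  part-full : ∀ {h} → t ≤ h → part h ≡ 0
  part-full {h} t≤h rewrite m≤n⇒m∸n≡0 t≤h = refl

  part≤ : ∀ h → part h ≤ h
  part≤ h with t ∸ h
  ... | zero  = z≤n
  ... | suc _ = ≤-refl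

  partial : List (Stack k) → ℕ
  partial []      = 0
  partial (s ∷ S) = part (height s) + partial S

  lastHeight : List (Stack k) → ℕ
  lastHeight []            = 0
  lastHeight (s ∷ [])      = height s
  lastHeight (s ∷ S@(_ ∷ _)) = lastHeight S

  partial-snoc : ∀ S s → partial (S ++ [ s ]) ≡ partial S + part (height s)
  partial-snoc []      s = +-identityʳ _
  partial-snoc (r ∷ S) s = trans (cong (part (height r) +_) (partial-snoc S s)) (sym (+-assoc (part (height r)) _ _))

  lastHeight-snoc : ∀ S s → lastHeight (S ++ [ s ]) ≡ height s
  lastHeight-snoc []            s = refl
  lastHeight-snoc (r ∷ [])      s = refl
  lastHeight-snoc (r ∷ S@(_ ∷ _)) s = lastHeight-snoc S s

module Clearing {n k : ℕ} (G : Graph n) (t : ℕ) where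
  open Graph G
  open Board {n} {k} G t public
  open Heights {k} t public

  Clears : Conf → List (Stack k) → Set
  Clears = Wins (λ δ → ∀ v → δ v ≡ nothing)

  mass : Conf → ℕ
  mass δ = ∑ (hostedHeight ∘ δ)

  unmerged : Conf → Fin k → Fin n → Fin n → ℕ
  unmerged δ c x v = if merges G t δ c x v then 0 else hostedHeight (δ v)

  mass-split : ∀ δ c x → mass δ ≡ ∑ (gain δ c x) + ∑ (unmerged δ c x)
  mass-split δ c x = trans (∑-cong each) (∑-distrib-+ +-0-commutativeMonoid (gain δ c x) (unmerged δ c x))
    where
    each : ∀ v → hostedHeight (δ v) ≡ gain δ c x v + unmerged δ c x v
    each v with merges G t δ c x v
    ... | true  = sym (+-identityʳ _)
    ... | false = refl

  gain≤mass : ∀ δ c x → ∑ (gain δ c x) ≤ mass δ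
  gain≤mass δ c x = ≤-trans (m≤m+n _ _) (≤-reflexive (sym (mass-split δ c x)))

  -- Merging preserves the total height and vanishing lowers it. If the merged stack stays, the
  -- placed one is lower than `t`, so `part` counts it in full.
  mass-place : ∀ δ s x → δ x ≡ nothing → mass (place G t δ s x) ≤ mass δ + part (height s)
  mass-place δ s x empty = ≤-trans (≤-reflexive split) (finish (placed-cases s H))
    where
    c : Fin k
    c = colour s
    H : ℕ
    H = mergedHeight G t δ c x
    U : ℕ
    U = ∑ (unmerged δ c x)
    split : mass (place G t δ s x) ≡ U + hostedHeight (placed s H)
    split = trans (∑-update (unmerged δ c x) (hostedHeight ∘ place G t δ s x) x
        (trans (cong (λ b → if b then 0 else hostedHeight (δ x)) (merges-nothing {δ = δ} c x empty))
               (cong hostedHeight empty))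
        (λ v ne → trans (cong hostedHeight (place-off δ s x v ne)) (off v)))
      (cong (λ m → U + hostedHeight m) (place-at δ s x))
      where
      off : ∀ v → hostedHeight (if merges G t δ c x v then nothing else δ v) ≡ unmerged δ c x v
      off v with merges G t δ c x v
      ... | true  = refl
      ... | false = refl
    U≤ : U ≤ mass δ
    U≤ = ≤-trans (m≤n+m U _) (≤-reflexive (sym (mass-split δ c x)))
    finish : (t ≤ height s + H × placed s H ≡ nothing) ⊎
             (height s + H < t × placed s H ≡ just (raise s H)) →
             U + hostedHeight (placed s H) ≤ mass δ + part (height s)
    finish (inj₁ (_ , eq)) rewrite eq = +-mono-≤ U≤ z≤n
    finish (inj₂ (lt , eq)) rewrite eq | part-low (≤-trans (s≤s (m≤m+n (height s) H)) lt) = ≤-reflexive (begin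
      U + (height s + H)                 ≡⟨ cong (λ z → U + (height s + z)) (mergedHeight≡ δ c x) ⟩
      U + (height s + ∑ (gain δ c x))    ≡⟨ ring U (height s) _ ⟩
      ∑ (gain δ c x) + U + height s      ≡⟨ cong (_+ height s) (mass-split δ c x) ⟨
      mass δ + height s                  ∎)
      where
      open ≡-Reasoning
      ring : ∀ a b c → a + (b + c) ≡ c + a + b
      ring = solve-∀

  -- All depends on the last placement, whose merged stack must vanish and so reaches `t`. Either
  -- the last stack does so alone, or it is a lower one that needs the mass on the board, which only
  -- stacks below `t` can have supplied.
  clears⇒enough : ∀ δ s S → Clears δ (s ∷ S) →
    t ≤ mass δ + partial (s ∷ S) ⊎ t ≤ lastHeight (s ∷ S)
  clears⇒enough δ s [] (ε , move x empty done , goal) =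
      decide (placed-cases s H)
    where
    H : ℕ
    H = mergedHeight G t δ (colour s) x
    decide : (t ≤ height s + H × placed s H ≡ nothing) ⊎
             (height s + H < t × placed s H ≡ just (raise s H)) →
             t ≤ mass δ + (part (height s) + 0) ⊎ t ≤ height s
    decide (inj₂ (_ , eq)) = contradiction (trans (sym (place-at δ s x)) (goal x)) (just≢nothing eq)
    decide (inj₁ (t≤ , _)) with t ≤? height s
    ... | yes t≤h = inj₂ t≤h
    ... | no t≰h = inj₁ (≤-trans t≤ (begin
      height s + H                   ≡⟨ +-comm (height s) H ⟩
      H + height s                   ≤⟨ +-monoˡ-≤ (height s) (≤-trans (≤-reflexive (mergedHeight≡ δ (colour s) x)) (gain≤mass δ (colour s) x)) ⟩
      mass δ + height s              ≡⟨ cong (mass δ +_) (sym (trans (+-identityʳ _) (part-low (≰⇒> t≰h)))) ⟩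
      mass δ + (part (height s) + 0) ∎))
      where open ≤-Reasoning
  clears⇒enough δ s (r ∷ S) (ε , move x empty play , goal)
    with clears⇒enough (place G t δ s x) r S (ε , play , goal)
  ... | inj₂ last = inj₂ last
  ... | inj₁ le = inj₁ (≤-trans le (≤-trans (+-monoˡ-≤ (partial (r ∷ S)) (mass-place δ s x empty))
                                            (≤-reflexive (+-assoc (mass δ) (part (height s)) _))))

emptiness : ∀ {k} → Maybe (Stack k) → ℕ
emptiness nothing  = 1
emptiness (just _) = 0

module OneColour {n : ℕ} (G : Graph n) (t : ℕ) where
  open Graph G
  open Board {n} {1} G t

  hosts-one : ∀ c s → hosts {1} c (just s) ≡ true
  hosts-one zero (stack zero _) = refl

  merges-one : ∀ (δ : Conf) c x {v s} → δ v ≡ just s → merges G t δ c x v ≡ adjacent x v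
  merges-one δ c x {v} {s} eq rewrite eq | hosts-one c s with adjacent x v
  ... | true  = refl
  ... | false = refl

  -- With one colour, a placement always merges with every filled neighbour. This keeps the ends of
  -- an edge from both being filled, and lets them take turns for ever.
  absorbed : ∀ (δ : Conf) s {u w} → adjacent u w ≡ true → place G t δ s u w ≡ nothing
  absorbed δ s {u} {w} e = trans (place-off δ s u w w≢u) cleared
    where
    w≢u : w ≢ u
    w≢u refl with () ← trans (sym e) (irreflexive w)
    cleared : (if merges G t δ (colour s) u w then nothing else δ w) ≡ nothing
    cleared with δ w in eq
    ... | nothing = if-same (adjacent u w ∧ false)
    ... | just z rewrite hosts-one (colour s) z | e = refl

-- Stacks are collected on the leaves; a placement on the centre wipes them out.
-- It is made as soon as it makes stacks vanish and the remaining stacks can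
-- still clear an empty board by themselves, and with the last stack.
module Star {n : ℕ} (G : Graph n) (t : ℕ) (0<t : 0 < t) (centre : Fin n) (Leaf : Fin n → Bool)
  (leaf-adjacent : ∀ {v} → Leaf v ≡ true → Graph.adjacent G centre v ≡ true)
  (leaf-independent : ∀ {u v} → Leaf u ≡ true → Leaf v ≡ true → Graph.adjacent G u v ≡ false)
  (enough-leaves : 2 * t ≤ ∑ (λ v → if Leaf v then 1 else 0)) where
  open Graph G
  open Clearing {n} {1} G t

  free : Conf → Fin n → ℕ
  free δ v = if Leaf v then emptiness (δ v) else 0

  heap : Conf → ℕ
  heap δ = ∑ (gain δ zero centre)

  centre-not-leaf : Leaf centre ≢ true
  centre-not-leaf eq with () ← trans (sym (leaf-adjacent eq)) (irreflexive centre)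

  OnLeaves : Conf → Set
  OnLeaves δ = ∀ v → δ v ≢ nothing → Leaf v ≡ true

  Enough : Conf → List (Stack 1) → Set
  Enough δ S = t ≤ heap δ + partial S ⊎ t ≤ lastHeight S

  -- `room` persists because a collected stack takes one leaf and adds at least 1 to the heap.
  -- Hence, while the heap is below `t`, more than `t` leaves are free. Once it is not, stacks are
  -- collected only if the later ones sum up to less than `t`, and each that stays lowers this sum
  -- by at least 1. The inequalities of `reserve` are strict so that a leaf is free also for a stack
  -- of height `t`, which vanishes on it.
  record Collected (δ : Conf) (S : List (Stack 1)) : Set where
    field
      on-leaves : OnLeaves δ
      room      : 2 * t ≤ ∑ (free δ) + heap δ
      reserve   : t < ∑ (free δ) ⊎ partial S < ∑ (free δ)
      enough    : Enough δ S

  open Collected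

  colour≡ : ∀ (s : Stack 1) → colour s ≡ zero
  colour≡ (stack zero _) = refl

  wiped : ∀ δ s → OnLeaves δ → t ≤ height s + heap δ → ∀ v → place G t δ s centre v ≡ nothing
  wiped δ s on t≤ v = by (v ≟ᶠ centre)
    where
    H≡ : mergedHeight G t δ (colour s) centre ≡ heap δ
    H≡ = trans (mergedHeight≡ δ (colour s) centre) (cong (λ c → ∑ (gain δ c centre)) (colour≡ s))
    by : Dec (v ≡ centre) → place G t δ s centre v ≡ nothing
    by (yes refl) = trans (place-at δ s v) (at (placed-cases s (mergedHeight G t δ (colour s) v)))
      where
      at : (t ≤ height s + mergedHeight G t δ (colour s) v × placed s (mergedHeight G t δ (colour s) v) ≡ nothing) ⊎
           (height s + mergedHeight G t δ (colour s) v < t × _) → placed s (mergedHeight G t δ (colour s) v) ≡ nothing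
      at (inj₁ (_ , eq)) = eq
      at (inj₂ (lt , _)) = contradiction (subst (λ z → t ≤ height s + z) (sym H≡) t≤) (<⇒≱ lt)
    by (no v≢c) = off (δ v) refl
      where
      off : ∀ m → δ v ≡ m → place G t δ s centre v ≡ nothing
      off nothing  eq = place-nothing δ s centre v≢c eq
      off (just _) eq = OneColour.absorbed G t δ s (leaf-adjacent (on v (just≢nothing eq)))

  centre-empty : ∀ {δ} → OnLeaves δ → δ centre ≡ nothing
  centre-empty {δ} on with δ centre in eq
  ... | nothing = refl
  ... | just _  = contradiction (on centre (just≢nothing eq)) centre-not-leaf

  unmergedᴸ : ∀ δ s {ℓ} → OnLeaves δ → Leaf ℓ ≡ true → ∀ v → merges G t δ (colour s) ℓ v ≡ false
  unmergedᴸ δ s {ℓ} on leaf v with δ v in eq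
  ... | nothing = merges-false (adjacent ℓ v)
    where
    merges-false : ∀ b → b ∧ false ≡ false
    merges-false true  = refl
    merges-false false = refl
  ... | just z rewrite leaf-independent leaf (on v (just≢nothing eq)) = refl

  merged-zero : ∀ δ s {ℓ} → OnLeaves δ → Leaf ℓ ≡ true → mergedHeight G t δ (colour s) ℓ ≡ 0
  merged-zero δ s {ℓ} on leaf = trans (mergedHeight≡ δ (colour s) ℓ)
    (∑-zero _ (λ v → cong (λ b → if b then hostedHeight (δ v) else 0) (unmergedᴸ δ s on leaf v)))

  place-leaf-off : ∀ δ s {ℓ} → OnLeaves δ → Leaf ℓ ≡ true → ∀ v → v ≢ ℓ → place G t δ s ℓ v ≡ δ v
  place-leaf-off δ s {ℓ} on leaf v ne = trans (place-off δ s ℓ v ne)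
    (cong (λ b → if b then nothing else δ v) (unmergedᴸ δ s on leaf v))

  free-cong : ∀ {δ ε} → δ ≗ᶜ ε → ∑ (free δ) ≡ ∑ (free ε)
  free-cong eq = ∑-cong (λ v → cong (λ m → if Leaf v then emptiness m else 0) (eq v))

  collected-cong : ∀ {δ ε S} → δ ≗ᶜ ε → Collected δ S → Collected ε S
  collected-cong {δ} {ε} {S} eq C = record
    { on-leaves = λ v ne → on-leaves C v (λ z → ne (trans (sym (eq v)) z))
    ; room      = subst₂ (λ a b → 2 * t ≤ a + b) f≡ h≡ (room C)
    ; reserve   = subst (λ a → t < a ⊎ partial S < a) f≡ (reserve C)
    ; enough    = subst (λ a → t ≤ a + partial S ⊎ t ≤ lastHeight S) h≡ (enough C) }
    where
    f≡ : ∑ (free δ) ≡ ∑ (free ε)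
    f≡ = free-cong eq
    h≡ : heap δ ≡ heap ε
    h≡ = ∑-cong (gain-cong eq zero centre)

  t<2t : t < 2 * t
  t<2t = ≤-trans (+-monoˡ-≤ t 0<t) (≤-reflexive (cong (t +_) (sym (+-identityʳ t))))

  collected-empty : ∀ {S} → t ≤ partial S ⊎ t ≤ lastHeight S → Collected allEmpty S
  collected-empty {S} suff = record
    { on-leaves = λ v ne → contradiction refl ne
    ; room      = ≤-trans enough-leaves (m≤m+n _ _)
    ; reserve   = inj₁ (≤-trans t<2t enough-leaves)
    ; enough    = enlarge suff }
    where
    enlarge : t ≤ partial S ⊎ t ≤ lastHeight S → Enough allEmpty S
    enlarge (inj₁ le) = inj₁ (≤-trans le (m≤n+m _ (heap allEmpty)))
    enlarge (inj₂ le) = inj₂ le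

  collected⇒clears : ∀ δ s S → Collected δ (s ∷ S) → Clears δ (s ∷ S)
  -- With no stacks to follow, either case of `enough` says that a placement on the centre reaches
  -- `t`.
  collected⇒clears δ s [] C =
      _ , move centre (centre-empty (on-leaves C)) done , wiped δ s (on-leaves C) (total (enough C))
    where
    total : Enough δ (s ∷ []) → t ≤ height s + heap δ
    total (inj₂ le) = ≤-trans le (m≤m+n _ _)
    total (inj₁ le) = ≤-trans le (≤-trans (+-monoʳ-≤ (heap δ) (≤-trans (≤-reflexive (+-identityʳ _)) (part≤ (height s))))
                                          (≤-reflexive (+-comm (heap δ) _)))
  collected⇒clears δ s S@(r ∷ S′) C = decide (t ≤? partial S) (t ≤? lastHeight S) (t ≤? height s + heap δ)
    where
    on : OnLeaves δ
    on = on-leaves C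
    at-centre : t ≤ partial S ⊎ t ≤ lastHeight S → t ≤ height s + heap δ → Clears δ (s ∷ S)
    at-centre suff t≤ with collected⇒clears (place G t δ s centre) r S′
        (collected-cong (λ v → sym (wiped δ s on t≤ v)) (collected-empty suff))
    ... | ε , play , goal = ε , move centre (centre-empty on) play , goal
    some-leaf : ∃[ ℓ ] Leaf ℓ ≡ true × δ ℓ ≡ nothing
    some-leaf with ∑-search (free δ) (positive (reserve C))
      where
      positive : t < ∑ (free δ) ⊎ partial (s ∷ S) < ∑ (free δ) → 0 < ∑ (free δ)
      positive (inj₁ lt) = ≤-trans (s≤s z≤n) lt
      positive (inj₂ lt) = ≤-trans (s≤s z≤n) lt
    ... | ℓ , pos with Leaf ℓ in leaf | δ ℓ in empty
    ...   | true | nothing = ℓ , leaf , empty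
    at-leaf : (t ≤ height s + heap δ → partial S < t) → Clears δ (s ∷ S)
    at-leaf tail with some-leaf
    ... | ℓ , leaf , empty with collected⇒clears (place G t δ s ℓ) r S′ next
      where
      off : ∀ v → v ≢ ℓ → place G t δ s ℓ v ≡ δ v
      off = place-leaf-off δ s on leaf
      at : place G t δ s ℓ ℓ ≡ placed s 0
      at = trans (place-at δ s ℓ) (cong (placed s) (merged-zero δ s on leaf))
      next : Collected (place G t δ s ℓ) S
      next with placed-cases s 0
      -- A stack of height `t` passes through a leaf without a trace: it has no filled neighbour
      -- there and vanishes alone, so the board and the sum of the low stacks stay the same.
      ... | inj₁ (t≤ , vanish) = collected-cong same record
          { on-leaves = on ; room = room C
          ; reserve = subst (λ z → t < ∑ (free δ) ⊎ z < ∑ (free δ)) partial≡ (reserve C)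
          ; enough = subst (λ z → t ≤ heap δ + z ⊎ t ≤ lastHeight S) partial≡ (enough C) }
        where
        partial≡ : partial (s ∷ S) ≡ partial S
        partial≡ = cong (_+ partial S) (part-full (subst (t ≤_) (+-identityʳ _) t≤))
        same : δ ≗ᶜ place G t δ s ℓ
        same v with v ≟ᶠ ℓ
        ... | yes refl = trans empty (sym (trans (cong (placed s) (merged-zero δ s on leaf)) vanish))
        ... | no _ rewrite unmergedᴸ δ s on leaf v = refl
      ... | inj₂ (lt , stays) = record
          { on-leaves = on′ ; room = room′ ; reserve = reserve′ ; enough = enough′ }
        where
        ε : Conf
        ε = place G t δ s ℓ
        h : ℕ
        h = height s
        h<t : h < t
        h<t = subst (_< t) (+-identityʳ h) lt
        0<h : 0 < h
        0<h = height-pos s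
        ε-ℓ : ε ℓ ≡ just (raise s 0)
        ε-ℓ = trans at stays
        on′ : OnLeaves ε
        on′ v ne with v ≟ᶠ ℓ
        ... | yes refl = leaf
        ... | no _ rewrite unmergedᴸ δ s on leaf v = on v ne
        free≡ : ∑ (free δ) ≡ ∑ (free ε) + 1
        free≡ = trans (∑-update (free ε) (free δ) ℓ free-ℓ
                  (λ v ne → cong (λ m → if Leaf v then emptiness m else 0) (sym (off v ne))))
                (cong (∑ (free ε) +_) (cong₂ (λ b m → if b then emptiness m else 0) leaf empty))
          where
          free-ℓ : free ε ℓ ≡ 0
          free-ℓ = cong₂ (λ b m → if b then emptiness m else 0) leaf ε-ℓ
        heap≡ : heap ε ≡ heap δ + h
        heap≡ = trans (∑-update (gain δ zero centre) (gain ε zero centre) ℓ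
                   (cong (λ b → if b then hostedHeight (δ ℓ) else 0) (merges-nothing {δ = δ} zero centre empty))
                   (λ v ne → cong (λ m → if adjacent centre v ∧ hosts zero m then hostedHeight m else 0) (off v ne)))
                 (cong (heap δ +_) (trans (cong₂ (λ b m → if b then hostedHeight m else 0)
                    (trans (OneColour.merges-one G t ε zero centre ε-ℓ) (leaf-adjacent leaf)) ε-ℓ) (+-identityʳ h)))
        partial≡ : partial (s ∷ S) ≡ h + partial S
        partial≡ = cong (_+ partial S) (part-low h<t)
        room′ : 2 * t ≤ ∑ (free ε) + heap ε
        room′ = begin
          2 * t                            ≤⟨ room C ⟩
          ∑ (free δ) + heap δ              ≡⟨ cong (_+ heap δ) free≡ ⟩
          ∑ (free ε) + 1 + heap δ          ≤⟨ +-monoˡ-≤ (heap δ) (+-monoʳ-≤ (∑ (free ε)) 0<h) ⟩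
          ∑ (free ε) + h + heap δ          ≡⟨ trans (+-assoc (∑ (free ε)) h _) (cong (∑ (free ε) +_) (+-comm h _)) ⟩
          ∑ (free ε) + (heap δ + h)        ≡⟨ cong (∑ (free ε) +_) heap≡ ⟨
          ∑ (free ε) + heap ε              ∎
          where open ≤-Reasoning
        reserve′ : t < ∑ (free ε) ⊎ partial S < ∑ (free ε)
        -- Below `t` on the heap, `room` forces more than `t` free leaves. Otherwise `tail` bounds
        -- the stacks to come by the leaves that are left.
        reserve′ with t ≤? h + heap δ
        ... | no small = inj₁ (+-cancelʳ-< (heap ε) t (∑ (free ε)) (begin-strict
            t + heap ε           ≡⟨ cong (t +_) (trans heap≡ (+-comm (heap δ) h)) ⟩
            t + (h + heap δ)     <⟨ +-monoʳ-< t (≰⇒> small) ⟩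
            t + t                ≡⟨ cong (t +_) (+-identityʳ t) ⟨
            2 * t                ≤⟨ room′ ⟩
            ∑ (free ε) + heap ε  ∎))
          where open ≤-Reasoning
        ... | yes large = inj₂ (by (reserve C))
          where
          by : t < ∑ (free δ) ⊎ partial (s ∷ S) < ∑ (free δ) → partial S < ∑ (free ε)
          by (inj₁ lt) = ≤-trans (tail large) (s≤s⁻¹ (≤-trans lt (≤-reflexive (trans free≡ (+-comm _ 1)))))
          by (inj₂ lt) = s≤s⁻¹ (≤-trans (s≤s (≤-trans (+-monoˡ-≤ (partial S) 0<h) (≤-reflexive (sym partial≡))))
                               (≤-trans lt (≤-reflexive (trans free≡ (+-comm _ 1)))))
        enough′ : Enough ε S
        enough′ with enough C
        ... | inj₂ le = inj₂ le
        ... | inj₁ le = inj₁ (≤-trans le (≤-reflexive (trans (cong (heap δ +_) partial≡)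
                          (trans (sym (+-assoc (heap δ) h _)) (cong (_+ partial S) (sym heap≡))))))
    ... | ε , play , goal = ε , move ℓ empty play , goal
    decide : Dec (t ≤ partial S) → Dec (t ≤ lastHeight S) → Dec (t ≤ height s + heap δ) → Clears δ (s ∷ S)
    decide (yes p) _       (yes q) = at-centre (inj₁ p) q
    decide _       (yes p) (yes q) = at-centre (inj₂ p) q
    -- The later stacks could not clear an empty board, so wiping out the heap now would be fatal;
    -- collecting goes on, and their sum below `t` limits the leaves required.
    decide (no p)  (no _)  _       = at-leaf (λ _ → ≰⇒> p)
    decide _       _       (no q)  = at-leaf (λ le → contradiction le q)

  sufficient : ∀ s S → t ≤ partial (s ∷ S) ⊎ t ≤ lastHeight (s ∷ S) → Clears allEmpty (s ∷ S)
  sufficient s S suff = collected⇒clears allEmpty s S (collected-empty suff)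

-- Fitting with one colour, and scans of the stacks

scanEdges greedyStep greedy fitOne : Command
scanEdges =
  73 := con 0 ▸
  62 := var 3 ⊞ var 3 ▸
  (for 60 / 61 below var 0 loop
    ((for 63 / 64 below var 0 loop (73 := var 73 ⊞ input (var 62 ⊞ var 63))) ▸
     62 := var 62 ⊞ var 0))
greedyStep =
  69 := input (var 8 ⊞ con 1) ▸
  (ifnz var 74
    then (ifnz var 2 ⊟ var 69 then (74 := var 74 ⊟ con 1) else nop)
    else (75 := con 1)) ▸
  8 := var 8 ⊞ con 2
greedy =
  74 := var 0 ▸
  75 := con 0 ▸
  8 := con 0 ▸
  (for 71 / 72 below var 3 loop greedyStep) ▸
  (ifnz var 75 then (0 := con 0) else (0 := con 1))
fitOne = scanEdges ▸ (ifnz var 73 then (0 := con 1) else greedy)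

module StackScan {k : ℕ} (inp : ℕ → ℕ) (S : List (Stack k))
  (inp-stack : ∀ pre s post → S ≡ pre ++ s ∷ post →
     inp (length pre + length pre) ≡ toℕ (colour s) × inp (length pre + length pre + 1) ≡ height s) where
  open Semantics inp

  double-suc : ∀ (pre : List (Stack k)) s → length pre + length pre + 2 ≡ length (pre ++ [ s ]) + length (pre ++ [ s ])
  double-suc pre s = trans (ring (length pre)) (cong (λ z → z + z) (sym (length-++ pre)))
    where
    ring : ∀ a → a + a + 2 ≡ a + 1 + (a + 1)
    ring = solve-∀

  -- A forward pass over the stacks with a body free of loop iterations. Register 8 is the read
  -- position, and the invariant is indexed by the prefix read so far, so that it can speak of a
  -- left fold.
  scan-run : ∀ {i l p h} (I : List (Stack k) → Store → Set) → separate i l p ≡ true →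
    vars h 3 ≡ length S → vars h 8 ≡ 0 → I [] (setVar i 0 (setVar l (length S) h)) →
    (i ≡ᵇ 8) ≡ false → (l ≡ᵇ 8) ≡ false →
    (∀ pre s post g → S ≡ pre ++ s ∷ post → Frame (for i / l below var 3 loop p) h g →
       vars g 8 ≡ length pre + length pre → I pre g →
       Run p g 0 (λ g′ → vars g′ 8 ≡ length pre + length pre + 2 × I (pre ++ [ s ]) (bump i g′))) →
    Run (for i / l below var 3 loop p) h (length S) (I S)
  scan-run {i} {l} {p} {h} I sep at-3 at-8 start i≢8 l≢8 body =
    run-mono (≤-reflexive (*-identityʳ _)) (λ {g} → finish {g})
      (run-for (λ j → j * 1) Inv sep at-3
        ([] , S , refl , refl , trans (upd-≡ᵇ (vars h [ l ↦ length S ]) i 8 0 i≢8)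
           (trans (upd-≡ᵇ (vars h) l 8 (length S) l≢8) at-8) , start) step)
    where
    Inv : ℕ → Store → Set
    Inv j g = ∃[ pre ] ∃[ post ] S ≡ pre ++ post × length pre ≡ j × vars g 8 ≡ length pre + length pre × I pre g
    finish : ∀ {g} → Inv (length S) g × _ → I S g
    finish {g} ((pre , [] , eq , len , _ , Ipre) , _) = subst (λ xs → I xs g) (trans (sym (++-identityʳ pre)) (sym eq)) Ipre
    finish ((pre , s ∷ post , eq , len , _) , _) = contradiction
      (trans len (trans (cong length eq) (length-++ pre)))
      (<⇒≢ (≤-trans (s≤s (m≤m+n (length pre) (length post))) (≤-reflexive (sym (+-suc (length pre) (length post))))))
    step : ∀ j g → j < length S → vars g i ≡ j → vars g l ≡ length S →
           Frame (for i / l below var 3 loop p) h g → Inv j g →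
           ∃[ T ] suc (T + j * 1) ≤ suc j * 1 × Run p g T (λ g′ → Inv (suc j) (bump i g′))
    step j g j< _ _ F (pre , [] , eq , len , _) = contradiction
      (trans (sym len) (cong length (trans (sym (++-identityʳ pre)) (sym eq)))) (<⇒≢ j<)
    step j g j< _ _ F (pre , s ∷ post , eq , len , g8 , Ipre) = 0 , ≤-refl ,
      run-mono ≤-refl (λ {g′} → next {g′}) (body pre s post g eq F g8 Ipre)
      where
      next : ∀ {g′} → vars g′ 8 ≡ length pre + length pre + 2 × I (pre ++ [ s ]) (bump i g′) → Inv (suc j) (bump i g′)
      next {g′} (g′8 , I′) = pre ++ [ s ] , post , trans eq (sym (++-assoc pre [ s ] post)) ,
        trans (length-++ pre) (trans (+-comm (length pre) 1) (cong suc len)) ,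
        trans (upd-≡ᵇ (vars g′) i 8 _ i≢8) (trans g′8 (double-suc pre s)) , I′

  module _ (t : ℕ) where
    open Heights {k} t

    starAnswer-run : ∀ h → vars h 2 ≡ t → vars h 3 ≡ length S →
      Run starAnswer h (length S) (λ g → Answers (t ≤ partial S ⊎ t ≤ lastHeight S) (vars g 0))
    starAnswer-run h at-2 at-3 = after (after (after (run-mono (≤-reflexive (+-identityʳ _)) (λ z → z)
        (run-seq {t₂ = 0} (scan-run I refl at-3 refl (refl , refl) refl refl body) conclude))))
      where
      I : List (Stack k) → Store → Set
      I pre g = vars g 68 ≡ partial pre × vars g 69 ≡ lastHeight pre
      h₃ : Store
      h₃ = setVar 8 0 (setVar 69 0 (setVar 68 0 h))
      stepᶜ split : Command
      split = ifnz var 2 ⊟ var 69 then (68 := var 68 ⊞ var 69) else nop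
      stepᶜ = 69 := input (var 8 ⊞ con 1) ▸ split ▸ 8 := var 8 ⊞ con 2
      body : ∀ pre s post g → S ≡ pre ++ s ∷ post → Frame (for 71 / 72 below var 3 loop stepᶜ) h₃ g →
        vars g 8 ≡ length pre + length pre → I pre g →
        Run stepᶜ g 0 (λ g′ → vars g′ 8 ≡ length pre + length pre + 2 × I (pre ++ [ s ]) (bump 71 g′))
      body pre s post g eq F g8 (g68 , g69) = after (run-seq {p = split} {t₁ = 0} {t₂ = 0}
          {Q = λ f → vars f 68 ≡ partial (pre ++ [ s ])}
          (run-if (λ ne → run z≤n (trans (cong₂ _+_ g68 (trans h≡ (sym (choose-pos (λ z → ne (trans test z))))))
                                        (sym (partial-snoc pre s))))
                  (λ z → run z≤n (trans g68 (sym (trans (partial-snoc pre s)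
                     (trans (cong (partial pre +_) (choose-zero (trans (sym test) z))) (+-identityʳ _)))))))
          (λ f F′ f68 → run z≤n (trans (cong (_+ 2) (var≡ F′ 8 refl)) (cong (_+ 2) g8) , f68 ,
             trans (var≡ F′ 69 refl) (trans h≡ (sym (lastHeight-snoc pre s))))))
        where
        h≡ : inp (vars g 8 + 1) ≡ height s
        h≡ = trans (cong (λ z → inp (z + 1)) g8) (proj₂ (inp-stack pre s post eq))
        test : vars g 2 ∸ inp (vars g 8 + 1) ≡ t ∸ height s
        test = cong₂ _∸_ (trans (var≡ F 2 refl) at-2) h≡
      conclude : ∀ g → Frame (for 71 / 72 below var 3 loop stepᶜ) h₃ g → I S g →
        Run (ifnz (var 68 ⊞ con 1) ⊟ var 2 then (0 := con 1)
              else (ifnz (var 69 ⊞ con 1) ⊟ var 2 then (0 := con 1) else (0 := con 0))) g 0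
            (λ g → Answers (t ≤ partial S ⊎ t ≤ lastHeight S) (vars g 0))
      conclude g F (g68 , g69) = run-if
          (λ ne → run z≤n (inj₁ (inj₁ (reached g68 ne) , refl)))
          (λ eq → run-if (λ ne → run z≤n (inj₁ (inj₂ (reached g69 ne) , refl)))
                         (λ eq′ → run z≤n (inj₂ ((λ where
                            (inj₁ le) → missed g68 eq le
                            (inj₂ le) → missed g69 eq′ le) , refl))))
        where
        g2 : vars g 2 ≡ t
        g2 = trans (var≡ F 2 refl) at-2
        reached : ∀ {x y} → x ≡ y → x + 1 ∸ vars g 2 ≢ 0 → t ≤ y
        reached {x} refl ne = s≤s⁻¹ (subst₂ _<_ g2 (+-comm x 1) (≰⇒> (λ le → ne (m≤n⇒m∸n≡0 le))))
        missed : ∀ {x y} → x ≡ y → x + 1 ∸ vars g 2 ≡ 0 → t ≤ y → ⊥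
        missed {x} refl eq le = <-irrefl refl (≤-trans (s≤s le) (subst₂ _≤_ (+-comm x 1) g2 (m∸n≡0⇒m≤n eq)))

    -- The number of empty vertices of an edgeless graph, and whether a stack
    -- met none.
    settle : ℕ × ℕ → Stack k → ℕ × ℕ
    settle (zero  , b) s = zero , 1
    settle (suc m , b) s = choose (t ∸ height s) m (suc m) , b

    greedy-run : ∀ h m → vars h 0 ≡ m → vars h 2 ≡ t → vars h 3 ≡ length S →
      Run greedy h (length S) (λ g → vars g 0 ≡ choose (proj₂ (foldl settle (m , 0) S)) 0 1)
    greedy-run h m at-0 at-2 at-3 = after (after (after (run-mono (≤-reflexive (+-identityʳ _)) (λ z → z)
        (run-seq {t₂ = 0} (scan-run I refl at-3 refl (at-0 , refl) refl refl body)
          (λ g F (g74 , g75) → run-if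
            (λ ne → run z≤n (trans (sym (choose-pos ne)) (cong (λ z → choose z 0 1) g75)))
            (λ eq → run z≤n (trans (sym (choose-zero eq)) (cong (λ z → choose z 0 1) g75))))))))
      where
      I : List (Stack k) → Store → Set
      I pre g = vars g 74 ≡ proj₁ (foldl settle (m , 0) pre) × vars g 75 ≡ proj₂ (foldl settle (m , 0) pre)
      h₃ : Store
      h₃ = setVar 8 0 (setVar 75 0 (setVar 74 (vars h 0) h))
      split : Command
      split = ifnz var 74 then (ifnz var 2 ⊟ var 69 then (74 := var 74 ⊟ con 1) else nop) else (75 := con 1)
      body : ∀ pre s post g → S ≡ pre ++ s ∷ post → Frame (for 71 / 72 below var 3 loop greedyStep) h₃ g →
        vars g 8 ≡ length pre + length pre → I pre g →
        Run greedyStep g 0 (λ g′ → vars g′ 8 ≡ length pre + length pre + 2 × I (pre ++ [ s ]) (bump 71 g′))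
      body pre s post g eq F g8 (g74 , g75) = after (run-seq {p = split} {t₁ = 0} {t₂ = 0}
          {Q = λ f → vars f 74 ≡ proj₁ next × vars f 75 ≡ proj₂ next}
          (run-if
            (λ ne → run-if
              (λ ne′ → run z≤n (on (vars g 74) (vars g 75) refl refl ne ne′))
              (λ z → run z≤n (off (vars g 74) (vars g 75) refl refl ne z)))
            (λ z → run z≤n (stuck z)))
          (λ f F′ (f74 , f75) → run z≤n (trans (cong (_+ 2) (var≡ F′ 8 refl)) (cong (_+ 2) g8) ,
             trans f74 (cong proj₁ (sym snoc)) , trans f75 (cong proj₂ (sym snoc)))))
        where
        next : ℕ × ℕ
        next = settle (vars g 74 , vars g 75) s
        snoc : foldl settle (m , 0) (pre ++ [ s ]) ≡ next
        snoc = trans (foldl-∷ʳ settle (m , 0) s pre) (cong₂ (λ a b → settle (a , b) s) (sym g74) (sym g75))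
        h≡ : inp (vars g 8 + 1) ≡ height s
        h≡ = trans (cong (λ z → inp (z + 1)) g8) (proj₂ (inp-stack pre s post eq))
        test : vars g 2 ∸ inp (vars g 8 + 1) ≡ t ∸ height s
        test = cong₂ _∸_ (trans (var≡ F 2 refl) at-2) h≡
        on : ∀ a b → vars g 74 ≡ a → vars g 75 ≡ b → a ≢ 0 → vars g 2 ∸ inp (vars g 8 + 1) ≢ 0 →
             a ∸ 1 ≡ proj₁ (settle (a , b) s) × b ≡ proj₂ (settle (a , b) s)
        on zero    b _ _ ne _ = contradiction refl ne
        on (suc a) b _ _ _ ne = sym (choose-pos (λ z → ne (trans test z))) , refl
        off : ∀ a b → vars g 74 ≡ a → vars g 75 ≡ b → a ≢ 0 → vars g 2 ∸ inp (vars g 8 + 1) ≡ 0 →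
             a ≡ proj₁ (settle (a , b) s) × b ≡ proj₂ (settle (a , b) s)
        off zero    b _ _ ne _ = contradiction refl ne
        off (suc a) b _ _ _ z = sym (choose-zero (trans (sym test) z)) , refl
        stuck : vars g 74 ≡ 0 → vars g 74 ≡ proj₁ next × 1 ≡ proj₂ next
        stuck z rewrite z = refl , refl

module FitOne {n : ℕ} (G : Graph n) (t : ℕ) (inp : ℕ → ℕ) (S : List (Stack 1))
  (inp-adjacent : ∀ u v → inp (length S + length S + toℕ u * n + toℕ v)
                          ≡ (if Graph.adjacent G u v then 1 else 0))
  (inp-stack : ∀ pre s post → S ≡ pre ++ s ∷ post →
     inp (length pre + length pre) ≡ toℕ (colour s) × inp (length pre + length pre + 1) ≡ height s) where
  open Graph G
  open Board {n} {1} G t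
  open Semantics inp
  open Pairs G inp (length S) inp-adjacent
  open StackScan {1} inp S inp-stack

  Fits : Conf → List (Stack 1) → Set
  Fits = Wins (λ _ → ⊤)

  -- The ends of the edge are used in turn: a placement on one empties the other for the next stack.
  edge⇒fits : ∀ a b → adjacent a b ≡ true → ∀ T δ → δ a ≡ nothing → Fits δ T
  edge⇒fits a b e []      δ empty = δ , done , tt
  edge⇒fits a b e (s ∷ T) δ empty
    with edge⇒fits b a (trans (symmetric b a) e) T (place G t δ s a) (OneColour.absorbed G t δ s e)
  ... | ε , play , _ = ε , move a empty play , tt

  vacant : Conf → ℕ
  vacant δ = ∑ (emptiness ∘ δ)

  module _ (edgeless : ∀ u → Isolated u) where

    apart : ∀ (δ : Conf) c x v → merges G t δ c x v ≡ false
    apart δ c x v rewrite edgeless x v = refl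

    alone : ∀ (δ : Conf) c x → mergedHeight G t δ c x ≡ 0
    alone δ c x = trans (mergedHeight≡ δ c x)
      (∑-zero _ (λ v → cong (λ b → if b then hostedHeight (δ v) else 0) (apart δ c x v)))

    vacant-place : ∀ δ s x → δ x ≡ nothing → ∀ m → vacant δ ≡ suc m →
      vacant (place G t δ s x) ≡ choose (t ∸ height s) m (suc m)
    vacant-place δ s x empty m v≡ = by (placed-cases s 0)
      where
      ε : Conf
      ε = place G t δ s x
      ε-x : ε x ≡ placed s 0
      ε-x = trans (place-at δ s x) (cong (placed s) (alone δ (colour s) x))
      ε-off : ∀ v → v ≢ x → ε v ≡ δ v
      ε-off v ne = trans (place-off δ s x v ne) (cong (λ b → if b then nothing else δ v) (apart δ (colour s) x v))
      by : (t ≤ height s + 0 × placed s 0 ≡ nothing) ⊎ (height s + 0 < t × placed s 0 ≡ just (raise s 0)) →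
           vacant ε ≡ choose (t ∸ height s) m (suc m)
      by (inj₁ (t≤ , eq)) = trans (∑-cong same)
          (trans v≡ (sym (choose-zero (m≤n⇒m∸n≡0 (subst (t ≤_) (+-identityʳ _) t≤)))))
        where
        same : ∀ v → emptiness (ε v) ≡ emptiness (δ v)
        same v = cong emptiness (at (v ≟ᶠ x))
          where
          at : Dec (v ≡ x) → ε v ≡ δ v
          at (yes refl) = trans ε-x (trans eq (sym empty))
          at (no ne)    = ε-off v ne
      by (inj₂ (lt , eq)) = trans (+-cancelʳ-≡ 1 (vacant ε) m (trans (sym grown′) (trans v≡ (+-comm 1 m))))
          (sym (choose-pos (λ z → <⇒≱ (subst (_< t) (+-identityʳ _) lt) (m∸n≡0⇒m≤n z))))
        where
        grown′ : vacant δ ≡ vacant ε + 1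
        grown′ = trans (∑-update (emptiness ∘ ε) (emptiness ∘ δ) x (cong emptiness (trans ε-x eq))
                         (λ v ne → cong emptiness (sym (ε-off v ne))))
                       (cong (λ z → vacant ε + emptiness z) empty)

    jammed : ∀ T m b → b ≢ 0 → proj₂ (foldl (settle t) (m , b) T) ≢ 0
    jammed []      m       b ne = ne
    jammed (s ∷ T) zero    b ne = jammed T zero 1 (λ ())
    jammed (s ∷ T) (suc m) b ne = jammed T _ b ne

    -- Without edges nothing merges, so all empty vertices are equally good and their number alone
    -- decides: every stack below `t` uses one up for ever, and a stack of height `t` merely
    -- requires that there is one.
    fits⇔ : ∀ T δ m → vacant δ ≡ m →
      (proj₂ (foldl (settle t) (m , 0) T) ≡ 0 → Fits δ T) × (Fits δ T → proj₂ (foldl (settle t) (m , 0) T) ≡ 0)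
    fits⇔ []      δ m v≡ = (λ _ → δ , done , tt) , (λ _ → refl)
    fits⇔ (s ∷ T) δ zero v≡ = (λ eq → contradiction eq (jammed T zero 1 (λ ()))) , blocked
      where
      blocked : Fits δ (s ∷ T) → _
      blocked (_ , move x empty _ , _) = contradiction
        (≤-trans (≤-reflexive (cong emptiness (sym empty))) (≤-trans (∑-term (emptiness ∘ δ) x) (≤-reflexive v≡))) λ ()
    fits⇔ (s ∷ T) δ (suc m) v≡ = to , from
      where
      spot : ∃[ x ] δ x ≡ nothing
      spot with ∑-search (emptiness ∘ δ) (subst (0 <_) (sym v≡) (s≤s z≤n))
      ... | x , pos with δ x in eq
      ...   | nothing = x , eq
      to : proj₂ (foldl (settle t) (choose (t ∸ height s) m (suc m) , 0) T) ≡ 0 → Fits δ (s ∷ T)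
      to z with spot
      ... | x , empty with proj₁ (fits⇔ T (place G t δ s x) _ (vacant-place δ s x empty m v≡)) z
      ... | ε , play , _ = ε , move x empty play , tt
      from : Fits δ (s ∷ T) → proj₂ (foldl (settle t) (choose (t ∸ height s) m (suc m) , 0) T) ≡ 0
      from (ε , move x empty play , _) =
        proj₂ (fits⇔ T (place G t δ s x) _ (vacant-place δ s x empty m v≡)) (ε , play , tt)

  scanEdges-run : ∀ h → vars h 0 ≡ n → vars h 3 ≡ length S →
    Run scanEdges h (n * suc (n * 1)) (λ g → vars g 73 ≡ ∑ degree)
  scanEdges-run h at-0 at-3 = after (after (run-mono ≤-refl
      (λ (_ , eq) → trans (eq ≤-refl) (prefix≡∑ degree))
      (run-for-const (n * 1) Outer refl at-0
        (trans (cong₂ _+_ at-3 at-3) (sym (+-identityʳ _)) , λ _ → refl) outer)))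
    where
    h₀ : Store
    h₀ = setVar 62 (vars h 3 + vars h 3) (setVar 73 0 h)
    stepᶜ rowᶜ bodyᶜ : Command
    stepᶜ = 73 := var 73 ⊞ input (var 62 ⊞ var 63)
    rowᶜ = for 63 / 64 below var 0 loop stepᶜ
    bodyᶜ = rowᶜ ▸ 62 := var 62 ⊞ var 0
    Outer : ℕ → Store → Set
    Outer j g = vars g 62 ≡ length S + length S + j * n × ((j≤ : j ≤ n) → vars g 73 ≡ prefix degree j j≤)
    outer : ∀ j g → j < n → vars g 60 ≡ j → Frame (for 60 / 61 below var 0 loop bodyᶜ) h₀ g → Outer j g →
            Run bodyᶜ g (n * 1) (λ g′ → Outer (suc j) (bump 60 g′))
    outer j g j< at-60 F (g62 , g73) = run-mono (≤-reflexive (+-identityʳ _)) (λ z → z) (run-seq {t₂ = 0}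
        (run-for-const 0 (λ i f → (i≤ : i ≤ n) → vars f 73 ≡ vars g 73 + prefix bits i i≤) refl g0
          (λ _ → sym (+-identityʳ _)) inner)
        (λ f F′ f73 → run z≤n
          ( trans (cong₂ _+_ (trans (var≡ F′ 62 refl) g62) (trans (var≡ F′ 0 refl) g0))
                  (next-row (length S + length S) j)
          , λ j<′ → trans (f73 ≤-refl) (cong₂ _+_ (g73 (<⇒≤ j<′)) (prefix≡∑ bits)) )))
      where
      g0 : vars g 0 ≡ n
      g0 = trans (var≡ F 0 refl) at-0
      u : Fin n
      u = fromℕ< j<
      bits : Fin n → ℕ
      bits v = bit (adjacent u v)
      inner : ∀ i f → i < n → vars f 63 ≡ i → Frame rowᶜ g f →
        ((i≤ : i ≤ n) → vars f 73 ≡ vars g 73 + prefix bits i i≤) →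
        Run stepᶜ f 0 (λ f′ → (i≤ : suc i ≤ n) → vars (bump 63 f′) 73 ≡ vars g 73 + prefix bits (suc i) i≤)
      inner i f i< at-63 F′ inv = run z≤n λ i<′ → trans (cong₂ _+_ (inv (<⇒≤ i<′))
        (trans (cong₂ (λ a b → inp (a + b))
                 (trans (var≡ F′ 62 refl) (trans g62 (cong (λ z → length S + length S + z * n) (sym (toℕ-fromℕ< j<)))))
                 (trans at-63 (sym (toℕ-fromℕ< i<))))
               (inp-adjacent u (fromℕ< i<)))) (+-assoc (vars g 73) _ _)

  fitOne-run : ∀ h → vars h 0 ≡ n → vars h 2 ≡ t → vars h 3 ≡ length S →
    Run fitOne h (n * suc (n * 1) + length S) (λ g → Answers (Fits allEmpty S) (vars g 0))
  fitOne-run h at-0 at-2 at-3 = run-seq (scanEdges-run h at-0 at-3) (λ g F g73 → run-if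
      (λ ne → run z≤n (inj₁ (crowded (λ z → ne (trans g73 z)) , refl)))
      (λ eq → run-mono ≤-refl (λ {f} → decide (trans (sym g73) eq) {f})
        (greedy-run t g n (trans (var≡ F 0 refl) at-0) (trans (var≡ F 2 refl) at-2) (trans (var≡ F 3 refl) at-3))))
    where
    crowded : ∑ degree ≢ 0 → Fits allEmpty S
    crowded ne with ∑-search degree (n≢0⇒n>0 ne)
    ... | u , pos with degree≢0 (λ z → <-irrefl (sym z) pos)
    ...   | v , e = edge⇒fits u v e S allEmpty refl
    decide : ∑ degree ≡ 0 → ∀ {f} → vars f 0 ≡ choose (proj₂ (foldl (settle t) (n , 0) S)) 0 1 →
             Answers (Fits allEmpty S) (vars f 0)
    decide z {f} eq with proj₂ (foldl (settle t) (n , 0) S) | fits⇔ edgeless S allEmpty n (∑-one n)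
      where
      edgeless : ∀ u → Isolated u
      edgeless u = degree≡0 (n≤0⇒n≡0 (≤-trans (∑-term degree u) (≤-reflexive z)))
    ... | zero  | to , from = inj₁ (to refl , eq)
    ... | suc _ | to , from = inj₂ ((λ fits → 0≢1+n (sym (from fits))) , eq)

-- The initial memory

memory : ∀ {n k} → Graph n → List (Stack k) → List ℕ
memory {n} G S = concatMap (λ s → toℕ (colour s) ∷ height s ∷ []) S
  ++ cartesianProductWith (λ u v → if Graph.adjacent G u v then 1 else 0) (allFin n) (allFin n)

contents-++ : ∀ xs ys a → contents (xs ++ ys) (length xs + a) ≡ contents ys a
contents-++ []       ys a = refl
contents-++ (x ∷ xs) ys a = contents-++ xs ys a

contents-left : ∀ xs ys {a} → a < length xs → contents (xs ++ ys) a ≡ contents xs a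
contents-left (x ∷ xs) ys {zero}  a< = refl
contents-left (x ∷ xs) ys {suc a} a< = contents-left xs ys (s≤s⁻¹ a<)

contents-beyond : ∀ xs a → length xs ≤ a → contents xs a ≡ 0
contents-beyond []       a       le = refl
contents-beyond (x ∷ xs) (suc a) le = contents-beyond xs a (s≤s⁻¹ le)

contents-map : ∀ {n m} (f : Fin n → ℕ) (g : Fin m → Fin n) v →
               contents (map f (tabulate g)) (toℕ v) ≡ f (g v)
contents-map f g zero    = refl
contents-map f g (suc v) = contents-map f (g ∘ suc) v

module _ {m n : ℕ} (f : Fin m → Fin n → ℕ) where

  rows : ∀ {l} → (Fin l → Fin m) → List ℕ
  rows g = cartesianProductWith f (tabulate g) (allFin n)

  length-row : ∀ u → length (map (f u) (allFin n)) ≡ n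
  length-row u = trans (length-map (f u) (allFin n)) (length-tabulate {n = n} (λ v → v))

  length-rows : ∀ {l} (g : Fin l → Fin m) → length (rows g) ≡ l * n
  length-rows {zero}  g = refl
  length-rows {suc l} g = trans (length-++ (map (f (g zero)) (allFin n)))
    (cong₂ _+_ (length-row (g zero)) (length-rows (g ∘ suc)))

  contents-rows : ∀ {l} (g : Fin l → Fin m) u v → contents (rows g) (toℕ u * n + toℕ v) ≡ f (g u) v
  contents-rows g zero v = trans
    (contents-left (map (f (g zero)) (allFin n)) (rows (g ∘ suc)) (subst (toℕ v <_) (sym (length-row (g zero))) (toℕ<n v)))
    (contents-map (f (g zero)) (λ v → v) v)
  contents-rows g (suc u) v = trans (cong (contents (rows g)) (trans (+-assoc n (toℕ u * n) (toℕ v))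
      (cong (_+ (toℕ u * n + toℕ v)) (sym (length-row (g zero))))))
    (trans (contents-++ (map (f (g zero)) (allFin n)) (rows (g ∘ suc)) _) (contents-rows (g ∘ suc) u v))

pairs : ∀ {k} → List (Stack k) → List ℕ
pairs = concatMap (λ s → toℕ (colour s) ∷ height s ∷ [])

length-pairs : ∀ {k} (S : List (Stack k)) → length (pairs S) ≡ length S + length S
length-pairs []      = refl
length-pairs (s ∷ S) = cong suc (trans (cong suc (length-pairs S)) (sym (+-suc (length S) (length S))))

contents-pairs : ∀ {k} (pre : List (Stack k)) s post ys →
  contents (pairs (pre ++ s ∷ post) ++ ys) (length pre + length pre) ≡ toℕ (colour s)
  × contents (pairs (pre ++ s ∷ post) ++ ys) (length pre + length pre + 1) ≡ height s
contents-pairs []        s post ys = refl , refl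
contents-pairs (r ∷ pre) s post ys rewrite +-suc (length pre) (length pre) = contents-pairs pre s post ys

module Memory {n k : ℕ} (G : Graph n) (S : List (Stack k)) where

  inp : ℕ → ℕ
  inp = contents (memory G S)

  inp-stack : ∀ pre s post → S ≡ pre ++ s ∷ post →
    inp (length pre + length pre) ≡ toℕ (colour s) × inp (length pre + length pre + 1) ≡ height s
  inp-stack pre s post refl = contents-pairs pre s post _

  inp-adjacent : ∀ u v → inp (length S + length S + toℕ u * n + toℕ v) ≡ (if Graph.adjacent G u v then 1 else 0)
  inp-adjacent u v = trans (cong inp (trans (+-assoc (length S + length S) (toℕ u * n) (toℕ v))
      (cong (_+ (toℕ u * n + toℕ v)) (sym (length-pairs S)))))
    (trans (contents-++ (pairs S) _ _) (contents-rows (λ u v → if Graph.adjacent G u v then 1 else 0) (λ u → u) u v))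

  size : ℕ
  size = length S + length S + n * n

  inp-end : ∀ a → size ≤ a → inp a ≡ 0
  inp-end a le = contents-beyond (memory G S) a (≤-trans (≤-reflexive (trans (length-++ (pairs S))
    (cong₂ _+_ (length-pairs S) (length-rows (λ u v → if Graph.adjacent G u v then 1 else 0) (λ u → u))))) le)

-- The complete programs

-- Register 4 must contain the length of the input, 2 |S| + |V|², before compiled code can run. This
-- is written directly for the machine, with |V|² as a sum of |V| terms.
findLoop findSize : Program
findLoop = whileNonZero (reg 5) repeat (5 ≔ reg 5 ⊖ lit 1 ⨾ 4 ≔ reg 4 ⊕ reg 0)
findSize = 4 ≔ reg 3 ⊕ reg 3 ⨾ 5 ≔ reg 0 ⨾ findLoop

-- Without stacks the answer is yes; with stacks but no vertices, no; with
-- threshold 1 every stack vanishes at once.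
decideBy : Command → Program
decideBy p =
  ifNonZero reg 3
    then (ifNonZero reg 0
            then (ifNonZero reg 2 ⊖ lit 1 then (findSize ⨾ ⌊ p ⌋) else (0 ≔ lit 1))
            else skip)
    else (0 ≔ lit 1)

fitMain emptyMain : Command
fitMain = ifnz var 1 ⊟ con 1 then fill markAll else fitOne
emptyMain =
  ifnz var 1 ⊟ con 1
    then fill markEmpty
    else (matching ▸ isolating ▸ starring ▸ (ifnz var 65 then starAnswer else fill markEmpty))

findLoop-run : ∀ m σ → regs σ 5 ≡ m →
  ∃[ σ′ ] ∃[ T ] ⟨ findLoop , σ ⟩⇓ σ′ [ T ] × T ≤ 2 + m * 10
    × regs σ′ 4 ≡ regs σ 4 + m * regs σ 0 × (∀ r → r < 4 → regs σ′ r ≡ regs σ r) × mem σ′ ≡ mem σ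
findLoop-run zero σ eq = σ , 2 , ⇓exit eq , ≤-refl , sym (+-identityʳ _) , (λ _ _ → refl) , refl
findLoop-run (suc m) σ eq
  with findLoop-run m (state ((regs σ [ 5 ↦ regs σ 5 ∸ 1 ]) [ 4 ↦ regs σ 4 + regs σ 0 ]) (mem σ)) (cong (_∸ 1) eq)
... | σ′ , T , run′ , T≤ , at-4 , low , mem≡ = σ′ , _ ,
  ⇓loop (λ z → 0≢1+n (trans (sym z) eq)) (⇓seq ⇓reg ⇓reg) run′ ,
  ≤-trans (+-monoʳ-≤ 10 T≤) (≤-reflexive (ring m)) ,
  trans at-4 (+-assoc (regs σ 4) (regs σ 0) (m * regs σ 0)) ,
  (λ where
    0 r< → low 0 r<
    1 r< → low 1 r<
    2 r< → low 2 r<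
    3 r< → low 3 r<
    (suc (suc (suc (suc r)))) (s≤s (s≤s (s≤s (s≤s ()))))) ,
  mem≡
  where
  ring : ∀ m → 10 + (2 + m * 10) ≡ 2 + suc m * 10
  ring = solve-∀

answers-map : ∀ {P Q : Set} {b} → (P → Q) → (Q → P) → Answers P b → Answers Q b
answers-map f g (inj₁ (p , eq))  = inj₁ (f p , eq)
answers-map f g (inj₂ (¬p , eq)) = inj₂ ((λ q → ¬p (g q)) , eq)

Bound : Instance → ℕ
Bound I = length stacks * (colours * threshold) ^ vertices
  where open Instance I

inputOf : Instance → ℕ → ℕ
inputOf I = Memory.inp (Instance.graph I) (Instance.stacks I)

InitialFor : Instance → Store → Set
InitialFor I = Initial (Instance.graph I) (Instance.threshold I) (Instance.stacks I)

stacks⇒colour : ∀ {k} {S : List (Stack k)} → 0 < length S → 1 ≤ k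
stacks⇒colour {zero} {stack () _ ∷ S} _
stacks⇒colour {suc k} _ = s≤s z≤n

-- From a command to a machine program that decides the problem

module _ (Promise Problem : Instance → Set)
  (bounded : ∀ I → Promise I → HeightsBounded I)
  (no-stacks : ∀ I → Instance.stacks I ≡ [] → Problem I)
  (no-vertices : ∀ I → Instance.vertices I ≡ 0 → 0 < length (Instance.stacks I) → ¬ Problem I)
  (unit : ∀ I → 0 < Instance.vertices I → Instance.threshold I ≤ 1 → Problem I)
  (p : Command) (legal-p : legal p ≡ true) (K : ℕ)
  (main : ∀ I → Promise I → 1 ≤ Instance.vertices I → 2 ≤ Instance.threshold I →
          1 ≤ length (Instance.stacks I) → ∀ h → InitialFor I h →
          ∃[ T ] Semantics.Run (inputOf I) p h T (λ g → Answers (Problem I) (vars g 0)) × T ≤ K * Bound I)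
  where

  private
    W K′ : ℕ
    W  = weight p
    -- The simulation takes at most W (1 + K F) ≤ W (K + 1) F steps. The 34 has room for the initial
    -- tests, for the 10 steps per vertex of `findLoop`, and for the runs that end early.
    K′ = 34 + W * suc K

  decide : DecidableInTime Promise Problem Bound
  decide = decideBy p , K′ , λ I promise → go I promise (Instance.stacks I) refl
    where
    Result : Instance → Set
    Result I = ∃[ σ ] ∃[ T ] ⟨ decideBy p , encode I ⟩⇓ σ [ T ]
                 × T ≤ K′ * (Bound I ⊔ 1) × Answers (Problem I) (regs σ 0)
    short : ∀ I {T} → T ≤ 34 → T ≤ K′ * (Bound I ⊔ 1)
    short I le = ≤-trans le (≤-trans (m≤m+n 34 (W * suc K))
      (m≤m*n K′ (Bound I ⊔ 1) {{>-nonZero (m≤n⊔m (Bound I) 1)}}))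
    compute : ∀ I → Promise I → 1 ≤ Instance.vertices I → 2 ≤ Instance.threshold I →
              1 ≤ length (Instance.stacks I) → Result I
    compute I promise 1≤n 2≤t 1≤s
      with findLoop-run n (state (((regs (encode I)) [ 4 ↦ s + s ]) [ 5 ↦ n ]) (mem (encode I))) refl
      where
      open Instance I
      n s : ℕ
      n = vertices
      s = length stacks
    ... | σ₁ , T₁ , run₁ , T₁≤ , at-4 , low , mem≡ = finish (simulate p legal-p rep)
      where
      open Instance I
      open Memory graph stacks
      open Semantics inp
      open Simulation inp size inp-end
      h : Store
      h = store (regs σ₁) (λ _ _ → 0)
      rep : Represents σ₁ h
      rep = record
        { vars≡  = λ _ → refl
        ; base≡  = at-4
        ; input≡ = λ a _ → cong-app mem≡ a
        -- All arrays lie beyond the input, where the memory is zero, so they start out as zero.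
        ; cells≡ = λ k i _ → trans (cong-app mem≡ _)
            (inp-end _ (≤-trans (m≤m+n size (suc k)) (m≤m+n (size + suc k) (oct i)))) }
      initial : Initial graph threshold stacks h
      initial = low 0 (s≤s z≤n) , low 1 (s≤s (s≤s z≤n)) , low 2 (s≤s (s≤s (s≤s z≤n))) ,
                low 3 (s≤s (s≤s (s≤s (s≤s z≤n)))) , λ _ _ → refl
      1≤k : 1 ≤ colours
      1≤k = stacks⇒colour {S = stacks} 1≤s
      2≤b : 2 ≤ colours * threshold
      2≤b = *-mono-≤ 1≤k 2≤t
      F : ℕ
      F = Bound I
      n≤F : vertices ≤ F
      n≤F = ≤-trans (n≤t^n vertices 2≤b) (m≤n*m _ (length stacks) {{>-nonZero 1≤s}})
      1≤F : 1 ≤ F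
      1≤F = *-mono-≤ 1≤s (m^n>0 (colours * threshold) {{>-nonZero (≤-trans (s≤s z≤n) 2≤b)}} vertices)
      finish : Simulated p σ₁ h → Result I
      finish (σ₂ , T₂ , run₂ , T₂≤ , rep₂) = σ₂ , _ ,
          ⇓then (λ z → <-irrefl (sym z) 1≤s) (⇓then (λ z → <-irrefl (sym z) 1≤n)
            (⇓then (λ z → <⇒≱ 2≤t (m∸n≡0⇒m≤n z)) (⇓seq (⇓seq′ run₁) run₂))) ,
          time , subst (Answers (Problem I)) (sym (Represents.vars≡ rep₂ 0)) answer′
        where
        ⇓seq′ : ⟨ findLoop , _ ⟩⇓ σ₁ [ T₁ ] → ⟨ findSize , encode I ⟩⇓ σ₁ [ 4 + (2 + T₁) ]
        ⇓seq′ r = ⇓seq ⇓reg (⇓seq ⇓reg r)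
        outcome : ∃[ T ] Run p h T (λ g → Answers (Problem I) (vars g 0)) × T ≤ K * F
        outcome = main I promise 1≤n 2≤t 1≤s h initial
        answer′ : Answers (Problem I) (vars (exec p h) 0)
        answer′ = Run.post (proj₁ (proj₂ outcome))
        steps≤F : steps p h ≤ K * F
        steps≤F = ≤-trans (Run.steps≤ (proj₁ (proj₂ outcome))) (proj₂ (proj₂ outcome))
        T₂≤F : T₂ ≤ W * suc K * F
        T₂≤F = ≤-trans T₂≤ (≤-trans (*-monoʳ-≤ W (+-mono-≤ 1≤F steps≤F)) (≤-reflexive (sym (*-assoc W (suc K) F))))
        time : 2 + (2 + (4 + (4 + (2 + T₁) + T₂))) ≤ K′ * (F ⊔ 1)
        time = begin
          2 + (2 + (4 + (4 + (2 + T₁) + T₂)))        ≡⟨ ring₁ T₁ T₂ ⟩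
          14 + T₁ + T₂                               ≤⟨ +-mono-≤ (+-monoʳ-≤ 14 T₁≤) T₂≤F ⟩
          14 + (2 + vertices * 10) + W * suc K * F   ≤⟨ +-monoˡ-≤ (W * suc K * F) (+-monoʳ-≤ 14 (+-monoʳ-≤ 2 (*-monoˡ-≤ 10 n≤F))) ⟩
          14 + (2 + F * 10) + W * suc K * F          ≡⟨ ring₂ F (W * suc K) ⟩
          16 * 1 + 10 * F + W * suc K * F            ≤⟨ +-monoˡ-≤ (W * suc K * F) (+-monoˡ-≤ (10 * F) (*-monoʳ-≤ 16 1≤F)) ⟩
          16 * F + 10 * F + W * suc K * F            ≤⟨ m≤n+m _ (8 * F) ⟩
          8 * F + (16 * F + 10 * F + W * suc K * F)  ≡⟨ ring₃ F (W * suc K) ⟩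
          K′ * F                                     ≤⟨ *-monoʳ-≤ K′ (m≤m⊔n F 1) ⟩
          K′ * (F ⊔ 1)                               ∎
          where
          open ≤-Reasoning
          ring₁ : ∀ a b → 2 + (2 + (4 + (4 + (2 + a) + b))) ≡ 14 + a + b
          ring₁ = solve-∀
          ring₂ : ∀ f w → 14 + (2 + f * 10) + w * f ≡ 16 * 1 + 10 * f + w * f
          ring₂ = solve-∀
          ring₃ : ∀ f w → 8 * f + (16 * f + 10 * f + w * f) ≡ (34 + w) * f
          ring₃ = solve-∀
    go : ∀ I → Promise I → ∀ S → Instance.stacks I ≡ S → Result I
    go I promise [] eq = _ , _ , ⇓else (cong length eq) ⇓reg , short I (≤ᵇ⇒≤ 4 34 _) ,
      inj₁ (no-stacks I eq , refl)
    go I promise (s ∷ S) eq = by-vertices (Instance.vertices I) refl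
      where
      1≤s : 1 ≤ length (Instance.stacks I)
      1≤s = subst (λ S → 1 ≤ length S) (sym eq) (s≤s z≤n)
      s≢0 : length (Instance.stacks I) ≢ 0
      s≢0 z = <-irrefl (sym z) 1≤s
      by-vertices : ∀ n → Instance.vertices I ≡ n → Result I
      -- Register 0 holds the number of vertices; being 0, it already is the answer no.
      by-vertices zero n≡ = _ , _ , ⇓then s≢0 (⇓else n≡ ⇓skip) , short I (≤ᵇ⇒≤ 5 34 _) ,
        inj₂ (no-vertices I n≡ 1≤s , n≡)
      by-vertices (suc n) n≡ with Instance.threshold I ≤? 1
      ... | yes t≤1 = _ , _ ,
        ⇓then s≢0 (⇓then (λ z → 0≢1+n (trans (sym z) n≡)) (⇓else (m≤n⇒m∸n≡0 t≤1) ⇓reg)) ,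
        short I (≤ᵇ⇒≤ 10 34 _) ,
        inj₁ (unit I (subst (0 <_) (sym n≡) (s≤s z≤n)) t≤1 , refl)
      ... | no t≰1 = compute I promise (subst (1 ≤_) (sym n≡) (s≤s z≤n)) (≰⇒> t≰1) 1≤s

-- Threshold 1

module _ {n k : ℕ} (G : Graph n) (t : ℕ) where
  open Clearing {n} {k} G t

  unit-clears : t ≤ 1 → Fin n → ∀ S δ → (∀ v → δ v ≡ nothing) → Clears δ S
  unit-clears t≤1 x []      δ empty = δ , done , empty
  unit-clears t≤1 x (s ∷ S) δ empty with unit-clears t≤1 x S (place G t δ s x) (λ v → by v (v ≟ᶠ x))
    where
    vanish : ∀ h′ → placed s h′ ≡ nothing
    vanish h′ with placed-cases s h′
    ... | inj₁ (_ , eq) = eq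
    ... | inj₂ (lt , _) = contradiction (≤-trans t≤1 (≤-trans (height-pos s) (m≤m+n _ h′))) (<⇒≱ lt)
    by : ∀ v → Dec (v ≡ x) → place G t δ s x v ≡ nothing
    by v (yes refl) = trans (place-at δ s x) (vanish _)
    by v (no ne) = place-nothing δ s x ne (empty v)
  ... | ε , play , goal = ε , move x (empty x) play , goal

-- Assembly of the programs for one colour

scan-bound : ∀ n k t s → 1 ≤ n → 1 ≤ k → 2 ≤ t → 1 ≤ s → n * suc (n * 1) ≤ 6 * (s * (k * t) ^ n)
scan-bound n k t s 1≤n 1≤k 2≤t 1≤s = begin
  n * suc (n * 1)            ≡⟨ cong (λ z → n * suc z) (*-identityʳ n) ⟩
  n * (1 + n)                ≤⟨ *-monoʳ-≤ n (+-monoˡ-≤ n 1≤n) ⟩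
  n * (n + n)                ≡⟨ ring n ⟩
  2 * (n * n)                ≤⟨ *-monoʳ-≤ 2 (m≤m*n (n * n) b {{>-nonZero (≤-trans (s≤s z≤n) 2≤b)}}) ⟩
  2 * (n * n * b)            ≤⟨ *-monoʳ-≤ 2 (square-power-bound n 2≤b) ⟩
  2 * (3 * b ^ n)            ≡⟨ *-assoc 2 3 (b ^ n) ⟨
  6 * b ^ n                  ≤⟨ *-monoʳ-≤ 6 (m≤n*m (b ^ n) s {{>-nonZero 1≤s}}) ⟩
  6 * (s * b ^ n)            ∎
  where
  open ≤-Reasoning
  b : ℕ
  b = k * t
  2≤b : 2 ≤ b
  2≤b = *-mono-≤ 1≤k 2≤t
  ring : ∀ n → n * (n + n) ≡ 2 * (n * n)
  ring = solve-∀

stacks-bound : ∀ n k t s → 1 ≤ k → 2 ≤ t → s ≤ s * (k * t) ^ n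
stacks-bound n k t s 1≤k 2≤t = m≤m*n s ((k * t) ^ n)
  {{m^n≢0 (k * t) n {{>-nonZero (≤-trans (s≤s z≤n) (*-mono-≤ 1≤k 2≤t))}}}}

module SingleColour {n : ℕ} (G : Graph n) (t : ℕ) (S : List (Stack 1))
  (1≤n : 1 ≤ n) (2≤t : 2 ≤ t) (1≤s : 1 ≤ length S)
  (bounded : All (λ s → height s ≤ t) S) where
  open Graph G
  open Memory G S
  open Semantics inp
  open Pairs G inp (length S) inp-adjacent

  F : ℕ
  F = length S * (1 * t) ^ n

  0<t : 0 < t
  0<t = ≤-trans (s≤s z≤n) 2≤t

  instance
    t≢0 : NonZero t
    t≢0 = >-nonZero 0<t

  open Clearing {n} {1} G t

  mass-empty : mass allEmpty ≡ 0
  mass-empty = ∑-zero {n} _ (λ _ → refl)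

  clears⇒ : ∀ T → 0 < length T → Clears allEmpty T → t ≤ partial T ⊎ t ≤ lastHeight T
  clears⇒ (s ∷ T) _ wins = subst (λ z → t ≤ z + partial (s ∷ T) ⊎ t ≤ lastHeight (s ∷ T)) mass-empty
    (clears⇒enough allEmpty s T wins)

  module _ (role : Fin n → Role n) (seen : Seen (λ _ _ → ⊤) role) where

    isLeaf : Fin n → Fin n → Bool
    isLeaf c v with role v
    ... | single  = adjacent c v
    ... | skip    = false
    ... | first _ = false

    leaf-parts : ∀ c {v} → isLeaf c v ≡ true → role v ≡ single × adjacent c v ≡ true
    leaf-parts c {v} eq with role v
    ... | single = refl , eq

    leaf-count : ∀ c v → (if isLeaf c v then 1 else 0) ≡ bit (adjacent c v) * isSingle (role v)
    leaf-count c v with role v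
    ... | single  = sym (*-identityʳ _)
    ... | skip    = sym (*-zeroʳ (bit (adjacent c v)))
    ... | first _ = sym (*-zeroʳ (bit (adjacent c v)))

    apart : ∀ {u v} → role u ≡ single → role v ≡ single → adjacent u v ≡ false
    apart {u} {v} p q with adjacent u v in e
    ... | true  = ⊥-elim (seen tt e p q)
    ... | false = refl

    star⇒clears : ∀ c → 2 * t ≤ leaves role c → ∀ T → 0 < length T →
      t ≤ partial T ⊎ t ≤ lastHeight T → Clears allEmpty T
    star⇒clears c many (s ∷ T) _ suff =
      Star.sufficient G t 0<t c (isLeaf c) (λ eq → proj₂ (leaf-parts c eq))
        (λ p q → apart (proj₁ (leaf-parts c p)) (proj₁ (leaf-parts c q)))
        (subst (2 * t ≤_) (sym (∑-cong (leaf-count c))) many) s T suff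

  -- No later placement is adjacent to such a stack, and none can be made on its vertex. On the way
  -- to an empty board, an isolated vertex is thus of use only for stacks that vanish at once.
  isolated-stays : ∀ {v} → Isolated v → ∀ T {δ ε} → Plays G t δ T ε → δ v ≢ nothing → ε v ≢ nothing
  isolated-stays iso []      done ne = ne
  isolated-stays {v} iso (s ∷ T) {δ} (move x empty play) ne = isolated-stays iso T play
    (λ z → ne (trans (sym kept) z))
    where
    v≢x : v ≢ x
    v≢x refl = ne empty
    kept : place G t δ s x v ≡ δ v
    kept = trans (place-off δ s x v v≢x)
      (cong (λ b → if b ∧ hosts (colour s) (δ v) then nothing else δ v) (trans (symmetric x v) (iso x)))

  module Roles (role : Fin n → Role n) (settled : Settled role) where
    open Settled settled
    GoodConf : Conf → Set
    GoodConf = Enumeration.GoodConf G t role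

    -- Pairs are edges, and with one colour a placement on one end empties the other; elsewhere a
    -- placement fills nothing.
    place-Good : ∀ {δ} s x → GoodConf δ → GoodConf (place G t δ s x)
    place-Good {δ} s x good {u} {w} r = by (u ≟ᶠ x) (w ≟ᶠ x)
      where
      by : Dec (u ≡ x) → Dec (w ≡ x) → place G t δ s x u ≡ nothing ⊎ place G t δ s x w ≡ nothing
      by (yes refl) _ = inj₂ (OneColour.absorbed G t δ s (edge r))
      by (no _) (yes refl) = inj₁ (OneColour.absorbed G t δ s (trans (symmetric w u) (edge r)))
      by (no u≢x) (no w≢x) with good r
      ... | inj₁ z = inj₁ (place-nothing δ s x u≢x z)
      ... | inj₂ z = inj₂ (place-nothing δ s x w≢x z)

    -- The goal of an empty board enters here: a stack on a discarded vertex, which is isolated,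
    -- could never be removed.
    wins⇒Storable : ∀ {δ T} → Clears δ T → Enumeration.Storable G t role δ
    wins⇒Storable {δ} {T} (ε , play , goal) {v} ne with role v in r
    ... | single  = inj₁ (λ ())
    ... | first _ = inj₁ (λ ())
    ... | skip with partner r
    ...   | inj₁ found = inj₂ found
    ...   | inj₂ iso   = contradiction (goal v) (isolated-stays iso T play ne)

    module _ (few : ∀ c → leaves role c ≤ 2 * t) (seen : Seen (λ _ _ → ⊤) role)
             (touched : ∀ {u} → role u ≡ single → ∃[ v ] adjacent u v ≡ true) where
      count : (Role n → ℕ) → ℕ
      count f = ∑ (f ∘ role)

      m r i E : ℕ
      m = count isFirst
      r = count isSingle
      -- The `skip` vertices without the partners, that is, the discarded ones.
      i = count isSkip ∸ m
      E = t ^ r * (t + (t ∸ 1)) ^ m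

      n≡ : i + (m + m) + r ≡ n
      n≡ = trans (trans (ring i m r) (cong (r + m +_) (m∸n+n≡m balanced))) (role-count role)
        where
        ring : ∀ i m r → i + (m + m) + r ≡ r + m + (i + m)
        ring = solve-∀

      nE≤ : n * E ≤ 41 * (1 * t) ^ n
      nE≤ = subst₂ (λ a b → a * E ≤ 41 * b ^ a) n≡ (sym (+-identityʳ t))
        (pairs-bound i m r 2≤t (single-count settled seen touched few))

      fill-one : ∀ h → vars h 0 ≡ n → vars h 1 ≡ 1 → vars h 2 ≡ t → vars h 3 ≡ length S →
        (∀ y → cells h 4 y ≡ 0) → (∀ y → cells h 5 y ≡ 0) → Coded (cells h 7) role →
        ∃[ T ] Run (fill markEmpty) h T (λ g → Answers (Clears allEmpty S) (vars g 0)) × T ≤ 112 * F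
      fill-one h at-0 at-1 at-2 at-3 zeros₄ zeros₅ coded = _ ,
        Enumeration.Filling.fill-run G t role inp S inp-adjacent inp-stack 0<t E
          (Enumeration.entries-length-pairs G t role refl 0<t) 0<base pairing (λ δ → ∀ v → δ v ≡ nothing)
          (λ eq goal v → trans (sym (eq v)) (goal v)) place-Good
          (λ {δ} {T} → wins⇒Storable {δ} {T}) (heights-split bounded) markEmpty 0 h at-0 at-1 at-2 at-3
          zeros₄ zeros₅ coded
          (Enumeration.Filling.markEmpty-run G t role inp S inp-adjacent inp-stack 0<base) ,
        solve-bound n 1 t (length S) E 41 0 1≤n ≤-refl 2≤t 1≤s z≤n nE≤
        where
        0<base : 0 < base
        0<base = ≤-trans (s≤s z≤n) (*-mono-≤ (≤-refl {1}) 2≤t)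

  scan≤ : n * suc (n * 1) ≤ 6 * F
  scan≤ = scan-bound n 1 t (length S) 1≤n ≤-refl 2≤t 1≤s

  all-single : Matched (λ _ _ → ⊥) (λ _ → 0)
  all-single = (λ _ → single) , (λ _ → refl) , record
    { pairing  = record { partner-skip = λ () ; partner-injective = λ () }
    ; edge     = λ ()
    ; partner  = λ ()
    ; balanced = ≤-trans (≤-reflexive (∑-zero {n} _ (λ _ → refl))) z≤n } , λ ()

  oneBranch : Command
  oneBranch = matching ▸ isolating ▸ starring ▸ (ifnz var 65 then starAnswer else fill markEmpty)

  empty-run : ∀ h → Initial G t S h →
    ∃[ T ] Run oneBranch h T (λ g → Answers (Clears allEmpty S) (vars g 0)) × T ≤ 131 * F
  empty-run h (at-0 , at-1 , at-2 , at-3 , zeros) = _ ,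
      run-seq (matching-run h at-0 at-3 start) (λ g₁ F₁ M →
        run-seq (isolating-run g₁ (trans (var≡ F₁ 0 refl) at-0) (trans (var≡ F₁ 3 refl) at-3) M)
          (λ g₂ F₂ (role , coded , settled , seen , touched) →
            run-seq (starring-run g₂ t role (trans (var≡ F₂ 0 refl) (trans (var≡ F₁ 0 refl) at-0))
                       (trans (var≡ F₂ 2 refl) (trans (var≡ F₁ 2 refl) at-2))
                       (trans (var≡ F₂ 3 refl) (trans (var≡ F₁ 3 refl) at-3)) coded)
              (λ g₃ F₃ starred → branch g₁ F₁ g₂ F₂ g₃ F₃ role coded settled seen (λ {u} → touched {u} tt) starred))) ,
      -- Three scans of the matrix at 6 F each, and 113 F to cover either branch; filling the table
      -- takes 112 = 30 + 2 · 41.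
      ≤-trans (+-mono-≤ scan≤ (+-mono-≤ scan≤ (+-monoˡ-≤ (113 * F) scan≤))) (≤-reflexive (ring F))
    where
    ring : ∀ f → 6 * f + (6 * f + (6 * f + 113 * f)) ≡ 131 * f
    ring = solve-∀
    start : Matched (λ _ _ → ⊥) (cells h 7)
    start with all-single
    ... | role , coded , rest = role , (λ v → trans (zeros 7 (toℕ v)) (coded v)) , rest
    branch : ∀ g₁ → Frame matching h g₁ → ∀ g₂ → Frame isolating g₁ g₂ → ∀ g₃ → Frame starring g₂ g₃ →
      ∀ role → Coded (cells g₂ 7) role → Settled role → Seen (λ _ _ → ⊤) role →
      (∀ {u} → role u ≡ single → ∃[ v ] adjacent u v ≡ true) → Starred role t n (vars g₃ 65) →
      Run (ifnz var 65 then starAnswer else fill markEmpty) g₃ (113 * F)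
          (λ g → Answers (Clears allEmpty S) (vars g 0))
    branch g₁ F₁ g₂ F₂ g₃ F₃ role coded settled seen touched = by
      where
      at : ∀ r → assigns r matching ≡ false → assigns r isolating ≡ false → assigns r starring ≡ false →
           vars g₃ r ≡ vars h r
      at r p q s = trans (var≡ F₃ r s) (trans (var≡ F₂ r q) (var≡ F₁ r p))
      zero-cells : ∀ j → updates j matching ≡ false → updates j isolating ≡ false → updates j starring ≡ false →
           ∀ y → cells g₃ j y ≡ 0
      zero-cells j p q s y = trans (cong-app (trans (cell≡ F₃ j s) (trans (cell≡ F₂ j q) (cell≡ F₁ j p))) y) (zeros j y)
      by : Starred role t n (vars g₃ 65) → Run (ifnz var 65 then starAnswer else fill markEmpty) g₃ (113 * F)
             (λ g → Answers (Clears allEmpty S) (vars g 0))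
      by (inj₂ (one , c , many)) = run-if
        (λ _ → run-mono (≤-trans (stacks-bound n 1 t (length S) ≤-refl 2≤t) (m≤n*m F 113))
          (answers-map (star⇒clears role seen c many S 1≤s) (clears⇒ S 1≤s))
          (StackScan.starAnswer-run inp S inp-stack t g₃ (trans (at 2 refl refl refl) at-2) (trans (at 3 refl refl refl) at-3)))
        (λ z → contradiction (trans (sym z) one) (λ ()))
      by (inj₁ (none , few)) = run-if
        (λ ne → contradiction none ne)
        (λ _ → fill-branch)
        where
        filled : ∃[ T ] Run (fill markEmpty) g₃ T (λ g → Answers (Clears allEmpty S) (vars g 0)) × T ≤ 112 * F
        filled = Roles.fill-one role settled (λ c → few (toℕ<n c)) seen touched g₃
          (trans (at 0 refl refl refl) at-0) (trans (at 1 refl refl refl) at-1)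
          (trans (at 2 refl refl refl) at-2) (trans (at 3 refl refl refl) at-3)
          (zero-cells 4 refl refl refl) (zero-cells 5 refl refl refl)
          (λ v → trans (cong-app (cell≡ F₃ 7 refl) (toℕ v)) (coded v))
        fill-branch : Run (fill markEmpty) g₃ (113 * F) (λ g → Answers (Clears allEmpty S) (vars g 0))
        fill-branch = run-mono (≤-trans (proj₂ (proj₂ filled)) (m≤n+m (112 * F) F)) (λ z → z)
                               (proj₁ (proj₂ filled))

  fit-run : ∀ h → Initial G t S h →
    ∃[ T ] Run fitOne h T (λ g → Answers (Wins (λ _ → ⊤) allEmpty S) (vars g 0)) × T ≤ 32 * F
  fit-run h (at-0 , at-1 , at-2 , at-3 , zeros) = _ ,
    FitOne.fitOne-run G t inp S inp-adjacent inp-stack h at-0 at-2 at-3 ,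
    ≤-trans (+-mono-≤ scan≤ (stacks-bound n 1 t (length S) ≤-refl 2≤t))
      (≤-trans (m≤n+m _ (25 * F)) (≤-reflexive (ring F)))
    where
    ring : ∀ f → 25 * f + (6 * f + f) ≡ 32 * f
    ring = solve-∀

-- The two decision programs for every number of colours

module Outcomes {n k : ℕ} (G : Graph n) (t : ℕ) (S : List (Stack k)) where
  open Memory G S
  open Semantics inp

  Outcome : Command → Store → Set → ℕ → Set
  Outcome p h P K = ∃[ T ] Run p h T (λ g → Answers P (vars g 0)) × T ≤ K * (length S * (k * t) ^ n)

  outcome-map : ∀ {p h P Q} K L → K ≤ L → (P → Q) → (Q → P) → Outcome p h P K → Outcome p h Q L
  outcome-map K L K≤L f g (T , r , T≤) = T , run-mono ≤-refl (answers-map f g) r , ≤-trans T≤ (*-monoˡ-≤ _ K≤L)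

  outcome-then : ∀ {e p q h P} K → val e h ≢ 0 → Outcome p h P K → Outcome (ifnz e then p else q) h P K
  outcome-then K ne (T , r , T≤) = T , run-if (λ _ → r) (λ eq → contradiction eq ne) , T≤

  outcome-else : ∀ {e p q h P} K → val e h ≡ 0 → Outcome q h P K → Outcome (ifnz e then p else q) h P K
  outcome-else K eq (T , r , T≤) = T , run-if (λ ne → contradiction eq ne) (λ _ → r) , T≤

Fitting : ∀ {n k} → Graph n → ℕ → List (Stack k) → Set
Fitting G t S = ∃[ ε ] Plays G t allEmpty S ε

Emptying : ∀ {n k} → Graph n → ℕ → List (Stack k) → Set
Emptying G t S = ∃[ ε ] Plays G t allEmpty S ε × (∀ v → ε v ≡ nothing)

module _ {n : ℕ} (G : Graph n) (t : ℕ) (1≤n : 1 ≤ n) (2≤t : 2 ≤ t) where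

  fitMain-run : ∀ {k} (S : List (Stack k)) → 1 ≤ length S → All (λ s → height s ≤ t) S →
    ∀ h → Initial G t S h → Outcomes.Outcome G t S fitMain h (Fitting G t S) 32
  fitMain-run {zero} S 1≤s bounded h init = contradiction (stacks⇒colour {S = S} 1≤s) (λ ())
  fitMain-run {suc zero} S 1≤s bounded h init =
    Outcomes.outcome-else G t S 32 (cong (_∸ 1) (proj₁ (proj₂ init)))
      (Outcomes.outcome-map G t S 32 32 ≤-refl (λ (ε , play , _) → ε , play) (λ (ε , play) → ε , play , tt)
        (SingleColour.fit-run G t S 1≤n 2≤t 1≤s bounded h init))
  fitMain-run {suc (suc k)} S 1≤s bounded h init =
    Outcomes.outcome-then G t S 32 (λ z → 0≢1+n (trans (sym z) (cong (_∸ 1) (proj₁ (proj₂ init)))))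
      (Outcomes.outcome-map G t S 32 32 ≤-refl (λ (ε , play , _) → ε , play) (λ (ε , play) → ε , play , tt)
        (Enumeration.Filling.many-run G t (λ _ → single) inp S inp-adjacent inp-stack (λ _ → refl)
          (s≤s (s≤s z≤n)) 2≤t 1≤n 1≤s bounded (λ _ → ⊤) (λ _ _ → tt) markAll ((suc (suc k) * t) ^ n) ≤-refl
          (Enumeration.Filling.markAll-run G t (λ _ → single) inp S inp-adjacent inp-stack
            (≤-trans (s≤s z≤n) (*-mono-≤ (s≤s (z≤n {suc k})) 2≤t))) h init))
    where open Memory G S

  emptyMain-run : ∀ {k} (S : List (Stack k)) → 1 ≤ length S → All (λ s → height s ≤ t) S →
    ∀ h → Initial G t S h → Outcomes.Outcome G t S emptyMain h (Emptying G t S) 131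
  emptyMain-run {zero} S 1≤s bounded h init = contradiction (stacks⇒colour {S = S} 1≤s) (λ ())
  emptyMain-run {suc zero} S 1≤s bounded h init =
    Outcomes.outcome-else G t S 131 (cong (_∸ 1) (proj₁ (proj₂ init)))
      (SingleColour.empty-run G t S 1≤n 2≤t 1≤s bounded h init)
  emptyMain-run {suc (suc k)} S 1≤s bounded h init =
    Outcomes.outcome-then G t S 131 (λ z → 0≢1+n (trans (sym z) (cong (_∸ 1) (proj₁ (proj₂ init)))))
      (Outcomes.outcome-map G t S 32 131 (≤ᵇ⇒≤ 32 131 _) (λ w → w) (λ w → w)
        (Enumeration.Filling.many-run G t (λ _ → single) inp S inp-adjacent inp-stack (λ _ → refl)
          (s≤s (s≤s z≤n)) 2≤t 1≤n 1≤s bounded (λ δ → ∀ v → δ v ≡ nothing)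
          (λ eq goal v → trans (sym (eq v)) (goal v)) markEmpty 0 z≤n
          (Enumeration.Filling.markEmpty-run G t (λ _ → single) inp S inp-adjacent inp-stack
            {{>-nonZero (≤-trans (s≤s z≤n) 2≤t)}}
            (≤-trans (s≤s z≤n) (*-mono-≤ (s≤s (z≤n {suc k})) 2≤t))) h init))
    where open Memory G S

plays-nil : ∀ {n k} {G : Graph n} {t} {S : List (Stack k)} {δ} → S ≡ [] → Plays G t δ S δ
plays-nil refl = done

some-vertex : ∀ {n} → 0 < n → Fin n
some-vertex {suc n} _ = zero

stuck : ∀ {n k} {G : Graph n} {t} {S : List (Stack k)} {δ ε} → n ≡ 0 → 0 < length S → ¬ Plays G t δ S ε
stuck refl lt (move () _ _)

theorem11 :
  let bound = λ (I : Instance) → let open Instance I in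
        length stacks * (colours * threshold) ^ vertices
  in DecidableInTime HeightsBounded FittingHexasort bound
   × DecidableInTime (λ I → HeightsBounded I × ColoursSuffice I) EmptyHexasort bound
theorem11 =
  decide HeightsBounded FittingHexasort (λ _ b → b) (λ _ eq → allEmpty , plays-nil eq)
    (λ _ eq lt (_ , play) → stuck eq lt play)
    (λ I pos t≤1 → let (ε , play , _) = unit-clears (Instance.graph I) (Instance.threshold I) t≤1 (some-vertex pos)
                                          (Instance.stacks I) allEmpty (λ _ → refl)
                   in ε , play)
    fitMain refl 32
    (λ I b 1≤n 2≤t 1≤s → fitMain-run (Instance.graph I) (Instance.threshold I) 1≤n 2≤t (Instance.stacks I) 1≤s b) ,
  decide (λ I → HeightsBounded I × ColoursSuffice I) EmptyHexasort (λ _ → proj₁)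
    (λ _ eq → allEmpty , plays-nil eq , λ _ → refl)
    (λ _ eq lt (_ , play , _) → stuck eq lt play)
    (λ I pos t≤1 → unit-clears (Instance.graph I) (Instance.threshold I) t≤1 (some-vertex pos)
                     (Instance.stacks I) allEmpty (λ _ → refl))
    emptyMain refl 131
    (λ I b 1≤n 2≤t 1≤s → emptyMain-run (Instance.graph I) (Instance.threshold I) 1≤n 2≤t (Instance.stacks I) 1≤s (proj₁ b))
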